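{- Let $p_E=1$, $\lambda_H,\lambda_E>0$, and let $d\ge1$ be an integer constant independent of $p_H$. Then under the ChainMatch(d) policy $\mathcal{C}(d)$ in steady-state, $$\lim_{p_H\to0}p_H\,w_H^{\mathcal{C}(d)}=\frac{\ln\left(\frac{\lambda_H}{\lambda_E}+1\right)}{\lambda_H}.$$ Consequently, $\lim_{p_H\to0}p_H\,w_H^{\mathcal{C}(d)}$ decreases with $\lambda_E$ (for fixed $\lambda_H$) and with $\lambda_H$ (for fixed $\lambda_E$).
   Context: Model: agents of two types $H$ (hard-to-match) and $E$ (easy-to-match) arrive to a market according to independent Poisson processes with rates $\lambda_H,\lambda_E>0$. Each agent owns an item; an agent of type $T\in\{H,E\}$ finds the item of any other agent compatible with probability $p_T$, independently over all ordered pairs; there is a directed edge from $i$ to $j$ if $j$ finds $i$'s item compatible. Here $p_H\in(0,1)$ is a parameter tending to $0$. A waiting agent leaves only when matched, i.e. when she receives a compatible item. Policy ChainMatch(d) ($\mathcal{C}(d)$): the market starts with $d$ altruistic agents, who give an item without requiring one; at all times there are exactly $d$ bridge agents (an altruistic agent who has not yet given, or an agent who has received an item but not yet given hers). When a new agent $i_1$ arrives: if no bridge agent has an edge to $i_1$, then $i_1$ joins the market and waits. Otherwise one of the bridge agents with an edge to $i_1$ is chosen uniformly at random and gives her item to $i_1$ (ceasing to be a bridge agent), starting a chain-segment. The chain-segment advances instantaneously by local search: if the current last agent has an edge to at least one waiting agent not already in the chain-segment, one of these is selected at random, with $H$ agents favored over $E$ agents, is matched by the last agent and becomes the new last agent;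 this is repeated until the last agent has no edge to a remaining waiting agent. All agents of the chain-segment leave the market, and the last one becomes a bridge agent. The numbers $[H_t,E_t]$ of waiting (non-bridge) $H$ and $E$ agents form a positive recurrent continuous-time Markov chain: since each edge is examined at most once, edges may be revealed only when examined. $[H^{\mathcal{C}(d)},E^{\mathcal{C}(d)}]$ has its stationary distribution (started from an empty market), and by Little's law the steady-state average waiting time of $H$ agents is $w_H^{\mathcal{C}(d)}=\mathbb{E}[H^{\mathcal{C}(d)}]/\lambda_H$. -}

module Defs where

open import Data.Bool.Base using (Bool; true; false; if_then_else_; _∨_)
open import Data.Integer.Base using (+_)
open import Data.Nat.Base as ℕ using (ℕ; zero; suc; _!)
import Data.Nat.Properties as ℕ
open import Data.Product.Base using (∃-syntax; _×_; _,_)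
open import Data.Product.Properties using (≡-dec)
open import Data.Rational.Base as ℚ using (ℚ; 0ℚ; 1ℚ; ½)
import Data.Rational.Properties as ℚ
open import Data.Rational.Solver using (module +-*-Solver)
open import Relation.Binary.PropositionalEquality
  using (_≡_; refl; sym; trans; cong; cong₂; subst)
open import Relation.Nullary using (¬_; yes; no; does; contradiction)

-- Cauchy sequences of rationals; equality of reals is _≃_ below.
record ℝ : Set where
  no-eta-equality
  field
    seq    : ℕ → ℚ
    cauchy : ∀ ε → 0ℚ ℚ.< ε →
             ∃[ N ] (∀ m n → N ℕ.≤ m → N ℕ.≤ n → ℚ.∣ seq m ℚ.- seq n ∣ ℚ.< ε)

open ℝ public

infix 4 _≃_ _<_ _≤_

record _≃_ (x y : ℝ) : Set where
  constructor mk≃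
  field
    eventually : ∀ ε → 0ℚ ℚ.< ε →
                 ∃[ N ] (∀ n → N ℕ.≤ n → ℚ.∣ seq x n ℚ.- seq y n ∣ ℚ.< ε)

record _<_ (x y : ℝ) : Set where
  constructor mk<
  field
    gap   : ℚ
    gap>0 : 0ℚ ℚ.< gap
    start : ℕ
    apart : ∀ n → start ℕ.≤ n → seq x n ℚ.+ gap ℚ.< seq y n

_≤_ : ℝ → ℝ → Set
x ≤ y = ¬ (y < x)

open +-*-Solver using (solve; _:+_; _:*_; _:-_; _:=_)

half+half : ∀ ε → ε ℚ.* ½ ℚ.+ ε ℚ.* ½ ≡ ε
half+half ε = trans (sym (ℚ.*-distribˡ-+ ε ½ ½)) (ℚ.*-identityʳ ε)

*-pos : ∀ {p q} → 0ℚ ℚ.< p → 0ℚ ℚ.< q → 0ℚ ℚ.< p ℚ.* q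
*-pos {p} {q} 0<p 0<q = ℚ.positive⁻¹ _
  {{ℚ.pos*pos⇒pos p {{ℚ.positive 0<p}} q {{ℚ.positive 0<q}}}}

half>0 : ∀ {ε} → 0ℚ ℚ.< ε → 0ℚ ℚ.< ε ℚ.* ½
half>0 0<ε = *-pos 0<ε (ℚ.positive⁻¹ ½)

0<1 : 0ℚ ℚ.< 1ℚ
0<1 = ℚ.positive⁻¹ 1ℚ

∣p∣≥0 : ∀ p → 0ℚ ℚ.≤ ℚ.∣ p ∣
∣p∣≥0 p = ℚ.nonNegative⁻¹ _ {{ℚ.∣-∣-nonNeg p}}

bound : (x : ℝ) → ∃[ B ] 0ℚ ℚ.< B × ∃[ N ] (∀ n → N ℕ.≤ n → ℚ.∣ seq x n ∣ ℚ.< B)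
bound x with cauchy x 1ℚ 0<1
... | N , close = B , 0<B , N , λ n N≤n → begin-strict
    ℚ.∣ seq x n ∣
      ≡⟨ cong ℚ.∣_∣ (split (seq x n) c) ⟩
    ℚ.∣ c ℚ.+ (seq x n ℚ.- c) ∣
      ≤⟨ ℚ.∣p+q∣≤∣p∣+∣q∣ c (seq x n ℚ.- c) ⟩
    ℚ.∣ c ∣ ℚ.+ ℚ.∣ seq x n ℚ.- c ∣
      <⟨ ℚ.+-monoʳ-< ℚ.∣ c ∣ (close n N N≤n ℕ.≤-refl) ⟩
    B ∎
  where
  open ℚ.≤-Reasoning
  c = seq x N
  B = ℚ.∣ c ∣ ℚ.+ 1ℚ
  0<B : 0ℚ ℚ.< B
  0<B = subst (ℚ._< B) (ℚ.+-identityˡ 0ℚ) (ℚ.+-mono-≤-< (∣p∣≥0 c) 0<1)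
  split : ∀ a b → a ≡ b ℚ.+ (a ℚ.- b)
  split = solve 2 (λ a b → a := b :+ (a :- b)) refl

recip : ℚ → ℚ
recip q with q ℚ.≟ 0ℚ
... | yes _  = 0ℚ
... | no q≢0 = ℚ.1/_ q {{ℚ.≢-nonZero q≢0}}

recip-inverse : ∀ q → 0ℚ ℚ.< q → recip q ℚ.* q ≡ 1ℚ
recip-inverse q 0<q with q ℚ.≟ 0ℚ
... | yes q≡0 = contradiction 0<q (ℚ.<-irrefl (sym q≡0))
... | no q≢0  = ℚ.*-inverseˡ q {{ℚ.≢-nonZero q≢0}}

recip>0 : ∀ q → 0ℚ ℚ.< q → 0ℚ ℚ.< recip q
recip>0 q 0<q with q ℚ.≟ 0ℚ
... | yes q≡0 = contradiction 0<q (ℚ.<-irrefl (sym q≡0))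
... | no q≢0  = ℚ.positive⁻¹ _ {{ℚ.1/pos⇒pos q {{ℚ.positive 0<q}}}}

share : ∀ A B ε → 0ℚ ℚ.< A → 0ℚ ℚ.< B → 0ℚ ℚ.< ε →
        ∃[ η ] 0ℚ ℚ.< η × A ℚ.* η ℚ.+ B ℚ.* η ≡ ε
share A B ε 0<A 0<B 0<ε = recip (A ℚ.+ B) ℚ.* ε , *-pos (recip>0 _ 0<A+B) 0<ε ,
  (begin-equality
    A ℚ.* (recip (A ℚ.+ B) ℚ.* ε) ℚ.+ B ℚ.* (recip (A ℚ.+ B) ℚ.* ε)
      ≡⟨ regroup A B (recip (A ℚ.+ B)) ε ⟩
    recip (A ℚ.+ B) ℚ.* (A ℚ.+ B) ℚ.* ε
      ≡⟨ cong (ℚ._* ε) (recip-inverse (A ℚ.+ B) 0<A+B) ⟩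
    1ℚ ℚ.* ε
      ≡⟨ ℚ.*-identityˡ ε ⟩
    ε ∎)
  where
  open ℚ.≤-Reasoning
  0<A+B : 0ℚ ℚ.< A ℚ.+ B
  0<A+B = subst (ℚ._< A ℚ.+ B) (ℚ.+-identityˡ 0ℚ) (ℚ.+-mono-< 0<A 0<B)
  regroup : ∀ a b r e → a ℚ.* (r ℚ.* e) ℚ.+ b ℚ.* (r ℚ.* e) ≡ r ℚ.* (a ℚ.+ b) ℚ.* e
  regroup = solve 4 (λ a b r e → a :* (r :* e) :+ b :* (r :* e) := r :* (a :+ b) :* e) refl

small : ∀ D η p q → 0ℚ ℚ.< D → ℚ.∣ p ∣ ℚ.< D → ℚ.∣ q ∣ ℚ.< η →
        ℚ.∣ p ℚ.* q ∣ ℚ.< D ℚ.* η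
small D η p q 0<D ∣p∣<D ∣q∣<η = begin-strict
  ℚ.∣ p ℚ.* q ∣          ≡⟨ ℚ.∣p*q∣≡∣p∣*∣q∣ p q ⟩
  ℚ.∣ p ∣ ℚ.* ℚ.∣ q ∣    ≤⟨ ℚ.*-monoʳ-≤-nonNeg ℚ.∣ q ∣ {{ℚ.∣-∣-nonNeg q}} (ℚ.<⇒≤ ∣p∣<D) ⟩
  D ℚ.* ℚ.∣ q ∣          <⟨ ℚ.*-monoʳ-<-pos D {{ℚ.positive 0<D}} ∣q∣<η ⟩
  D ℚ.* η                ∎
  where open ℚ.≤-Reasoning

close-* : ∀ a b c d A B η → 0ℚ ℚ.< A → 0ℚ ℚ.< B →
          ℚ.∣ a ∣ ℚ.< A → ℚ.∣ b ℚ.- d ∣ ℚ.< η →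
          ℚ.∣ d ∣ ℚ.< B → ℚ.∣ a ℚ.- c ∣ ℚ.< η →
          ℚ.∣ a ℚ.* b ℚ.- c ℚ.* d ∣ ℚ.< A ℚ.* η ℚ.+ B ℚ.* η
close-* a b c d A B η 0<A 0<B ∣a∣<A ∣b-d∣<η ∣d∣<B ∣a-c∣<η = begin-strict
  ℚ.∣ a ℚ.* b ℚ.- c ℚ.* d ∣
    ≡⟨ cong ℚ.∣_∣ (regroup a b c d) ⟩
  ℚ.∣ a ℚ.* (b ℚ.- d) ℚ.+ d ℚ.* (a ℚ.- c) ∣
    ≤⟨ ℚ.∣p+q∣≤∣p∣+∣q∣ (a ℚ.* (b ℚ.- d)) (d ℚ.* (a ℚ.- c)) ⟩
  ℚ.∣ a ℚ.* (b ℚ.- d) ∣ ℚ.+ ℚ.∣ d ℚ.* (a ℚ.- c) ∣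
    <⟨ ℚ.+-mono-< (small A η a (b ℚ.- d) 0<A ∣a∣<A ∣b-d∣<η)
                  (small B η d (a ℚ.- c) 0<B ∣d∣<B ∣a-c∣<η) ⟩
  A ℚ.* η ℚ.+ B ℚ.* η ∎
  where
  open ℚ.≤-Reasoning
  regroup : ∀ a b c d → a ℚ.* b ℚ.- c ℚ.* d ≡ a ℚ.* (b ℚ.- d) ℚ.+ d ℚ.* (a ℚ.- c)
  regroup = solve 4 (λ a b c d → a :* b :- c :* d := a :* (b :- d) :+ d :* (a :- c)) refl

fromℚ : ℚ → ℝ
fromℚ q .seq _ = q
fromℚ q .cauchy ε 0<ε =
  0 , λ _ _ _ _ → subst (ℚ._< ε) (sym (cong ℚ.∣_∣ (ℚ.+-inverseʳ q))) 0<ε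

fromℕ : ℕ → ℝ
fromℕ n = fromℚ (+ n ℚ./ 1)

0ℝ 1ℝ : ℝ
0ℝ = fromℚ 0ℚ
1ℝ = fromℚ 1ℚ

infixl 6 _+_ _-_
infixl 7 _*_ _/_
infix  8 -_
infixr 8 _^_

_+_ : ℝ → ℝ → ℝ
(x + y) .seq n = seq x n ℚ.+ seq y n
(x + y) .cauchy ε 0<ε
  with cauchy x (ε ℚ.* ½) (half>0 0<ε) | cauchy y (ε ℚ.* ½) (half>0 0<ε)
... | M , closeˣ | N , closeʸ = M ℕ.⊔ N , λ m n ≤m ≤n → begin-strict
    ℚ.∣ (seq x m ℚ.+ seq y m) ℚ.- (seq x n ℚ.+ seq y n) ∣
      ≡⟨ cong ℚ.∣_∣ (regroup (seq x m) (seq y m) (seq x n) (seq y n)) ⟩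
    ℚ.∣ (seq x m ℚ.- seq x n) ℚ.+ (seq y m ℚ.- seq y n) ∣
      ≤⟨ ℚ.∣p+q∣≤∣p∣+∣q∣ (seq x m ℚ.- seq x n) (seq y m ℚ.- seq y n) ⟩
    ℚ.∣ seq x m ℚ.- seq x n ∣ ℚ.+ ℚ.∣ seq y m ℚ.- seq y n ∣
      <⟨ ℚ.+-mono-< (closeˣ m n (ℕ.m⊔n≤o⇒m≤o M N ≤m) (ℕ.m⊔n≤o⇒m≤o M N ≤n))
                    (closeʸ m n (ℕ.m⊔n≤o⇒n≤o M N ≤m) (ℕ.m⊔n≤o⇒n≤o M N ≤n)) ⟩
    ε ℚ.* ½ ℚ.+ ε ℚ.* ½
      ≡⟨ half+half ε ⟩
    ε ∎
  where
  open ℚ.≤-Reasoning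
  regroup : ∀ a b c d → (a ℚ.+ b) ℚ.- (c ℚ.+ d) ≡ (a ℚ.- c) ℚ.+ (b ℚ.- d)
  regroup = solve 4 (λ a b c d → (a :+ b) :- (c :+ d) := (a :- c) :+ (b :- d)) refl

-_ : ℝ → ℝ
(- x) .seq n = ℚ.- seq x n
(- x) .cauchy ε 0<ε with cauchy x ε 0<ε
... | N , close = N , λ m n ≤m ≤n →
  subst (ℚ._< ε)
    (trans (sym (ℚ.∣-p∣≡∣p∣ (seq x m ℚ.- seq x n)))
           (cong ℚ.∣_∣ (ℚ.neg-distrib-+ (seq x m) (ℚ.- seq x n))))
    (close m n ≤m ≤n)

_-_ : ℝ → ℝ → ℝ
x - y = x + - y

_*_ : ℝ → ℝ → ℝ
(x * y) .seq n = seq x n ℚ.* seq y n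
(x * y) .cauchy ε 0<ε =
  let A , 0<A , K , ∣x∣<A = bound x
      B , 0<B , L , ∣y∣<B = bound y
      η , 0<η , A*η+B*η≡ε = share A B ε 0<A 0<B 0<ε
      M , closeˣ = cauchy x η 0<η
      N , closeʸ = cauchy y η 0<η
      KL≤ : ∀ {n} → (K ℕ.⊔ L) ℕ.⊔ (M ℕ.⊔ N) ℕ.≤ n → K ℕ.⊔ L ℕ.≤ n
      KL≤ = ℕ.m⊔n≤o⇒m≤o (K ℕ.⊔ L) (M ℕ.⊔ N)
      MN≤ : ∀ {n} → (K ℕ.⊔ L) ℕ.⊔ (M ℕ.⊔ N) ℕ.≤ n → M ℕ.⊔ N ℕ.≤ n
      MN≤ = ℕ.m⊔n≤o⇒n≤o (K ℕ.⊔ L) (M ℕ.⊔ N)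
  in (K ℕ.⊔ L) ℕ.⊔ (M ℕ.⊔ N) , λ m n ≤m ≤n →
    subst (ℚ.∣ seq x m ℚ.* seq y m ℚ.- seq x n ℚ.* seq y n ∣ ℚ.<_) A*η+B*η≡ε
      (close-* (seq x m) (seq y m) (seq x n) (seq y n) A B η 0<A 0<B
        (∣x∣<A m (ℕ.m⊔n≤o⇒m≤o K L (KL≤ ≤m)))
        (closeʸ m n (ℕ.m⊔n≤o⇒n≤o M N (MN≤ ≤m)) (ℕ.m⊔n≤o⇒n≤o M N (MN≤ ≤n)))
        (∣y∣<B n (ℕ.m⊔n≤o⇒n≤o K L (KL≤ ≤n)))
        (closeˣ m n (ℕ.m⊔n≤o⇒m≤o M N (MN≤ ≤m)) (ℕ.m⊔n≤o⇒m≤o M N (MN≤ ≤n))))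

record Positive (x : ℝ) : Set where
  constructor mkPositive
  field
    0<x : 0ℝ < x

-- The junk value recip 0ℚ = 0ℚ occurs at finitely many indices at most.
inverse : (x : ℝ) → 0ℝ < x → ℝ
inverse x 0<x .seq n = recip (seq x n)
inverse x (mk< δ 0<δ K 0+δ<x) .cauchy ε 0<ε
  with cauchy x (ε ℚ.* (δ ℚ.* δ)) (*-pos 0<ε (*-pos 0<δ 0<δ))
... | N , close = K ℕ.⊔ N , λ m n ≤m ≤n →
  near (seq x m) (seq x n) (δ<x m (ℕ.m⊔n≤o⇒m≤o K N ≤m)) (δ<x n (ℕ.m⊔n≤o⇒m≤o K N ≤n))
       (close n m (ℕ.m⊔n≤o⇒n≤o K N ≤n) (ℕ.m⊔n≤o⇒n≤o K N ≤m))
  where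
  open ℚ.≤-Reasoning
  δ<x : ∀ n → K ℕ.≤ n → δ ℚ.< seq x n
  δ<x n K≤n = subst (ℚ._< seq x n) (ℚ.+-identityˡ δ) (0+δ<x n K≤n)
  regroup : ∀ r s a b → (r ℚ.- s) ℚ.* (a ℚ.* b) ≡ (r ℚ.* a) ℚ.* b ℚ.- (s ℚ.* b) ℚ.* a
  regroup = solve 4 (λ r s a b → (r :- s) :* (a :* b) := (r :* a) :* b :- (s :* b) :* a) refl
  near : ∀ a b → δ ℚ.< a → δ ℚ.< b → ℚ.∣ b ℚ.- a ∣ ℚ.< ε ℚ.* (δ ℚ.* δ) →
         ℚ.∣ recip a ℚ.- recip b ∣ ℚ.< ε
  near a b δ<a δ<b ∣b-a∣< =
    ℚ.*-cancelʳ-<-nonNeg (a ℚ.* b) {{ℚ.nonNegative (ℚ.<⇒≤ 0<ab)}} (begin-strict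
      ℚ.∣ recip a ℚ.- recip b ∣ ℚ.* (a ℚ.* b)
        ≡⟨ cong (ℚ.∣ recip a ℚ.- recip b ∣ ℚ.*_) (ℚ.0≤p⇒∣p∣≡p (ℚ.<⇒≤ 0<ab)) ⟨
      ℚ.∣ recip a ℚ.- recip b ∣ ℚ.* ℚ.∣ a ℚ.* b ∣
        ≡⟨ ℚ.∣p*q∣≡∣p∣*∣q∣ (recip a ℚ.- recip b) (a ℚ.* b) ⟨
      ℚ.∣ (recip a ℚ.- recip b) ℚ.* (a ℚ.* b) ∣
        ≡⟨ cong ℚ.∣_∣ clear ⟩
      ℚ.∣ b ℚ.- a ∣
        <⟨ ∣b-a∣< ⟩
      ε ℚ.* (δ ℚ.* δ)
        <⟨ ℚ.*-monoʳ-<-pos ε {{ℚ.positive 0<ε}} δδ<ab ⟩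
      ε ℚ.* (a ℚ.* b) ∎)
    where
    0<a = ℚ.<-trans 0<δ δ<a
    0<b = ℚ.<-trans 0<δ δ<b
    0<ab = *-pos 0<a 0<b
    δδ<ab : δ ℚ.* δ ℚ.< a ℚ.* b
    δδ<ab = ℚ.<-trans (ℚ.*-monoʳ-<-pos δ {{ℚ.positive 0<δ}} δ<b)
                      (ℚ.*-monoˡ-<-pos b {{ℚ.positive 0<b}} δ<a)
    clear : (recip a ℚ.- recip b) ℚ.* (a ℚ.* b) ≡ b ℚ.- a
    clear = trans (regroup (recip a) (recip b) a b)
      (cong₂ ℚ._-_
        (trans (cong (ℚ._* b) (recip-inverse a 0<a)) (ℚ.*-identityˡ b))
        (trans (cong (ℚ._* a) (recip-inverse b 0<b)) (ℚ.*-identityˡ a)))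

_/_ : (x y : ℝ) → {{Positive y}} → ℝ
_/_ x y {{mkPositive 0<y}} = x * inverse y 0<y

_^_ : ℝ → ℕ → ℝ
x ^ zero  = 1ℝ
x ^ suc n = x * x ^ n

∣_-_∣<_ : ℝ → ℝ → ℝ → Set
∣ x - y ∣< ε = (x - y < ε) × (y - x < ε)

Converges : (ℕ → ℝ) → ℝ → Set
Converges s l = ∀ ε → 0ℝ < ε → ∃[ N ] (∀ n → N ℕ.≤ n → ∣ s n - l ∣< ε)

Σ< : ℕ → (ℕ → ℝ) → ℝ
Σ< zero    f = 0ℝ
Σ< (suc n) f = Σ< n f + f n

-- x = exp y, by the exponential series.
IsExp : ℝ → ℝ → Set
IsExp y x = Converges (λ n → Σ< n λ k → y ^ k * fromℚ (ℚ._/_ (+ 1) (k !) {{k ℕ.!≢0}})) x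

IsLn : ℝ → ℝ → Set
IsLn x y = IsExp y x

-- Finitely supported distributions, each given by its expectation
-- operator f ↦ 𝔼[f].
Dist : Set → Set
Dist A = (A → ℝ) → ℝ

return : ∀ {A} → A → Dist A
return a f = f a

infixl 1 _>>=_

_>>=_ : ∀ {A B} → Dist A → (A → Dist B) → Dist B
(m >>= k) f = m λ a → k a f

bernoulli : ℝ → Dist Bool
bernoulli p f = p * f true + (1ℝ - p) * f false

anyEdge : ℝ → ℕ → Dist Bool
anyEdge p zero    = return false
anyEdge p (suc n) = do
  first ← bernoulli p
  rest  ← anyEdge p n
  return (first ∨ rest)

-- Numbers of waiting H and E agents (bridge agents not counted).
State : Set
State = ℕ × ℕ

𝟙 : State → State → ℝ
𝟙 s t = if does (≡-dec ℕ._≟_ ℕ._≟_ s t) then 1ℝ else 0ℝ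

Pr : Dist State → State → ℝ
Pr m s = m (𝟙 s)

-- Sum over the quadrant by square partial sums; below it is only applied
-- to functions that are nonnegative off a single state, for which the order
-- of summation is immaterial.
HasSum : (State → ℝ) → ℝ → Set
HasSum f = Converges (λ n → Σ< n λ h → Σ< n λ e → f (h , e))

data AgentType : Set where
  H E : AgentType

module ChainMatch (λH λE pH pE : ℝ) (d : ℕ) where

  compatibility : AgentType → ℝ
  compatibility H = pH
  compatibility E = pE

  join : AgentType → State → State
  join H (h , e) = suc h , e
  join E (h , e) = h , suc e

  -- segment h e is the law of the numbers of agents left waiting once a
  -- chain-segment whose last agent is about to search among h waiting H and
  -- e waiting E agents has stopped.  Which agent of the favoured type is
  -- selected does not matter for the counts, since none of the edges leaving
  -- her towards the other waiting agents have been examined yet.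
  segment : ℕ → ℕ → Dist State
  segment zero    zero    = return (zero , zero)
  segment zero    (suc e) = do
    toE ← anyEdge pE (suc e)
    if toE then segment zero e else return (zero , suc e)
  segment (suc h) zero    = do
    toH ← anyEdge pH (suc h)
    if toH then segment h zero else return (suc h , zero)
  segment (suc h) (suc e) = do
    toH ← anyEdge pH (suc h)
    if toH then segment h (suc e) else do
      toE ← anyEdge pE (suc e)
      if toE then segment (suc h) e else return (suc h , suc e)

  -- State after an arrival of type T; the first edges examined are those
  -- from the d bridge agents to the new agent.
  arrival : AgentType → State → Dist State
  arrival T s@(h , e) = do
    matched ← anyEdge (compatibility T) d
    if matched then segment h e else return (join T s)

  -- Arrivals that leave the state unchanged occur in both terms and cancel.
  generator : State → State → ℝ
  generator s t = (λH * Pr (arrival H s) t + λE * Pr (arrival E s) t) - (λH + λE) * 𝟙 s t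

  record IsStationary (π : State → ℝ) : Set where
    field
      nonNegative : ∀ s → 0ℝ ≤ π s
      total       : HasSum π 1ℝ
      balance     : ∀ t → HasSum (λ s → π s * generator s t) 0ℝ

  IsMeanH : ℝ → Set
  IsMeanH m = ∃[ π ] IsStationary π × HasSum (λ s@(h , _) → fromℕ h * π s) m

  IsWaitingTimeH : {{Positive λH}} → ℝ → Set
  IsWaitingTimeH w = ∃[ m ] IsMeanH m × w ≃ m / λH

-- ℓ is the limit of pH · w_H as pH → 0⁺, for pE = 1.
IsScaledLimit : (λH λE : ℝ) → {{Positive λH}} → ℕ → ℝ → Set
IsScaledLimit λH λE d ℓ =
  ∀ ε → 0ℝ < ε → ∃[ δ ] 0ℝ < δ ×
    (∀ pH → 0ℝ < pH → pH < 1ℝ → pH < δ →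
     ∀ w → ChainMatch.IsWaitingTimeH λH λE pH 1ℝ d w → ∣ pH * w - ℓ ∣< ε)

{-# OPTIONS --safe #-}
-- Since pE = 1, a state with waiting E agents carries no stationary mass.  Put
-- r = 1 - pH and ρ = λH r ^ d / (λH + λE).  The flows across the cut between h
-- and h + 1 waiting H agents balance when (1 - r ^ (h + 1)) π (h + 1) = ρ π h,
-- which determines π up to normalisation.  Testing this relation against
-- r ^ (k h) and h r ^ (k h) for every k yields
--
--   E[H] = Σ_k ρ r ^ k / (1 - ρ r ^ k).
--
-- With z k = 1 - ρ r ^ k we have z (k + 1) - z k = pH ρ r ^ k, so pH E[H] is an
-- upper Riemann sum of 1 / z over [1 - ρ , 1], and the lower sum differs from
-- it by O(pH).  The inequalities exp x (1 + s) ≤ exp (x + s) and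
-- exp (x + s) (1 - s) ≤ exp x compare such sums with the logarithm, and with
-- x = λH / λE and L = ln (1 + x) this gives
--
--   L - d pH x ≤ pH E[H] ≤ L + pH x.

module Submission where

open import Defs
open import Algebra.Bundles using (CommutativeRing)
import Algebra.Solver.Ring as RingSolver
open import Algebra.Solver.Ring.AlmostCommutativeRing
  using (fromCommutativeRing; _-Raw-AlmostCommutative⟶_)
open import Data.Bool.Base using (true; false; if_then_else_)
open import Data.Empty using (⊥; ⊥-elim)
open import Data.Integer.Base as ℤ using (+_; +≤+)
import Data.Integer.Properties as ℤ
open import Data.Maybe.Base using (Maybe; just; nothing)
open import Data.Nat.Base as ℕ using (ℕ; zero; suc; s≤s; _!)
import Data.Nat.Properties as ℕ
open import Data.Product using (∃-syntax; ∃!; _×_; _,_; proj₁; proj₂)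
open import Data.Product.Properties using (≡-dec)
open import Data.Rational.Base as ℚ using (ℚ; 0ℚ; 1ℚ; ½)
import Data.Rational.Properties as ℚ
open import Data.Rational.Solver renaming (module +-*-Solver to ℚS)
open import Data.Rational.Unnormalised.Base as ℚᵘ using (mkℚᵘ; *≡*; *≤*)
import Data.Rational.Unnormalised.Properties as ℚᵘ
open import Data.Sum.Base using (_⊎_; inj₁; inj₂; [_,_]′)
open import Level using (0ℓ)
import Relation.Binary.Reasoning.Base.Triple as Triple
open import Relation.Binary.PropositionalEquality
  using (_≡_; refl; sym; trans; cong; subst)
open import Relation.Binary.Structures using (IsEquivalence; IsPreorder)
open import Relation.Nullary using (¬_; Dec; yes; no)
open import Relation.Nullary.Decidable using (dec-true; dec-false)

-- The balance equation of a single state contains an infinite sum, since a segment may lead from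
-- any larger j down to h. Multiplying the sum for h by r turns it into a finite term plus a
-- multiple of the sum for h + 1. Balance at h and at h + 1 evaluates both sums, so they can be
-- eliminated, and the cut equation follows by induction on h.
--
-- If F k and D k denote the two tested expectations, the cut equation gives F (k + 1) = z k F k and
-- D (k + 1) = z k D k - ρ r ^ k F k. Hence D k / F k starts at E[H] and drops by ρ r ^ k / z k at
-- each step. It tends to 0, because D k ≤ r ^ k E[H] while F k never falls below the mass of h = 0.
--
-- The term d pH x stems from H agents matched on arrival: (1 - ρ) (1 + x) is 1 + x (1 - r ^ d), not
-- 1, and 1 - r ^ d ≤ d pH.
--
-- The order on the reals is undecidable and `_≤_` is a negation. Bounded monotone sums therefore
-- need explicit tail estimates in order to converge, and most inequalities are proved by exhibiting
-- the difference of the two sides.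

-- Eventual properties and rational inequalities

Ev : (ℕ → Set) → Set
Ev P = ∃[ N ] (∀ n → N ℕ.≤ n → P n)

ev-map : ∀ {P Q : ℕ → Set} → (∀ n → P n → Q n) → Ev P → Ev Q
ev-map f (N , p) = N , λ n N≤n → f n (p n N≤n)

ev-map₂ : ∀ {P Q R : ℕ → Set} → (∀ n → P n → Q n → R n) → Ev P → Ev Q → Ev R
ev-map₂ f (M , p) (N , q) = M ℕ.⊔ N , λ n ≤n →
  f n (p n (ℕ.m⊔n≤o⇒m≤o M N ≤n)) (q n (ℕ.m⊔n≤o⇒n≤o M N ≤n))

ev-const : ∀ {P : Set} → Ev (λ _ → P) → P
ev-const (N , p) = p N ℕ.≤-refl

pos+ : ∀ {p q} → 0ℚ ℚ.< p → 0ℚ ℚ.< q → 0ℚ ℚ.< p ℚ.+ q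
pos+ = ℚ.+-mono-<

-- Estimates on sequence entries are kept in the form `0ℚ < e`: positive hypotheses are added up,
-- and the ring solver matches their sum with the goal.
pos-by : ∀ {p q} → 0ℚ ℚ.< p → p ≡ q → 0ℚ ℚ.< q
pos-by 0<p p≡q = subst (0ℚ ℚ.<_) p≡q 0<p

ℚ<⇒diff : ∀ {p q} → p ℚ.< q → 0ℚ ℚ.< q ℚ.- p
ℚ<⇒diff {p} {q} p<q = subst (ℚ._< q ℚ.- p) (ℚ.+-inverseʳ p) (ℚ.+-monoˡ-< (ℚ.- p) p<q)

diff⇒ℚ< : ∀ {p q} → 0ℚ ℚ.< q ℚ.- p → p ℚ.< q
diff⇒ℚ< {p} {q} 0<d = subst (ℚ._< q) (ℚ.+-identityʳ p)
  (subst (p ℚ.+ 0ℚ ℚ.<_) (eq p q) (ℚ.+-monoʳ-< p 0<d))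
  where
  open ℚS
  eq : ∀ p q → p ℚ.+ (q ℚ.- p) ≡ q
  eq = solve 2 (λ p q → p :+ (q :- p) := q) refl

p≤∣p∣ : ∀ p → p ℚ.≤ ℚ.∣ p ∣
p≤∣p∣ p with ℚ.≤-total 0ℚ p
... | inj₁ 0≤p = ℚ.≤-reflexive (sym (ℚ.0≤p⇒∣p∣≡p 0≤p))
... | inj₂ p≤0 = ℚ.≤-trans p≤0 (ℚ.0≤∣p∣ p)

abs-pos⁺ : ∀ {η} p → ℚ.∣ p ∣ ℚ.< η → 0ℚ ℚ.< η ℚ.- p
abs-pos⁺ p ∣p∣<η = ℚ<⇒diff (ℚ.≤-<-trans (p≤∣p∣ p) ∣p∣<η)

abs-pos⁻ : ∀ {η} p → ℚ.∣ p ∣ ℚ.< η → 0ℚ ℚ.< η ℚ.+ p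
abs-pos⁻ {η} p ∣p∣<η = pos-by (abs-pos⁺ (ℚ.- p) (subst (ℚ._< η) (sym (ℚ.∣-p∣≡∣p∣ p)) ∣p∣<η))
  (solve 2 (λ η p → η :- :- p := η :+ p) refl η p)
  where open ℚS

abs-intro : ∀ {η} p → 0ℚ ℚ.< η ℚ.- p → 0ℚ ℚ.< η ℚ.+ p → ℚ.∣ p ∣ ℚ.< η
abs-intro {η} p 0<η-p 0<η+p with ℚ.∣p∣≡p∨∣p∣≡-p p
... | inj₁ ≡p  = subst (ℚ._< η) (sym ≡p) (diff⇒ℚ< 0<η-p)
... | inj₂ ≡-p = subst (ℚ._< η) (sym ≡-p) (diff⇒ℚ< (pos-by 0<η+p
    (solve 2 (λ η p → η :+ p := η :- :- p) refl η p)))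
  where open ℚS

-- The commutative ring of reals

≃-pointwise : ∀ {x y} → (∀ n → seq x n ≡ seq y n) → x ≃ y
≃-pointwise {x} {y} x≡y = mk≃ λ ε 0<ε → 0 , λ n _ → subst (ℚ._< ε)
  (sym (cong ℚ.∣_∣ (trans (cong (ℚ._- seq y n) (x≡y n)) (ℚ.+-inverseʳ (seq y n))))) 0<ε

≃-refl : ∀ {x} → x ≃ x
≃-refl = ≃-pointwise λ _ → refl

≃-sym : ∀ {x y} → x ≃ y → y ≃ x
≃-sym {x} {y} (mk≃ x≃y) = mk≃ λ ε 0<ε → ev-map (λ n close → subst (ℚ._< ε)
  (trans (sym (ℚ.∣-p∣≡∣p∣ (seq x n ℚ.- seq y n)))
         (cong ℚ.∣_∣ (solve 2 (λ a b → :- (a :- b) := b :- a) refl (seq x n) (seq y n)))) close)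
  (x≃y ε 0<ε)
  where open ℚS

≃-trans : ∀ {x y z} → x ≃ y → y ≃ z → x ≃ z
≃-trans {x} {y} {z} (mk≃ x≃y) (mk≃ y≃z) = mk≃ λ ε 0<ε → ev-map₂ (λ n p q →
  let a = seq x n ; b = seq y n ; c = seq z n in
  abs-intro (a ℚ.- c)
    (pos-by (pos+ (abs-pos⁺ (a ℚ.- b) p) (abs-pos⁺ (b ℚ.- c) q))
      (solve 4 (λ ε a b c → (ε :* con ½ :- (a :- b)) :+ (ε :* con ½ :- (b :- c)) :=
          ε :- (a :- c)) refl ε a b c))
    (pos-by (pos+ (abs-pos⁻ (a ℚ.- b) p) (abs-pos⁻ (b ℚ.- c) q))
      (solve 4 (λ ε a b c → (ε :* con ½ :+ (a :- b)) :+ (ε :* con ½ :+ (b :- c)) :=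
          ε :+ (a :- c)) refl ε a b c)))
  (x≃y (ε ℚ.* ½) (half>0 0<ε)) (y≃z (ε ℚ.* ½) (half>0 0<ε))
  where open ℚS

≃-isEquivalence : IsEquivalence _≃_
≃-isEquivalence = record { refl = ≃-refl ; sym = ≃-sym ; trans = ≃-trans }

+-cong : ∀ {x x′ y y′} → x ≃ x′ → y ≃ y′ → x + y ≃ x′ + y′
+-cong {x} {x′} {y} {y′} (mk≃ x≃x′) (mk≃ y≃y′) = mk≃ λ ε 0<ε → ev-map₂ (λ n p q →
  let a = seq x n ; b = seq y n ; c = seq x′ n ; d = seq y′ n in
  abs-intro ((a ℚ.+ b) ℚ.- (c ℚ.+ d))
    (pos-by (pos+ (abs-pos⁺ (a ℚ.- c) p) (abs-pos⁺ (b ℚ.- d) q))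
      (solve 5 (λ ε a b c d → (ε :* con ½ :- (a :- c)) :+ (ε :* con ½ :- (b :- d)) :=
          ε :- ((a :+ b) :- (c :+ d))) refl ε a b c d))
    (pos-by (pos+ (abs-pos⁻ (a ℚ.- c) p) (abs-pos⁻ (b ℚ.- d) q))
      (solve 5 (λ ε a b c d → (ε :* con ½ :+ (a :- c)) :+ (ε :* con ½ :+ (b :- d)) :=
          ε :+ ((a :+ b) :- (c :+ d))) refl ε a b c d)))
  (x≃x′ (ε ℚ.* ½) (half>0 0<ε)) (y≃y′ (ε ℚ.* ½) (half>0 0<ε))
  where open ℚS

-‿cong : ∀ {x y} → x ≃ y → - x ≃ - y
-‿cong {x} {y} (mk≃ x≃y) = mk≃ λ ε 0<ε → ev-map (λ n close → subst (ℚ._< ε)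
  (trans (sym (ℚ.∣-p∣≡∣p∣ (seq x n ℚ.- seq y n)))
         (cong ℚ.∣_∣ (ℚ.neg-distrib-+ (seq x n) (ℚ.- seq y n)))) close)
  (x≃y ε 0<ε)

*-cong : ∀ {x x′ y y′} → x ≃ x′ → y ≃ y′ → x * y ≃ x′ * y′
*-cong {x} {x′} {y} {y′} (mk≃ x≃x′) (mk≃ y≃y′) = mk≃ λ ε 0<ε →
  let A , 0<A , ∣x∣<A  = bound x
      B , 0<B , ∣y′∣<B = bound y′
      η , 0<η , Aη+Bη≡ε = share A B ε 0<A 0<B 0<ε
  in ev-map₂ (λ n (p , q) (p′ , q′) → subst (_ ℚ.<_) Aη+Bη≡ε
       (close-* (seq x n) (seq y n) (seq x′ n) (seq y′ n) A B η 0<A 0<B p q p′ q′))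
     (ev-map₂ (λ _ → _,_) ∣x∣<A (y≃y′ η 0<η))
     (ev-map₂ (λ _ → _,_) ∣y′∣<B (x≃x′ η 0<η))

ℝ-commutativeRing : CommutativeRing 0ℓ 0ℓ
ℝ-commutativeRing = record
  { Carrier = ℝ ; _≈_ = _≃_ ; _+_ = _+_ ; _*_ = _*_ ; -_ = -_ ; 0# = 0ℝ ; 1# = 1ℝ
  ; isCommutativeRing = record
    { isRing = record
      { +-isAbelianGroup = record
        { isGroup = record
          { isMonoid = record
            { isSemigroup = record
              { isMagma = record { isEquivalence = ≃-isEquivalence ; ∙-cong = +-cong }
              ; assoc = λ x y z → ≃-pointwise λ n → ℚ.+-assoc (seq x n) (seq y n) (seq z n)
              }
            ; identity = (λ x → ≃-pointwise λ n → ℚ.+-identityˡ (seq x n))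
                       , (λ x → ≃-pointwise λ n → ℚ.+-identityʳ (seq x n))
            }
          ; inverse = (λ x → ≃-pointwise λ n → ℚ.+-inverseˡ (seq x n))
                    , (λ x → ≃-pointwise λ n → ℚ.+-inverseʳ (seq x n))
          ; ⁻¹-cong = -‿cong
          }
        ; comm = λ x y → ≃-pointwise λ n → ℚ.+-comm (seq x n) (seq y n)
        }
      ; *-cong = *-cong
      ; *-assoc = λ x y z → ≃-pointwise λ n → ℚ.*-assoc (seq x n) (seq y n) (seq z n)
      ; *-identity = (λ x → ≃-pointwise λ n → ℚ.*-identityˡ (seq x n))
                   , (λ x → ≃-pointwise λ n → ℚ.*-identityʳ (seq x n))
      ; distrib = (λ x y z → ≃-pointwise λ n → ℚ.*-distribˡ-+ (seq x n) (seq y n) (seq z n))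
                , (λ x y z → ≃-pointwise λ n → ℚ.*-distribʳ-+ (seq x n) (seq y n) (seq z n))
      }
    ; *-comm = λ x y → ≃-pointwise λ n → ℚ.*-comm (seq x n) (seq y n)
    }
  }

-- Rational coefficients allow the solver to compute with constants such as `½` and to compare them
-- by the decidable equality of ℚ.
ℚ⟶ℝ : CommutativeRing.rawRing ℚ.+-*-commutativeRing
        -Raw-AlmostCommutative⟶ fromCommutativeRing ℝ-commutativeRing
ℚ⟶ℝ = record
  { ⟦_⟧ = fromℚ
  ; +-homo = λ _ _ → ≃-pointwise λ _ → refl
  ; *-homo = λ _ _ → ≃-pointwise λ _ → refl
  ; -‿homo = λ _ → ≃-pointwise λ _ → refl
  ; 0-homo = ≃-refl
  ; 1-homo = ≃-refl
  }

fromℚ-≟ : ∀ p q → Maybe (fromℚ p ≃ fromℚ q)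
fromℚ-≟ p q with p ℚ.≟ q
... | yes refl = just ≃-refl
... | no _     = nothing

module ℝS = RingSolver (CommutativeRing.rawRing ℚ.+-*-commutativeRing)
  (fromCommutativeRing ℝ-commutativeRing) ℚ⟶ℝ fromℚ-≟

-- The strict order

<-intro : ∀ {x y} g → 0ℚ ℚ.< g → Ev (λ n → 0ℚ ℚ.< seq y n ℚ.- (seq x n ℚ.+ g)) → x < y
<-intro g 0<g (N , p) = mk< g 0<g N λ n N≤n → diff⇒ℚ< (p n N≤n)

<-elim : ∀ {x y} (x<y : x < y) → Ev (λ n → 0ℚ ℚ.< seq y n ℚ.- (seq x n ℚ.+ _<_.gap x<y))
<-elim (mk< g 0<g N p) = N , λ n N≤n → ℚ<⇒diff (p n N≤n)

<-irrefl : ∀ {x} → ¬ (x < x)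
<-irrefl {x} x<x = ℚ.<-irrefl refl (ev-const (ev-map (λ n p →
  pos-by (pos+ p (_<_.gap>0 x<x))
    (solve 2 (λ a g → (a :- (a :+ g)) :+ g := con 0ℚ) refl (seq x n) (_<_.gap x<x))) (<-elim x<x)))
  where open ℚS

<-trans : ∀ {x y z} → x < y → y < z → x < z
<-trans {x} {y} {z} x<y y<z = <-intro g (_<_.gap>0 x<y) (ev-map₂ (λ n p q →
  pos-by (pos+ (pos+ p q) (_<_.gap>0 y<z))
    (solve 5 (λ a b c g h → ((b :- (a :+ g)) :+ (c :- (b :+ h))) :+ h := c :- (a :+ g)) refl
      (seq x n) (seq y n) (seq z n) g h)) (<-elim x<y) (<-elim y<z))
  where
  open ℚS
  g = _<_.gap x<y
  h = _<_.gap y<z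

<-asym : ∀ {x y} → x < y → ¬ (y < x)
<-asym x<y y<x = <-irrefl (<-trans x<y y<x)

<-respʳ-≃ : ∀ {x y z} → y ≃ z → x < y → x < z
<-respʳ-≃ {x} {y} {z} (mk≃ y≃z) x<y = <-intro (g ℚ.* ½) (half>0 0<g) (ev-map₂ (λ n p q →
  pos-by (pos+ p (abs-pos⁺ (seq y n ℚ.- seq z n) q))
    (solve 4 (λ a b c g → (b :- (a :+ g)) :+ (g :* con ½ :- (b :- c)) := c :- (a :+ g :* con ½)) refl
      (seq x n) (seq y n) (seq z n) g)) (<-elim x<y) (y≃z (g ℚ.* ½) (half>0 0<g)))
  where
  open ℚS
  g = _<_.gap x<y
  0<g = _<_.gap>0 x<y

+-monoˡ-< : ∀ {x y} z → x < y → x + z < y + z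
+-monoˡ-< {x} {y} z x<y = <-intro g (_<_.gap>0 x<y) (ev-map (λ n p →
  pos-by p (solve 4 (λ a b c g → b :- (a :+ g) := (b :+ c) :- ((a :+ c) :+ g)) refl
      (seq x n) (seq y n) (seq z n) g)) (<-elim x<y))
  where
  open ℚS
  g = _<_.gap x<y

neg-mono-< : ∀ {x y} → x < y → - y < - x
neg-mono-< {x} {y} x<y = <-intro g (_<_.gap>0 x<y) (ev-map (λ n p →
  pos-by p (solve 3 (λ a b g → b :- (a :+ g) := :- a :- (:- b :+ g)) refl
      (seq x n) (seq y n) g)) (<-elim x<y))
  where
  open ℚS
  g = _<_.gap x<y

<-respˡ-≃ : ∀ {x y z} → y ≃ z → y < x → z < x
<-respˡ-≃ {x} {y} {z} y≃z y<x = <-respʳ-≃ (neg-neg x) (<-respˡ (neg-mono-< (<-respʳ-≃ (-‿cong y≃z) (neg-mono-< y<x))))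
  where
  open ℝS
  neg-neg : ∀ x → - - x ≃ x
  neg-neg = solve 1 (λ x → :- :- x := x) ≃-refl
  <-respˡ : - - z < - - x → z < - - x
  <-respˡ (mk< g 0<g N p) = mk< g 0<g N λ n N≤n → subst (λ q → q ℚ.+ g ℚ.< ℚ.- ℚ.- seq x n)
    (ℚS.solve 1 (λ x → ℚS.:- ℚS.:- x ℚS.:= x) refl (seq z n)) (p n N≤n)

*-pos-ℝ : ∀ {x y} → 0ℝ < x → 0ℝ < y → 0ℝ < x * y
*-pos-ℝ {x} {y} 0<x 0<y = <-intro (g ℚ.* h) (*-pos 0<g 0<h) (ev-map₂ (λ n p q →
  pos-by (pos+ (pos+ (*-pos p q) (*-pos p 0<h)) (*-pos q 0<g))
    (solve 4 (λ a b g h → ((a :- (con 0ℚ :+ g)) :* (b :- (con 0ℚ :+ h)) :+ (a :- (con 0ℚ :+ g)) :* h)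
        :+ (b :- (con 0ℚ :+ h)) :* g := a :* b :- (con 0ℚ :+ g :* h)) refl
      (seq x n) (seq y n) g h)) (<-elim 0<x) (<-elim 0<y))
  where
  open ℚS
  g = _<_.gap 0<x
  h = _<_.gap 0<y
  0<g = _<_.gap>0 0<x
  0<h = _<_.gap>0 0<y

settle : ∀ x η → 0ℚ ℚ.< η → ∃[ N ] (∀ M → N ℕ.≤ M → ∀ n → N ℕ.≤ n → ℚ.∣ seq x n ℚ.- seq x M ∣ ℚ.< η)
settle x η 0<η with cauchy x η 0<η
... | N , close = N , λ M N≤M n N≤n → close n M N≤n N≤M

ℚ≤⇒diff : ∀ {p q} → p ℚ.≤ q → 0ℚ ℚ.≤ q ℚ.- p
ℚ≤⇒diff {p} {q} p≤q = subst (ℚ._≤ q ℚ.- p) (ℚ.+-inverseʳ p) (ℚ.+-monoˡ-≤ (ℚ.- p) p≤q)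

⅛ : ℚ
⅛ = ½ ℚ.* ½ ℚ.* ½

-- The rational test of z against x + g / 2 at one late index decides the alternative. The budget g
-- / 2 covers two later oscillations of at most g / 8 each and still leaves a gap of g / 8.
<-cotrans : ∀ {x y} → x < y → ∀ z → x < z ⊎ z < y
<-cotrans {x} {y} x<y z = decide (xM ℚ.+ g ℚ.* ½ ℚ.<? zM)
  where
  open ℚS
  above : ∀ a z a' z' g → ((z' ℚ.- (a' ℚ.+ g ℚ.* ½)) ℚ.+ g ℚ.* ⅛) ℚ.+ ((g ℚ.* ⅛ ℚ.- (a ℚ.- a')) ℚ.+ (g ℚ.* ⅛ ℚ.+ (z ℚ.- z')))
    ≡ z ℚ.- (a ℚ.+ g ℚ.* ⅛)
  above = solve 5 (λ a z a' z' g → ((z' :- (a' :+ g :* con ½)) :+ g :* con ⅛) :+ ((g :* con ⅛ :- (a :- a')) :+ (g :* con ⅛ :+ (z :- z'))) := z :- (a :+ g :* con ⅛)) refl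
  below : ∀ a b z a' z' g → (((a' ℚ.+ g ℚ.* ½) ℚ.- z') ℚ.+ g ℚ.* ⅛) ℚ.+ ((b ℚ.- (a ℚ.+ g)) ℚ.+ ((g ℚ.* ⅛ ℚ.+ (a ℚ.- a')) ℚ.+ (g ℚ.* ⅛ ℚ.- (z ℚ.- z')))) ≡ b ℚ.- (z ℚ.+ g ℚ.* ⅛)
  below = solve 6 (λ a b z a' z' g → (((a' :+ g :* con ½) :- z') :+ g :* con ⅛) :+ ((b :- (a :+ g)) :+ ((g :* con ⅛ :+ (a :- a')) :+ (g :* con ⅛ :- (z :- z')))) := b :- (z :+ g :* con ⅛)) refl
  g = _<_.gap x<y
  q = g ℚ.* ⅛
  0<q : 0ℚ ℚ.< q
  0<q = *-pos (_<_.gap>0 x<y) (ℚ.positive⁻¹ ⅛)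
  K = proj₁ (settle x q 0<q)
  L = proj₁ (settle z q 0<q)
  M = K ℕ.⊔ L
  xM = seq x M
  zM = seq z M
  x~ : Ev (λ n → ℚ.∣ seq x n ℚ.- xM ∣ ℚ.< q)
  x~ = K , proj₂ (settle x q 0<q) M (ℕ.m≤m⊔n K L)
  z~ : Ev (λ n → ℚ.∣ seq z n ℚ.- zM ∣ ℚ.< q)
  z~ = L , proj₂ (settle z q 0<q) M (ℕ.m≤n⊔m K L)
  decide : Dec (xM ℚ.+ g ℚ.* ½ ℚ.< zM) → x < z ⊎ z < y
  decide (yes p) = inj₁ (<-intro q 0<q (ev-map₂ (λ n u v →
    pos-by (pos+ (pos+ (ℚ<⇒diff p) 0<q) (pos+ (abs-pos⁺ (seq x n ℚ.- xM) u) (abs-pos⁻ (seq z n ℚ.- zM) v)))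
      (above (seq x n) (seq z n) xM zM g))
    x~ z~))
  decide (no ¬p) = inj₂ (<-intro q 0<q (ev-map₂ (λ n (u , v) w →
    pos-by (pos+ (ℚ.+-mono-≤-< (ℚ≤⇒diff (ℚ.≮⇒≥ ¬p)) 0<q) (pos+ w (pos+ (abs-pos⁻ (seq x n ℚ.- xM) u) (abs-pos⁺ (seq z n ℚ.- zM) v))))
      (below (seq x n) (seq y n) (seq z n) xM zM g))
    (ev-map₂ (λ _ → _,_) x~ z~) (<-elim x<y)))

-- The weak order

≤-refl : ∀ {x} → x ≤ x
≤-refl = <-irrefl

<⇒≤ : ∀ {x y} → x < y → x ≤ y
<⇒≤ x<y y<x = <-asym x<y y<x

-- Cotransitivity is what makes the negatively defined `_≤_` compose with `_<_`.
<-≤-trans : ∀ {x y z} → x < y → y ≤ z → x < z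
<-≤-trans {z = z} x<y y≤z = [ (λ x<z → x<z) , (λ z<y → ⊥-elim (y≤z z<y)) ]′ (<-cotrans x<y z)

≤-<-trans : ∀ {x y z} → x ≤ y → y < z → x < z
≤-<-trans {x} x≤y y<z = [ (λ y<x → ⊥-elim (x≤y y<x)) , (λ x<z → x<z) ]′ (<-cotrans y<z x)

≤-trans : ∀ {x y z} → x ≤ y → y ≤ z → x ≤ z
≤-trans x≤y y≤z z<x = y≤z (<-≤-trans z<x x≤y)

≃⇒≤ : ∀ {x y} → x ≃ y → x ≤ y
≃⇒≤ x≃y y<x = <-irrefl (<-respʳ-≃ x≃y y<x)

≤-isPreorder : IsPreorder _≃_ _≤_
≤-isPreorder = record { isEquivalence = ≃-isEquivalence ; reflexive = ≃⇒≤ ; trans = ≤-trans }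

module ≤-Reasoning = Triple ≤-isPreorder <-asym <-trans (<-respʳ-≃ , <-respˡ-≃)
  <⇒≤ <-≤-trans ≤-<-trans

fromℚ-mono-< : ∀ {p q} → p ℚ.< q → fromℚ p < fromℚ q
fromℚ-mono-< {p} {q} p<q = <-intro ((q ℚ.- p) ℚ.* ½) (half>0 0<d) (0 , λ _ _ →
  pos-by (half>0 0<d)
    (solve 2 (λ p q → (q :- p) :* con ½ := q :- (p :+ (q :- p) :* con ½)) refl p q))
  where
  open ℚS
  0<d = ℚ<⇒diff p<q

fromℚ-cancel-< : ∀ {p q} → fromℚ p < fromℚ q → p ℚ.< q
fromℚ-cancel-< {p} {q} p<q = diff⇒ℚ< (ev-const (ev-map (λ n u →
  pos-by (pos+ u (_<_.gap>0 p<q)) (solve 3 (λ p q g → (q :- (p :+ g)) :+ g :=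
      q :- p) refl p q (_<_.gap p<q))) (<-elim p<q)))
  where open ℚS

rational-below : ∀ {ε} → 0ℝ < ε → ∃[ q ] 0ℚ ℚ.< q × fromℚ q < ε
rational-below {ε} 0<ε = g ℚ.* ½ , half>0 0<g , <-intro (g ℚ.* ½) (half>0 0<g)
  (ev-map (λ n p → pos-by p (solve 2 (λ a g → a :- (con 0ℚ :+ g) :=
      a :- (g :* con ½ :+ g :* con ½)) refl (seq ε n) g))
    (<-elim 0<ε))
  where
  open ℚS
  g = _<_.gap 0<ε
  0<g = _<_.gap>0 0<ε

rational-above : ∀ x → ∃[ q ] 0ℚ ℚ.< q × x < fromℚ q
rational-above x = let B , 0<B , ∣x∣<B = bound x in B ℚ.+ 1ℚ , pos+ 0<B 0<1 , <-intro 1ℚ 0<1 (ev-map (λ n p →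
      pos-by (abs-pos⁺ (seq x n) p) (solve 2 (λ b a → b :- a :=
          (b :+ con 1ℚ) :- (a :+ con 1ℚ)) refl B (seq x n))) ∣x∣<B)
  where open ℚS

x<y⇒0<y-x : ∀ {x y} → x < y → 0ℝ < y - x
x<y⇒0<y-x {x} {y} x<y = <-respˡ-≃ (ℝS.solve 1 (λ x → x ℝS.:- x ℝS.:= ℝS.con 0ℚ) ≃-refl x) (+-monoˡ-< (- x) x<y)

0<y-x⇒x<y : ∀ {x y} → 0ℝ < y - x → x < y
0<y-x⇒x<y {x} {y} 0<y-x = <-respˡ-≃ (ℝS.solve 1 (λ x → ℝS.con 0ℚ ℝS.:+ x ℝS.:= x) ≃-refl x)
  (<-respʳ-≃ (ℝS.solve 2 (λ x y → (y ℝS.:- x) ℝS.:+ x ℝS.:= y) ≃-refl x y) (+-monoˡ-< x 0<y-x))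

-- The standard form of the inequality proofs: the difference d is given as an expression whose sign
-- is evident, and the identity is left to the ring solver.
<-by : ∀ {x y} d → 0ℝ < d → y ≃ x + d → x < y
<-by {x} {y} d 0<d y≃x+d = 0<y-x⇒x<y (<-respʳ-≃
  (≃-trans (ℝS.solve 2 (λ x d → d ℝS.:= (x ℝS.:+ d) ℝS.:- x) ≃-refl x d) (+-cong (≃-sym y≃x+d) ≃-refl)) 0<d)

≤-by : ∀ {x y} d → 0ℝ ≤ d → y ≃ x + d → x ≤ y
≤-by {x} {y} d 0≤d y≃x+d y<x = 0≤d (<-by (x - y) (x<y⇒0<y-x y<x)
  (≃-trans (ℝS.solve 2 (λ x d → ℝS.con 0ℚ ℝS.:= d ℝS.:+ (x ℝS.:- (x ℝS.:+ d))) ≃-refl x d)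
     (+-cong ≃-refl (+-cong ≃-refl (-‿cong (≃-sym y≃x+d))))))

x≤y⇒0≤y-x : ∀ {x y} → x ≤ y → 0ℝ ≤ y - x
x≤y⇒0≤y-x {x} {y} x≤y y-x<0 = x≤y (<-by (0ℝ - (y - x)) (x<y⇒0<y-x y-x<0)
  (ℝS.solve 2 (λ x y → x ℝS.:= y ℝS.:+ (ℝS.con 0ℚ ℝS.:- (y ℝS.:- x))) ≃-refl x y))

+-nonneg-pos : ∀ {x y} → 0ℝ ≤ x → 0ℝ < y → 0ℝ < x + y
+-nonneg-pos {x} {y} 0≤x 0<y = ≤-<-trans 0≤x (<-by y 0<y ≃-refl)

+-pos : ∀ {x y} → 0ℝ < x → 0ℝ < y → 0ℝ < x + y
+-pos {x} {y} 0<x 0<y = <-trans 0<x (<-by y 0<y ≃-refl)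

+-nonneg : ∀ {x y} → 0ℝ ≤ x → 0ℝ ≤ y → 0ℝ ≤ x + y
+-nonneg {x} {y} 0≤x 0≤y = ≤-trans 0≤x (≤-by y 0≤y ≃-refl)

-- If y < x, then ε = (x - y) / B with a rational B > c makes y + ε c smaller than x. A rational
-- bound is taken because it has an exact reciprocal.
≤-limit : ∀ {x y} c → (∀ ε → 0ℝ < ε → x ≤ y + ε * c) → x ≤ y
≤-limit {x} {y} c h y<x =
  let B , 0<B , c<B = rational-above c
      b = fromℚ B
      0<b = fromℚ-mono-< 0<B
      ε = (x - y) * fromℚ (recip B)
      0<ε = *-pos-ℝ (x<y⇒0<y-x y<x) (fromℚ-mono-< (recip>0 B 0<B))
  in h ε 0<ε (<-by (ε * (b - c)) (*-pos-ℝ 0<ε (x<y⇒0<y-x c<B))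
      (ℝ-eq x y c b (fromℚ (recip B)) (≃-pointwise λ _ → recip-inverse B 0<B)))
  where
  ℝ-eq : ∀ x y c b r → r * b ≃ 1ℝ → x ≃ (y + (x - y) * r * c) + (x - y) * r * (b - c)
  ℝ-eq x y c b r rb≃1 = ≃-trans
    (≃-trans (ℝS.solve 2 (λ x y → x ℝS.:= y ℝS.:+ (x ℝS.:- y) ℝS.:* ℝS.con 1ℚ) ≃-refl x y)
      (+-cong ≃-refl (*-cong ≃-refl (≃-sym rb≃1))))
    (ℝS.solve 5 (λ x y c b r → y ℝS.:+ (x ℝS.:- y) ℝS.:* (r ℝS.:* b) ℝS.:=
      (y ℝS.:+ (x ℝS.:- y) ℝS.:* r ℝS.:* c) ℝS.:+ (x ℝS.:- y) ℝS.:* r ℝS.:* (b ℝS.:- c)) ≃-refl x y c b r)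

≤-antisym : ∀ {x y} → x ≤ y → y ≤ x → x ≃ y
≤-antisym {x} {y} x≤y y≤x = mk≃ λ ε 0<ε →
  ev-map₂ (λ n p q → abs-intro (seq x n ℚ.- seq y n)
      (pos-by (pos+ p (_<_.gap>0 (x-y<ε ε 0<ε)))
        (solve 4 (λ a b e g → (e :- ((a :- b) :+ g)) :+ g :=
            e :- (a :- b)) refl (seq x n) (seq y n) ε (_<_.gap (x-y<ε ε 0<ε))))
      (pos-by (pos+ q (_<_.gap>0 (y-x<ε ε 0<ε)))
        (solve 4 (λ a b e g → (e :- ((b :- a) :+ g)) :+ g :=
            e :+ (a :- b)) refl (seq x n) (seq y n) ε (_<_.gap (y-x<ε ε 0<ε)))))
    (<-elim (x-y<ε ε 0<ε)) (<-elim (y-x<ε ε 0<ε))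
  where
  open ℚS
  diff< : ∀ {a b} → a ≤ b → ∀ ε → 0ℚ ℚ.< ε → a - b < fromℚ ε
  diff< {a} {b} a≤b ε 0<ε = [ (λ 0<a-b → ⊥-elim (a≤b (0<y-x⇒x<y 0<a-b))) , (λ h → h) ]′
    (<-cotrans (fromℚ-mono-< 0<ε) (a - b))
  x-y<ε = diff< x≤y
  y-x<ε = diff< y≤x

-- A nonnegative real does not split constructively into zero and positive. The goal is a negation,
-- however, so each factor may be assumed positive: otherwise it is zero by antisymmetry, and so is
-- the product.
*-nonneg : ∀ {x y} → 0ℝ ≤ x → 0ℝ ≤ y → 0ℝ ≤ x * y
*-nonneg {x} {y} 0≤x 0≤y xy<0 =
  x≰0 (λ 0<x → y≰0 (λ 0<y → <-asym xy<0 (*-pos-ℝ 0<x 0<y)))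
  where
  x≰0 : (0ℝ < x → ⊥) → ⊥
  x≰0 x≤0 = <-irrefl (<-respˡ-≃ (≃-trans (*-cong (≤-antisym x≤0 0≤x) (≃-refl {y}))
    (ℝS.solve 1 (λ y → ℝS.con 0ℚ ℝS.:* y ℝS.:= ℝS.con 0ℚ) ≃-refl y)) xy<0)
  y≰0 : (0ℝ < y → ⊥) → ⊥
  y≰0 y≤0 = <-irrefl (<-respˡ-≃ (≃-trans (*-cong (≃-refl {x}) (≤-antisym y≤0 0≤y))
    (ℝS.solve 1 (λ x → x ℝS.:* ℝS.con 0ℚ ℝS.:= ℝS.con 0ℚ) ≃-refl x)) xy<0)

open ℝS

-- Rewriting with a hypothesis inside the ring solver: x - y is exhibited as c times l - r. Nested
-- uses take several hypotheses into account.
≃-by : ∀ {x y l r} c → l ≃ r → x ≃ y + c * (l - r) → x ≃ y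
≃-by {x} {y} {l} {r} c l≃r x≃ = ≃-trans x≃ (≃-trans
  (+-cong (≃-refl {y}) (*-cong (≃-refl {c}) (+-cong l≃r (≃-refl { - r}))))
  (solve 3 (λ y c r → y :+ c :* (r :- r) := y) ≃-refl y c r))

+-mono-≤ : ∀ {x y u v} → x ≤ y → u ≤ v → x + u ≤ y + v
+-mono-≤ {x} {y} {u} {v} x≤y u≤v = ≤-by ((y - x) + (v - u)) (+-nonneg (x≤y⇒0≤y-x x≤y) (x≤y⇒0≤y-x u≤v))
  (solve 4 (λ x y u v → y :+ v := (x :+ u) :+ ((y :- x) :+ (v :- u))) ≃-refl x y u v)

neg-mono-≤ : ∀ {x y} → x ≤ y → - y ≤ - x
neg-mono-≤ {x} {y} x≤y = ≤-by (y - x) (x≤y⇒0≤y-x x≤y)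
  (solve 2 (λ x y → :- x := :- y :+ (y :- x)) ≃-refl x y)

*-monoʳ-≤ : ∀ {x y z} → 0ℝ ≤ z → x ≤ y → x * z ≤ y * z
*-monoʳ-≤ {x} {y} {z} 0≤z x≤y = ≤-by ((y - x) * z) (*-nonneg (x≤y⇒0≤y-x x≤y) 0≤z)
  (solve 3 (λ x y z → y :* z := x :* z :+ (y :- x) :* z) ≃-refl x y z)

*-monoˡ-≤ : ∀ {x y z} → 0ℝ ≤ z → x ≤ y → z * x ≤ z * y
*-monoˡ-≤ {x} {y} {z} 0≤z x≤y = ≤-by (z * (y - x)) (*-nonneg 0≤z (x≤y⇒0≤y-x x≤y))
  (solve 3 (λ x y z → z :* y := z :* x :+ z :* (y :- x)) ≃-refl x y z)

*-monoʳ-< : ∀ {x y z} → 0ℝ < z → x < y → x * z < y * z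
*-monoʳ-< {x} {y} {z} 0<z x<y = <-by ((y - x) * z) (*-pos-ℝ (x<y⇒0<y-x x<y) 0<z)
  (solve 3 (λ x y z → y :* z := x :* z :+ (y :- x) :* z) ≃-refl x y z)

*-cancelʳ-≤ : ∀ {x y z} → 0ℝ < z → x * z ≤ y * z → x ≤ y
*-cancelʳ-≤ 0<z xz≤yz y<x = xz≤yz (*-monoʳ-< 0<z y<x)

*-cancelʳ-≃ : ∀ {x y z} → 0ℝ < z → x * z ≃ y * z → x ≃ y
*-cancelʳ-≃ 0<z xz≃yz =
  ≤-antisym (*-cancelʳ-≤ 0<z (≃⇒≤ xz≃yz)) (*-cancelʳ-≤ 0<z (≃⇒≤ (≃-sym xz≃yz)))

0<1ℝ : 0ℝ < 1ℝ
0<1ℝ = fromℚ-mono-< 0<1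

0<½ℝ : 0ℝ < fromℚ ½
0<½ℝ = fromℚ-mono-< (ℚ.positive⁻¹ ½)

half>0ℝ : ∀ {ε} → 0ℝ < ε → 0ℝ < ε * fromℚ ½
half>0ℝ 0<ε = *-pos-ℝ 0<ε 0<½ℝ

half<ℝ : ∀ {ε} → 0ℝ < ε → ε * fromℚ ½ < ε
half<ℝ {ε} 0<ε = <-by (ε * fromℚ ½) (half>0ℝ 0<ε) (solve 1 (λ e → e := e :* con ½ :+ e :* con ½) ≃-refl ε)

-- Multiplicative inverses

eventually-pos : ∀ {x} → 0ℝ < x → Ev (λ n → 0ℚ ℚ.< seq x n)
eventually-pos {x} 0<x = ev-map (λ n p → pos-by (pos+ p (_<_.gap>0 0<x))
  (ℚS.solve 2 (λ a g → (a ℚS.:- (ℚS.con 0ℚ ℚS.:+ g)) ℚS.:+ g ℚS.:= a) refl (seq x n) (_<_.gap 0<x))) (<-elim 0<x)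

*-inverseʳ : ∀ x (0<x : 0ℝ < x) → x * inverse x 0<x ≃ 1ℝ
*-inverseʳ x 0<x = mk≃ λ ε 0<ε → ev-map (λ n 0<xn → subst (ℚ._< ε) (sym (eq (seq x n) 0<xn)) 0<ε) (eventually-pos 0<x)
  where
  eq : ∀ q → 0ℚ ℚ.< q → ℚ.∣ q ℚ.* recip q ℚ.- 1ℚ ∣ ≡ 0ℚ
  eq q 0<q = cong (λ r → ℚ.∣ r ℚ.- 1ℚ ∣) (trans (ℚ.*-comm q (recip q)) (recip-inverse q 0<q))

-- The reciprocal of a rational bound B of x is a positive number to compare with: an inverse below
-- it would give 1 < 1.
inverse>0 : ∀ x (0<x : 0ℝ < x) → 0ℝ < inverse x 0<x
inverse>0 x 0<x = [ (λ 0<y → 0<y) , (λ y<β → ⊥-elim (<-irrefl (begin-strict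
    1ℝ      ≈⟨ *-inverseʳ x 0<x ⟨
    x * y   ≈⟨ solve 2 (λ x y → x :* y := y :* x) ≃-refl x y ⟩
    y * x   <⟨ *-monoʳ-< 0<x y<β ⟩
    β * x   ≤⟨ *-monoˡ-≤ (<⇒≤ 0<β) (<⇒≤ x<b) ⟩
    β * fromℚ B   ≈⟨ ≃-pointwise (λ _ → recip-inverse B 0<B) ⟩
    1ℝ      ∎))) ]′ (<-cotrans 0<β y)
  where
  open ≤-Reasoning
  above = rational-above x
  B = proj₁ above
  0<B = proj₁ (proj₂ above)
  x<b = proj₂ (proj₂ above)
  y = inverse x 0<x
  β = fromℚ (recip B)
  0<β = fromℚ-mono-< (recip>0 B 0<B)

-- Natural numbers and reciprocals in ℝ

toℚᵘ-/1 : ∀ n → ℚ.toℚᵘ (+ n ℚ./ 1) ℚᵘ.≃ mkℚᵘ (+ n) 0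
toℚᵘ-/1 n = ℚ.toℚᵘ-fromℚᵘ (mkℚᵘ (+ n) 0)

/1-mono-≤ : ∀ {m n} → m ℕ.≤ n → + m ℚ./ 1 ℚ.≤ + n ℚ./ 1
/1-mono-≤ {m} {n} m≤n = ℚ.toℚᵘ-cancel-≤ (ℚᵘ.≤-respˡ-≃ (ℚᵘ.≃-sym (toℚᵘ-/1 m)) (ℚᵘ.≤-respʳ-≃ (ℚᵘ.≃-sym (toℚᵘ-/1 n))
  (*≤* (ℤ.*-monoʳ-≤-nonNeg (+ 1) (+≤+ m≤n)))))

/1-suc : ∀ n → + suc n ℚ./ 1 ≡ 1ℚ ℚ.+ + n ℚ./ 1
/1-suc n = ℚ.toℚᵘ-injective (ℚᵘ.≃-trans (toℚᵘ-/1 (suc n)) (ℚᵘ.≃-sym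
  (ℚᵘ.≃-trans (ℚ.toℚᵘ-homo-+ 1ℚ (+ n ℚ./ 1))
  (ℚᵘ.≃-trans (ℚᵘ.+-congʳ (ℚ.toℚᵘ 1ℚ) (toℚᵘ-/1 n))
    (*≡* (cong (ℤ._* + 1) (cong (ℤ._+_ (+ 1)) (ℤ.*-identityʳ (+ n)))))))))

1/n*n≡1 : ∀ n .{{_ : ℕ.NonZero n}} → (+ 1 ℚ./ n) ℚ.* (+ n ℚ./ 1) ≡ 1ℚ
1/n*n≡1 n@(suc k) = ℚ.toℚᵘ-injective (ℚᵘ.≃-trans (ℚ.toℚᵘ-homo-* (+ 1 ℚ./ n) (+ n ℚ./ 1))
  (ℚᵘ.≃-trans (ℚᵘ.*-cong (ℚ.toℚᵘ-fromℚᵘ (mkℚᵘ (+ 1) k)) (toℚᵘ-/1 n))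
    (*≡* (trans (ℤ.*-identityʳ (+ 1 ℤ.* + n)) (trans (ℤ.*-identityˡ (+ n))
      (sym (trans (ℤ.*-identityˡ (+ n ℤ.* + 1)) (ℤ.*-identityʳ (+ n)))))))))

fromℕ-suc : ∀ n → fromℕ (suc n) ≃ 1ℝ + fromℕ n
fromℕ-suc n = ≃-pointwise λ _ → /1-suc n

/1≥0 : ∀ n → 0ℚ ℚ.≤ + n ℚ./ 1
/1≥0 n = /1-mono-≤ {0} {n} ℕ.z≤n

/1>0 : ∀ n → 0ℚ ℚ.< + suc n ℚ./ 1
/1>0 n = subst (0ℚ ℚ.<_) (sym (/1-suc n)) (ℚ.<-≤-trans 0<1 (subst (ℚ._≤ 1ℚ ℚ.+ + n ℚ./ 1) (ℚ.+-identityʳ 1ℚ) (ℚ.+-monoʳ-≤ 1ℚ (/1≥0 n))))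

fromℚ-mono-≤ : ∀ {p q} → p ℚ.≤ q → fromℚ p ≤ fromℚ q
fromℚ-mono-≤ p≤q q<p = ℚ.<-irrefl refl (ℚ.≤-<-trans p≤q (fromℚ-cancel-< q<p))

fromℚ-cancel-≤ : ∀ {p q} → fromℚ p ≤ fromℚ q → p ℚ.≤ q
fromℚ-cancel-≤ {p} {q} p≤q = ℚ.≮⇒≥ (λ q<p → p≤q (fromℚ-mono-< q<p))

fromℕ-mono-≤ : ∀ {m n} → m ℕ.≤ n → fromℕ m ≤ fromℕ n
fromℕ-mono-≤ m≤n = fromℚ-mono-≤ (/1-mono-≤ m≤n)

fromℕ≥0 : ∀ n → 0ℝ ≤ fromℕ n
fromℕ≥0 n = fromℚ-mono-≤ (/1≥0 n)

fromℕ>0 : ∀ n → 0ℝ < fromℕ (suc n)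
fromℕ>0 n = fromℚ-mono-< (/1>0 n)

-- The denominator is at least 1.
numerator-bound : ∀ p → 0ℚ ℚ.< p → p ℚ.≤ + ℤ.∣ ℚ.↥ p ∣ ℚ./ 1
numerator-bound (ℚ.mkℚ (+ n) d c) _ = ℚ.toℚᵘ-cancel-≤ (ℚᵘ.≤-respʳ-≃ (ℚᵘ.≃-sym (toℚᵘ-/1 n))
  (*≤* (ℤ.*-monoˡ-≤-nonNeg (+ n) (+≤+ (ℕ.s≤s ℕ.z≤n)))))
numerator-bound p@(ℚ.mkℚ ℤ.-[1+ n ] d c) 0<p = ℚ.≤-trans (ℚ.<⇒≤ (ℚ.negative⁻¹ p)) (/1≥0 (suc n))

archimedean : ∀ x → ∃[ n ] x < fromℕ n
archimedean x = let q , 0<q , x<q = rational-above x in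
  ℤ.∣ ℚ.↥ q ∣ , <-≤-trans x<q (fromℚ-mono-≤ (numerator-bound q 0<q))

-- Completeness

abstract
  unit : ℕ → ℚ
  unit k = + 1 ℚ./ suc k

  unit>0 : ∀ k → 0ℚ ℚ.< unit k
  unit>0 k = ℚ.positive⁻¹ (+ 1 ℚ./ suc k) {{ℚ.normalize-pos 1 (suc k)}}

  unit*suc : ∀ k → unit k ℚ.* (+ suc k ℚ./ 1) ≡ 1ℚ
  unit*suc k = 1/n*n≡1 (suc k)

unit-small : ∀ {ε} → 0ℝ < ε → Ev (λ k → fromℚ (unit k) ≤ ε)
unit-small {ε} 0<ε = let n , ε⁻¹<n = archimedean (inverse ε 0<ε) in n , λ k n≤k ε<u → <-irrefl (begin-strict
    1ℝ ≈⟨ *-inverseʳ ε 0<ε ⟨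
    ε * inverse ε 0<ε <⟨ *-monoʳ-< (inverse>0 ε 0<ε) ε<u ⟩
    fromℚ (unit k) * inverse ε 0<ε ≤⟨ *-monoˡ-≤ (0≤u k) (<⇒≤ ε⁻¹<n) ⟩
    fromℚ (unit k) * fromℕ n ≤⟨ *-monoˡ-≤ (0≤u k) (fromℕ-mono-≤ (ℕ.m≤n⇒m≤1+n n≤k)) ⟩
    fromℚ (unit k) * fromℕ (suc k) ≈⟨ ≃-pointwise (λ _ → unit*suc k) ⟩
    1ℝ ∎)
  where
  open ≤-Reasoning
  0≤u : ∀ k → 0ℝ ≤ fromℚ (unit k)
  0≤u k = <⇒≤ (fromℚ-mono-< (unit>0 k))

unit-smallℚ : ∀ {ε} → 0ℚ ℚ.< ε → Ev (λ k → unit k ℚ.≤ ε)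
unit-smallℚ 0<ε = ev-map (λ _ → fromℚ-cancel-≤) (unit-small (fromℚ-mono-< 0<ε))

≤-from-seq : ∀ {x q} → Ev (λ n → 0ℚ ℚ.< q ℚ.- seq x n) → x ≤ fromℚ q
≤-from-seq {x} {q} e q<x = ℚ.<-irrefl refl (ev-const (ev-map₂ (λ n u v →
  pos-by (pos+ (pos+ u v) (_<_.gap>0 q<x)) (ℚS.solve 3 (λ q a g → ((q ℚS.:- a) ℚS.:+ (a ℚS.:- (q ℚS.:+ g))) ℚS.:+ g ℚS.:= ℚS.con 0ℚ) refl q (seq x n) (_<_.gap q<x)))
  e (<-elim q<x)))

≥-from-seq : ∀ {x q} → Ev (λ n → 0ℚ ℚ.< seq x n ℚ.- q) → fromℚ q ≤ x
≥-from-seq {x} {q} e x<q = ℚ.<-irrefl refl (ev-const (ev-map₂ (λ n u v →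
  pos-by (pos+ (pos+ u v) (_<_.gap>0 x<q)) (ℚS.solve 3 (λ q a g → ((a ℚS.:- q) ℚS.:+ (q ℚS.:- (a ℚS.:+ g))) ℚS.:+ g ℚS.:= ℚS.con 0ℚ) refl q (seq x n) (_<_.gap x<q)))
  e (<-elim x<q)))

abstract
  approximate : ∀ x η → 0ℚ ℚ.< η → ∃[ q ] (x ≤ fromℚ (q ℚ.+ η)) × (fromℚ (q ℚ.- η) ≤ x)
  approximate x η 0<η = q
    , ≤-from-seq (J , λ n ≤n → pos-by (abs-pos⁺ (seq x n ℚ.- q) (close n J ≤n ℕ.≤-refl))
        (ℚS.solve 3 (λ u a q → u ℚS.:- (a ℚS.:- q) ℚS.:= (q ℚS.:+ u) ℚS.:- a) refl η (seq x n) q))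
    , ≥-from-seq (J , λ n ≤n → pos-by (abs-pos⁻ (seq x n ℚ.- q) (close n J ≤n ℕ.≤-refl))
        (ℚS.solve 3 (λ u a q → u ℚS.:+ (a ℚS.:- q) ℚS.:= a ℚS.:- (q ℚS.:- u)) refl η (seq x n) q))
    where
    J : ℕ
    J = proj₁ (cauchy x η 0<η)
    close : ∀ m n → J ℕ.≤ m → J ℕ.≤ n → ℚ.∣ seq x m ℚ.- seq x n ∣ ℚ.< η
    close = proj₂ (cauchy x η 0<η)
    q : ℚ
    q = seq x J

fromℚ-+ : ∀ p q → fromℚ (p ℚ.+ q) ≃ fromℚ p + fromℚ q
fromℚ-+ p q = ≃-pointwise λ _ → refl

fromℚ-- : ∀ p q → fromℚ (p ℚ.- q) ≃ fromℚ p - fromℚ q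
fromℚ-- p q = ≃-pointwise λ _ → refl

-- One-sided, because m and n may be exchanged.
IsCauchy : (ℕ → ℝ) → Set
IsCauchy s = ∀ ε → 0ℝ < ε → ∃[ N ] (∀ m n → N ℕ.≤ m → N ℕ.≤ n → s m - s n ≤ ε)

converges-intro : ∀ {s l} → (∀ ε → 0ℝ < ε → Ev (λ n → (s n - l ≤ ε) × (l - s n ≤ ε))) → Converges s l
converges-intro {s} {l} h ε 0<ε = proj₁ e , λ n N≤n →
    ≤-<-trans (proj₁ (proj₂ e n N≤n)) (half<ℝ 0<ε) , ≤-<-trans (proj₂ (proj₂ e n N≤n)) (half<ℝ 0<ε)
  where
  e : Ev (λ n → (s n - l ≤ ε * fromℚ ½) × (l - s n ≤ ε * fromℚ ½))
  e = h (ε * fromℚ ½) (half>0ℝ 0<ε)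

-- The limit is the diagonal sequence Q of rational approximations.
module Completeness (s : ℕ → ℝ) (s-cauchy : IsCauchy s) where
  u : ℕ → ℝ
  u k = fromℚ (unit k)

  u>0 : ∀ k → 0ℝ < u k
  u>0 k = fromℚ-mono-< (unit>0 k)

  index : ℕ → ℕ
  index k = proj₁ (s-cauchy (u k) (u>0 k))

  a : ℕ → ℝ
  a k = s (index k)

  a-near : ∀ k n → index k ℕ.≤ n → (s n - a k ≤ u k) × (a k - s n ≤ u k)
  a-near k n ≤n = proj₂ (s-cauchy (u k) (u>0 k)) n (index k) ≤n ℕ.≤-refl
                , proj₂ (s-cauchy (u k) (u>0 k)) (index k) n ℕ.≤-refl ≤n

  Q : ℕ → ℚ
  Q k = proj₁ (approximate (a k) (unit k) (unit>0 k))

  a≤Q+u : ∀ k → a k ≤ fromℚ (Q k) + u k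
  a≤Q+u k = ≤-trans (proj₁ (proj₂ (approximate (a k) (unit k) (unit>0 k)))) (≃⇒≤ (fromℚ-+ (Q k) (unit k)))

  Q-u≤a : ∀ k → fromℚ (Q k) - u k ≤ a k
  Q-u≤a k = ≤-trans (≃⇒≤ (≃-sym (fromℚ-- (Q k) (unit k)))) (proj₂ (proj₂ (approximate (a k) (unit k) (unit>0 k))))

  -- Each of k and l contributes two errors of one unit: from `Q` to `a`, and from `a` to a common
  -- later term of s.
  Q-near : ∀ k l → fromℚ (Q k) - fromℚ (Q l) ≤ (u k + u k) + (u l + u l)
  Q-near k l = ≤-by _ (+-nonneg (+-nonneg (x≤y⇒0≤y-x (Q-u≤a k)) (x≤y⇒0≤y-x (a≤Q+u l)))
                               (+-nonneg (x≤y⇒0≤y-x (proj₂ (a-near k n (ℕ.m≤m⊔n (index k) (index l)))))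
                                         (x≤y⇒0≤y-x (proj₁ (a-near l n (ℕ.m≤n⊔m (index k) (index l)))))))
    (solve 7 (λ qk ql uk ul ak al sn → (uk :+ uk) :+ (ul :+ ul) :=
        (qk :- ql) :+ (((ak :- (qk :- uk)) :+ ((ql :+ ul) :- al)) :+ ((uk :- (ak :- sn)) :+ (ul :- (sn :- al)))))
      ≃-refl (fromℚ (Q k)) (fromℚ (Q l)) (u k) (u l) (a k) (a l) (s n))
    where n = index k ℕ.⊔ index l

  Q-nearℚ : ∀ η → 0ℚ ℚ.< η → ∃[ K ] (∀ k l → K ℕ.≤ k → K ℕ.≤ l → 0ℚ ℚ.≤ η ℚ.- (Q k ℚ.- Q l))
  -- A quarter of η, because `Q-near` costs four units.
  Q-nearℚ η 0<η = let K , small = unit-smallℚ (*-pos 0<η (ℚ.positive⁻¹ (½ ℚ.* ½))) in K , λ k l K≤k K≤l →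
    subst (0ℚ ℚ.≤_) (ℚS.solve 5 (λ η qk ql uk ul → let ε = η ℚS.:* ℚS.con (½ ℚ.* ½) in
          (((uk ℚS.:+ uk) ℚS.:+ (ul ℚS.:+ ul)) ℚS.:- (qk ℚS.:- ql)) ℚS.:+ (((ε ℚS.:- uk) ℚS.:+ (ε ℚS.:- uk)) ℚS.:+ ((ε ℚS.:- ul) ℚS.:+ (ε ℚS.:- ul)))
          ℚS.:= η ℚS.:- (qk ℚS.:- ql)) refl η (Q k) (Q l) (unit k) (unit l))
      (ℚ.+-mono-≤ (ℚ≤⇒diff (fromℚ-cancel-≤ {Q k ℚ.- Q l} {(unit k ℚ.+ unit k) ℚ.+ (unit l ℚ.+ unit l)} (≤-trans (≃⇒≤ (fromℚ-- (Q k) (Q l))) (≤-trans (Q-near k l) (≃⇒≤ (≃-pointwise λ _ → refl))))))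
        (ℚ.+-mono-≤ (ℚ.+-mono-≤ (ℚ≤⇒diff (small k K≤k)) (ℚ≤⇒diff (small k K≤k)))
                    (ℚ.+-mono-≤ (ℚ≤⇒diff (small l K≤l)) (ℚ≤⇒diff (small l K≤l)))))

  limit : ℝ
  limit .seq = Q
  limit .cauchy ε 0<ε = let K , near = Q-nearℚ (ε ℚ.* ½) (half>0 0<ε) in K , λ m n K≤m K≤n →
    abs-intro (Q m ℚ.- Q n)
      (pos-by (ℚ.+-mono-≤-< (near m n K≤m K≤n) (half>0 0<ε))
        (ℚS.solve 3 (λ e p q → (e ℚS.:* ℚS.con ½ ℚS.:- (p ℚS.:- q)) ℚS.:+ e ℚS.:* ℚS.con ½ ℚS.:= e ℚS.:- (p ℚS.:- q)) refl ε (Q m) (Q n)))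
      (pos-by (ℚ.+-mono-≤-< (near n m K≤n K≤m) (half>0 0<ε))
        (ℚS.solve 3 (λ e p q → (e ℚS.:* ℚS.con ½ ℚS.:- (q ℚS.:- p)) ℚS.:+ e ℚS.:* ℚS.con ½ ℚS.:= e ℚS.:+ (p ℚS.:- q)) refl ε (Q m) (Q n)))

  limit-near : ∀ η → 0ℚ ℚ.< η → Ev (λ k → (fromℚ (Q k) - limit ≤ fromℚ η) × (limit - fromℚ (Q k) ≤ fromℚ η))
  limit-near η 0<η = let K , near = Q-nearℚ (η ℚ.* ½) (half>0 0<η) in K , λ k K≤k →
      ≤-by _ (x≤y⇒0≤y-x (≥-from-seq {limit} {Q k ℚ.- η} (K , λ l K≤l →
          pos-by (ℚ.+-mono-≤-< (near k l K≤k K≤l) (half>0 0<η))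
            (ℚS.solve 3 (λ e p q → (e ℚS.:* ℚS.con ½ ℚS.:- (p ℚS.:- q)) ℚS.:+ e ℚS.:* ℚS.con ½ ℚS.:= q ℚS.:- (p ℚS.:- e)) refl η (Q k) (Q l)))))
        (≃-trans (solve 3 (λ e q l → e := (q :- l) :+ (l :- (q :- e))) ≃-refl (fromℚ η) (fromℚ (Q k)) limit)
          (+-cong ≃-refl (+-cong ≃-refl (-‿cong (≃-sym (fromℚ-- (Q k) η))))))
    , ≤-by _ (x≤y⇒0≤y-x (≤-from-seq {limit} {Q k ℚ.+ η} (K , λ l K≤l →
          pos-by (ℚ.+-mono-≤-< (near l k K≤l K≤k) (half>0 0<η))
            (ℚS.solve 3 (λ e p q → (e ℚS.:* ℚS.con ½ ℚS.:- (q ℚS.:- p)) ℚS.:+ e ℚS.:* ℚS.con ½ ℚS.:= (p ℚS.:+ e) ℚS.:- q) refl η (Q k) (Q l)))))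
        (≃-trans (solve 3 (λ e q l → e := (l :- q) :+ ((q :+ e) :- l)) ≃-refl (fromℚ η) (fromℚ (Q k)) limit)
          (+-cong ≃-refl (+-cong (≃-sym (fromℚ-+ (Q k) η)) ≃-refl)))

  converges : Converges s limit
  converges = converges-intro λ ε 0<ε →
    -- The budget is ε / 2 for the distance from `Q k` to the limit and ε / 4 for each of the two
    -- units between s n and `Q k`.
    let q , 0<q , q<ε = rational-below (half>0ℝ 0<ε)
        K , near = limit-near q 0<q
        M , small = unit-small (*-pos-ℝ 0<ε (fromℚ-mono-< (ℚ.positive⁻¹ (½ ℚ.* ½))))
        k = K ℕ.⊔ M
        near₁ , near₂ = near k (ℕ.m≤m⊔n K M)
        uk = small k (ℕ.m≤n⊔m K M)
        slack = +-nonneg (+-nonneg (x≤y⇒0≤y-x uk) (x≤y⇒0≤y-x uk)) (x≤y⇒0≤y-x (<⇒≤ q<ε))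
    in index k , λ n ≤n →
      ≤-by _ (+-nonneg (+-nonneg (x≤y⇒0≤y-x (proj₁ (a-near k n ≤n))) (x≤y⇒0≤y-x (a≤Q+u k)))
              (+-nonneg (x≤y⇒0≤y-x near₁) slack))
        (solve 7 (λ e s l u a q r → e := (s :- l) :+ (((u :- (s :- a)) :+ ((q :+ u) :- a)) :+
            ((r :- (q :- l)) :+ (((e :* con (½ ℚ.* ½) :- u) :+ (e :* con (½ ℚ.* ½) :- u)) :+ (e :* con ½ :- r)))))
          ≃-refl ε (s n) limit (u k) (a k) (fromℚ (Q k)) (fromℚ q)) ,
      ≤-by _ (+-nonneg (+-nonneg (x≤y⇒0≤y-x (proj₂ (a-near k n ≤n))) (x≤y⇒0≤y-x (Q-u≤a k)))
              (+-nonneg (x≤y⇒0≤y-x near₂) slack))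
        (solve 7 (λ e s l u a q r → e := (l :- s) :+ (((u :- (a :- s)) :+ (a :- (q :- u))) :+
            ((r :- (l :- q)) :+ (((e :* con (½ ℚ.* ½) :- u) :+ (e :* con (½ ℚ.* ½) :- u)) :+ (e :* con ½ :- r)))))
          ≃-refl ε (s n) limit (u k) (a k) (fromℚ (Q k)) (fromℚ q))

-- Limits of sequences of reals

≤-resp : ∀ {x x′ y y′} → x ≃ x′ → y ≃ y′ → x ≤ y → x′ ≤ y′
≤-resp {x} {x′} {y} {y′} x≃ y≃ x≤y = ≤-trans {x′} {x} {y′} (≃⇒≤ (≃-sym x≃)) (≤-trans {x} {y} {y′} x≤y (≃⇒≤ y≃))

conv-≤ : ∀ {s t l l′} → Ev (λ n → s n ≤ t n) → Converges s l → Converges t l′ → l ≤ l′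
conv-≤ {s} {t} {l} {l′} s≤t s→l t→l′ = ≤-limit {l} {l′} (1ℝ + 1ℝ) λ ε 0<ε →
  let N , h = ev-map₂ {λ n → s n ≤ t n} {λ n → (l - s n < ε) × (t n - l′ < ε)}
                {λ n → l ≤ l′ + ε * (1ℝ + 1ℝ)}
        (λ n p (q , r) → ≤-by _ (+-nonneg (x≤y⇒0≤y-x p) (+-nonneg (x≤y⇒0≤y-x (<⇒≤ q)) (x≤y⇒0≤y-x (<⇒≤ r))))
          (solve 5 (λ s t l l′ ε → l′ :+ ε :* (con 1ℚ :+ con 1ℚ) :=
             l :+ ((t :- s) :+ ((ε :- (l :- s)) :+ (ε :- (t :- l′))))) ≃-refl (s n) (t n) l l′ ε))
        s≤t (ev-map₂ {λ n → ∣ s n - l ∣< ε} {λ n → ∣ t n - l′ ∣< ε} (λ n p q → proj₂ p , proj₁ q) (s→l ε 0<ε) (t→l′ ε 0<ε))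
  in h N ℕ.≤-refl

ev-always : ∀ {P : ℕ → Set} → (∀ n → P n) → Ev P
ev-always p = 0 , λ n _ → p n

conv-resp : ∀ {s t l l′} → Ev (λ n → s n ≃ t n) → l ≃ l′ → Converges s l → Converges t l′
conv-resp {s} {t} {l} {l′} s≃t l≃l′ s→l ε 0<ε =
  ev-map₂ {λ n → s n ≃ t n} {λ n → ∣ s n - l ∣< ε} {λ n → ∣ t n - l′ ∣< ε} (λ n p (q , r) →
    <-respˡ-≃ (+-cong p (-‿cong l≃l′)) q , <-respˡ-≃ (+-cong l≃l′ (-‿cong p)) r) s≃t (s→l ε 0<ε)

conv-unique : ∀ {s l l′} → Converges s l → Converges s l′ → l ≃ l′
conv-unique {s} p q = ≤-antisym
  (conv-≤ {s} {s} (ev-always λ n → ≤-refl {s n}) p q)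
  (conv-≤ {s} {s} (ev-always λ n → ≤-refl {s n}) q p)

conv-const : ∀ l → Converges (λ _ → l) l
conv-const l ε 0<ε = 0 , λ _ _ → <-respˡ-≃ (solve 1 (λ l → con 0ℚ := l :- l) ≃-refl l) 0<ε
                              , <-respˡ-≃ (solve 1 (λ l → con 0ℚ := l :- l) ≃-refl l) 0<ε

conv-+ : ∀ {s t l m} → Converges s l → Converges t m → Converges (λ n → s n + t n) (l + m)
conv-+ {s} {t} {l} {m} s→l t→m ε 0<ε = ev-map₂ {λ n → ∣ s n - l ∣< ε′} {λ n → ∣ t n - m ∣< ε′} {λ n → ∣ (s n + t n) - (l + m) ∣< ε}
  (λ n (p , p′) (q , q′) → go (s n) (t n) l m p q  , go l m (s n) (t n) p′ q′)
  (s→l ε′ (half>0ℝ 0<ε)) (t→m ε′ (half>0ℝ 0<ε))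
  where
  ε′ = ε * fromℚ ½
  go : ∀ s t l m → s - l < ε′ → t - m < ε′ → (s + t) - (l + m) < ε
  go s t l m p q = <-by _ (+-pos (x<y⇒0<y-x p) (x<y⇒0<y-x q))
      (solve 5 (λ s t l m ε → ε :=
          ((s :+ t) :- (l :+ m)) :+ ((ε :* con ½ :- (s :- l)) :+ (ε :* con ½ :- (t :- m)))) ≃-refl s t l m ε)

abs-bound : ∀ x → ∃[ b ] 0ℝ < b × x < b × - x < b
abs-bound x =
  let p , 0<p , x<p = rational-above x
      q , 0<q , -x<q = rational-above (- x)
      0<p′ = fromℚ-mono-< 0<p
      0<q′ = fromℚ-mono-< 0<q
  in fromℚ p + fromℚ q , +-pos 0<p′ 0<q′ ,
     <-trans x<p (<-by (fromℚ q) 0<q′ ≃-refl) ,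
     <-trans -x<q (<-by (fromℚ p) 0<p′ (solve 2 (λ p q → p :+ q := q :+ p) ≃-refl (fromℚ p) (fromℚ q)))

-- Both bounds come from 2 (b δ ∓ c x) = (b ∓ c) (δ + x) + (b ± c) (δ - x).
*-small : ∀ {b c δ x} → c < b → - c < b → x < δ → - x < δ → (c * x < b * δ) × (- (c * x) < b * δ)
*-small {b} {c} {δ} {x} c<b -c<b x<δ -x<δ =
  <-by _ (half>0ℝ (+-pos (*-pos-ℝ (x<y⇒0<y-x c<b) (x<y⇒0<y-x -x<δ)) (*-pos-ℝ (x<y⇒0<y-x -c<b) (x<y⇒0<y-x x<δ))))
    (solve 4 (λ b c d x → b :* d := c :* x :+ ((b :- c) :* (d :- :- x) :+ (b :- :- c) :* (d :- x)) :* con ½)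
        ≃-refl b c δ x) ,
  <-by _ (half>0ℝ (+-pos (*-pos-ℝ (x<y⇒0<y-x -c<b) (x<y⇒0<y-x -x<δ)) (*-pos-ℝ (x<y⇒0<y-x c<b) (x<y⇒0<y-x x<δ))))
    (solve 4 (λ b c d x → b :* d :=
        :- (c :* x) :+ ((b :- :- c) :* (d :- :- x) :+ (b :- c) :* (d :- x)) :* con ½) ≃-refl b c δ x)

conv-*ˡ : ∀ {s l} c → Converges s l → Converges (λ n → c * s n) (c * l)
conv-*ˡ {s} {l} c s→l ε 0<ε =
  ev-map {λ n → ∣ s n - l ∣< δ} {λ n → ∣ c * s n - c * l ∣< ε} (λ n p → scaled (s n) (proj₁ p) (proj₂ p))
    (s→l δ (*-pos-ℝ 0<ε (inverse>0 b 0<b)))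
  where
  bounds = abs-bound c
  b = proj₁ bounds
  0<b = proj₁ (proj₂ bounds)
  c<b = proj₁ (proj₂ (proj₂ bounds))
  -c<b = proj₂ (proj₂ (proj₂ bounds))
  δ = ε * inverse b 0<b
  bδ≃ε : b * δ ≃ ε
  bδ≃ε = ≃-trans (solve 3 (λ b e i → b :* (e :* i) := e :* (b :* i)) ≃-refl b ε (inverse b 0<b))
    (≃-trans (*-cong ≃-refl (*-inverseʳ b 0<b)) (solve 1 (λ e → e :* con 1ℚ := e) ≃-refl ε))
  scaled : ∀ x → x - l < δ → l - x < δ → (c * x - c * l < ε) × (c * l - c * x < ε)
  scaled x p q =
      <-respˡ-≃ (solve 3 (λ c s l → c :* (s :- l) := c :* s :- c :* l)
          ≃-refl c x l) (<-respʳ-≃ bδ≃ε (proj₁ both))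
    , <-respˡ-≃ (solve 3 (λ c s l → :- (c :* (s :- l)) := c :* l :- c :* s)
        ≃-refl c x l) (<-respʳ-≃ bδ≃ε (proj₂ both))
    where
    both : (c * (x - l) < b * δ) × (- (c * (x - l)) < b * δ)
    both = *-small c<b -c<b p (<-respˡ-≃ (solve 2 (λ s l → l :- s := :- (s :- l)) ≃-refl x l) q)

conv-- : ∀ {s t l m} → Converges s l → Converges t m → Converges (λ n → s n - t n) (l - m)
conv-- {s} {t} {l} {m} s→l t→m = conv-resp {λ n → s n + - 1ℝ * t n} {λ n → s n - t n}
  (ev-always λ n → eq (s n) (t n)) (eq l m)
  (conv-+ {s} {λ n → - 1ℝ * t n} s→l (conv-*ˡ {t} (- 1ℝ) t→m))
  where
  eq : ∀ x y → x + - 1ℝ * y ≃ x - y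
  eq = solve 2 (λ x y → x :+ :- con 1ℚ :* y := x :- y) ≃-refl

conv-suc : ∀ {s l} → Converges s l → Converges (λ n → s (suc n)) l
conv-suc s→l ε 0<ε = let N , h = s→l ε 0<ε in N , λ n N≤n → h (suc n) (ℕ.m≤n⇒m≤1+n N≤n)

conv-pred : ∀ {s l} → Converges (λ n → s (suc n)) l → Converges s l
conv-pred {s} {l} s→l ε 0<ε = let N , h = s→l ε 0<ε in suc N , λ where
  (suc n) (ℕ.s≤s N≤n) → h n N≤n

-- Finite sums

Σ-cong : ∀ {f g} n → (∀ k → k ℕ.< n → f k ≃ g k) → Σ< n f ≃ Σ< n g
Σ-cong zero    f≃g = ≃-refl
Σ-cong (suc n) f≃g = +-cong (Σ-cong n λ k k<n → f≃g k (ℕ.m<n⇒m<1+n k<n)) (f≃g n (ℕ.n<1+n n))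

Σ-mono : ∀ {f g} n → (∀ k → k ℕ.< n → f k ≤ g k) → Σ< n f ≤ Σ< n g
Σ-mono zero    f≤g = ≤-refl
Σ-mono (suc n) f≤g = +-mono-≤ (Σ-mono n λ k k<n → f≤g k (ℕ.m<n⇒m<1+n k<n)) (f≤g n (ℕ.n<1+n n))

Σ-nonneg : ∀ {f} n → (∀ k → 0ℝ ≤ f k) → 0ℝ ≤ Σ< n f
Σ-nonneg zero    0≤f = ≤-refl
Σ-nonneg (suc n) 0≤f = +-nonneg (Σ-nonneg n 0≤f) (0≤f n)

Σ-+ : ∀ f g n → Σ< n (λ k → f k + g k) ≃ Σ< n f + Σ< n g
Σ-+ f g zero    = solve 0 (con 0ℚ := con 0ℚ :+ con 0ℚ) ≃-refl
Σ-+ f g (suc n) = ≃-trans (+-cong (Σ-+ f g n) ≃-refl)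
  (solve 4 (λ a b c d → (a :+ b) :+ (c :+ d) := (a :+ c) :+ (b :+ d)) ≃-refl (Σ< n f) (Σ< n g) (f n) (g n))

Σ-*ˡ : ∀ c f n → Σ< n (λ k → c * f k) ≃ c * Σ< n f
Σ-*ˡ c f zero    = solve 1 (λ c → con 0ℚ := c :* con 0ℚ) ≃-refl c
Σ-*ˡ c f (suc n) = ≃-trans (+-cong (Σ-*ˡ c f n) ≃-refl)
  (solve 3 (λ c a b → c :* a :+ c :* b := c :* (a :+ b)) ≃-refl c (Σ< n f) (f n))

Σ-zero : ∀ {f} n → (∀ k → k ℕ.< n → f k ≃ 0ℝ) → Σ< n f ≃ 0ℝ
Σ-zero zero    f≃0 = ≃-refl
Σ-zero (suc n) f≃0 = ≃-trans (+-cong (Σ-zero n λ k k<n → f≃0 k (ℕ.m<n⇒m<1+n k<n)) (f≃0 n (ℕ.n<1+n n)))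
  (solve 0 (con 0ℚ :+ con 0ℚ := con 0ℚ) ≃-refl)

Σ-head : ∀ f n → Σ< (suc n) f ≃ f 0 + Σ< n (λ k → f (suc k))
Σ-head f zero    = solve 1 (λ a → con 0ℚ :+ a := a :+ con 0ℚ) ≃-refl (f 0)
Σ-head f (suc n) = ≃-trans (+-cong (Σ-head f n) ≃-refl)
  (solve 3 (λ a b c → (a :+ b) :+ c := a :+ (b :+ c)) ≃-refl (f 0) (Σ< n λ k → f (suc k)) (f (suc n)))

Σ-extend : ∀ {f} → (∀ k → 0ℝ ≤ f k) → ∀ {m n} → m ℕ.≤ n → Σ< m f ≤ Σ< n f
Σ-extend {f} 0≤f {m} {zero} ℕ.z≤n = ≤-refl
Σ-extend {f} 0≤f {m} {suc n} m≤1+n with ℕ.m≤n⇒m<n∨m≡n m≤1+n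
... | inj₂ refl          = ≤-refl
... | inj₁ (ℕ.s≤s m≤n)   = ≤-trans (Σ-extend 0≤f m≤n) (≤-by (f n) (0≤f n) ≃-refl)

series-≤-limit : ∀ {f l} → (∀ k → 0ℝ ≤ f k) → Converges (λ n → Σ< n f) l → ∀ n → Σ< n f ≤ l
series-≤-limit {f} 0≤f f→l n = conv-≤ {λ _ → Σ< n f} (n , λ m n≤m → Σ-extend 0≤f n≤m) (conv-const (Σ< n f)) f→l

-- Series of nonnegative terms

Summable : (ℕ → ℝ) → Set
Summable f = ∃[ l ] Converges (λ n → Σ< n f) l

summable-by-tails : ∀ {f} → (∀ k → 0ℝ ≤ f k) →
  (∀ ε → 0ℝ < ε → ∃[ N ] (∀ n → N ℕ.≤ n → Σ< n f - Σ< N f ≤ ε)) → Summable f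
summable-by-tails {f} 0≤f tails = Completeness.limit S c , Completeness.converges S c
  where
  S : ℕ → ℝ
  S n = Σ< n f
  c : IsCauchy S
  c ε 0<ε = let N , small = tails ε 0<ε in N , λ m n N≤m N≤n →
    ≤-trans (+-mono-≤ ≤-refl (neg-mono-≤ (Σ-extend 0≤f N≤n))) (small m N≤m)

-- The partial sums of g - f increase, so every tail of f is at most the corresponding tail of g.
summable-dominated : ∀ {f g} → (∀ k → 0ℝ ≤ f k) → (∀ k → f k ≤ g k) → Summable g → Summable f
summable-dominated {f} {g} 0≤f f≤g (G , g→G) = summable-by-tails 0≤f λ ε 0<ε →
  let N , close = g→G ε 0<ε in N , λ n N≤n → ≤-trans (tail n N≤n)
    (≤-trans (+-mono-≤ (series-≤-limit 0≤g g→G n) ≤-refl) (<⇒≤ (proj₂ (close N ℕ.≤-refl))))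
  where
  0≤g : ∀ k → 0ℝ ≤ g k
  0≤g k = ≤-trans (0≤f k) (f≤g k)
  0≤g-f : ∀ k → 0ℝ ≤ g k - f k
  0≤g-f k = x≤y⇒0≤y-x (f≤g k)
  split : ∀ n → Σ< n g ≃ Σ< n f + Σ< n (λ k → g k - f k)
  split n = ≃-trans (Σ-cong n λ k _ → solve 2 (λ f g → g := f :+ (g :- f))
      ≃-refl (f k) (g k)) (Σ-+ f (λ k → g k - f k) n)
  tail : ∀ {N} n → N ℕ.≤ n → Σ< n f - Σ< N f ≤ Σ< n g - Σ< N g
  tail {N} n N≤n = ≤-by _ (x≤y⇒0≤y-x (Σ-extend 0≤g-f N≤n))
    (≃-trans (+-cong (split n) (-‿cong (split N)))
      (solve 4 (λ a b c d → (a :+ b) :- (c :+ d) := (a :- c) :+ (b :- d)) ≃-refl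
        (Σ< n f) (Σ< n (λ k → g k - f k)) (Σ< N f) (Σ< N (λ k → g k - f k))))

module Ratio (g : ℕ → ℝ) (0≤g : ∀ k → 0ℝ ≤ g k) (τ : ℝ) (0<τ : 0ℝ < τ) (N : ℕ)
             (ratio : ∀ k → N ℕ.≤ k → g (suc k) ≤ (1ℝ - τ) * g k) where

  0≤iτ : ∀ i → 0ℝ ≤ fromℕ i * τ
  0≤iτ i = *-nonneg (fromℕ≥0 i) (<⇒≤ 0<τ)

  -- Bernoulli's inequality for a geometric sequence, as (1 + (i + 1) τ) (1 - τ) ≤ 1 + i τ. It gives
  -- an explicit rate of decay, from which `null` reads off its index.
  decay : ∀ i → (1ℝ + fromℕ i * τ) * g (i ℕ.+ N) ≤ g N
  decay zero = ≃⇒≤ (solve 2 (λ t g → (con 1ℚ :+ con 0ℚ :* t) :* g := g) ≃-refl τ (g N))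
  decay (suc i) = ≤-trans step (decay i)
    where
    open ≤-Reasoning
    I = fromℕ i
    G = g (i ℕ.+ N)
    step : (1ℝ + fromℕ (suc i) * τ) * g (suc (i ℕ.+ N)) ≤ (1ℝ + I * τ) * G
    step = begin
      (1ℝ + fromℕ (suc i) * τ) * g (suc (i ℕ.+ N))
        ≤⟨ *-monoˡ-≤ (+-nonneg (<⇒≤ 0<1ℝ) (0≤iτ (suc i))) (ratio (i ℕ.+ N) (ℕ.m≤n+m N i)) ⟩
      (1ℝ + fromℕ (suc i) * τ) * ((1ℝ - τ) * G)
        ≈⟨ *-cong (+-cong ≃-refl (*-cong (fromℕ-suc i) ≃-refl)) ≃-refl ⟩
      (1ℝ + (1ℝ + I) * τ) * ((1ℝ - τ) * G)
        ≤⟨ ≤-by ((τ + I * τ) * τ * G) (*-nonneg (*-nonneg (+-nonneg (<⇒≤ 0<τ) (0≤iτ i)) (<⇒≤ 0<τ)) (0≤g _))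
            (solve 3 (λ t i g → (con 1ℚ :+ i :* t) :* g :=
                (con 1ℚ :+ (con 1ℚ :+ i) :* t) :* ((con 1ℚ :- t) :* g) :+ (t :+ i :* t) :* t :* g)
              ≃-refl τ I G) ⟩
      (1ℝ + I * τ) * G ∎

  null : ∀ ε → 0ℝ < ε → Ev (λ n → g n ≤ ε)
  null ε 0<ε = let K , K> = archimedean (g N * inverse (τ * ε) 0<τε) in K ℕ.+ N , λ n ≤n →
    subst (λ m → g m ≤ ε) (ℕ.m∸n+n≡m (ℕ.≤-trans (ℕ.m≤n+m N K) ≤n))
      (bounded (n ℕ.∸ N) (≤-trans (<⇒≤ K>) (fromℕ-mono-≤ (subst (ℕ._≤ n ℕ.∸ N) (ℕ.m+n∸n≡m K N) (ℕ.∸-monoˡ-≤ N ≤n)))))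
    where
    open ≤-Reasoning
    0<τε = *-pos-ℝ 0<τ 0<ε
    y = inverse (τ * ε) 0<τε
    bounded : ∀ i → g N * y ≤ fromℕ i → g (i ℕ.+ N) ≤ ε
    bounded i h = *-cancelʳ-≤ (<-≤-trans 0<1ℝ (≤-by _ (0≤iτ i) ≃-refl)) (begin
      g (i ℕ.+ N) * (1ℝ + fromℕ i * τ) ≈⟨ solve 2 (λ a b → a :* b := b :* a) ≃-refl _ _ ⟩
      (1ℝ + fromℕ i * τ) * g (i ℕ.+ N) ≤⟨ decay i ⟩
      g N                      ≈⟨ solve 1 (λ a → a := a :* con 1ℚ) ≃-refl (g N) ⟩
      g N * 1ℝ                 ≈⟨ *-cong ≃-refl (≃-sym (*-inverseʳ (τ * ε) 0<τε)) ⟩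
      g N * (τ * ε * y)        ≈⟨ solve 4 (λ g t e y → g :* (t :* e :* y) := g :* y :* (t :* e))
          ≃-refl (g N) τ ε y ⟩
      g N * y * (τ * ε)        ≤⟨ *-monoʳ-≤ (<⇒≤ 0<τε) h ⟩
      fromℕ i * (τ * ε)        ≤⟨ ≤-by ε (<⇒≤ 0<ε) (solve 3 (λ i t e → e :* (con 1ℚ :+ i :* t) :=
          i :* (t :* e) :+ e) ≃-refl (fromℕ i) τ ε) ⟩
      ε * (1ℝ + fromℕ i * τ) ∎)

  -- The quantity τ times the tail sum plus the next term never increases. This yields the geometric
  -- bound g M / τ on the tail without summing powers.
  tail : ∀ {M} → N ℕ.≤ M → ∀ j → τ * (Σ< (j ℕ.+ M) g - Σ< M g) + g (j ℕ.+ M) ≤ g M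
  tail {M} N≤M zero = ≃⇒≤ (solve 3 (λ t s g → t :* (s :- s) :+ g := g) ≃-refl τ (Σ< M g) (g M))
  tail {M} N≤M (suc j) = ≤-trans
    (+-mono-≤ ≤-refl (ratio (j ℕ.+ M) (ℕ.≤-trans N≤M (ℕ.m≤n+m M j))))
    (≤-trans (≃⇒≤ (solve 4 (λ t s m g → t :* ((s :+ g) :- m) :+ (con 1ℚ :- t) :* g := t :* (s :- m) :+ g) ≃-refl
        τ (Σ< (j ℕ.+ M) g) (Σ< M g) (g (j ℕ.+ M)))) (tail N≤M j))

  summable : Summable g
  summable = summable-by-tails 0≤g λ ε 0<ε →
    let K , small = null (ε * τ) (*-pos-ℝ 0<ε 0<τ)
        M = K ℕ.⊔ N
    in M , λ n M≤n → *-cancelʳ-≤ 0<τ (≤-trans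
         (≤-by (g n) (0≤g n) (solve 3 (λ t s g → t :* s :+ g := s :* t :+ g) ≃-refl τ (Σ< n g - Σ< M g) (g n)))
         (≤-trans (subst (λ m → τ * (Σ< m g - Σ< M g) + g m ≤ g M) (ℕ.m∸n+n≡m M≤n) (tail (ℕ.m≤n⊔m K N) (n ℕ.∸ M)))
                  (small M (ℕ.m≤m⊔n K N))))

-- The exponential series

/1-* : ∀ m n → + (m ℕ.* n) ℚ./ 1 ≡ (+ m ℚ./ 1) ℚ.* (+ n ℚ./ 1)
/1-* m n = ℚ.toℚᵘ-injective (ℚᵘ.≃-trans (toℚᵘ-/1 (m ℕ.* n)) (ℚᵘ.≃-sym
  (ℚᵘ.≃-trans (ℚ.toℚᵘ-homo-* (+ m ℚ./ 1) (+ n ℚ./ 1))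
  (ℚᵘ.≃-trans (ℚᵘ.*-cong (toℚᵘ-/1 m) (toℚᵘ-/1 n)) (*≡* (cong (ℤ._* + 1) (sym (ℤ.pos-* m n))))))))

inv! : ℕ → ℝ
inv! k = fromℚ (ℚ._/_ (+ 1) (k !) {{k ℕ.!≢0}})

inv!*! : ∀ k → inv! k * fromℕ (k !) ≃ 1ℝ
inv!*! k = ≃-pointwise λ _ → 1/n*n≡1 (k !) {{k ℕ.!≢0}}

fromℕ-* : ∀ m n → fromℕ (m ℕ.* n) ≃ fromℕ m * fromℕ n
fromℕ-* m n = ≃-pointwise λ _ → /1-* m n

inv!>0 : ∀ k → 0ℝ < inv! k
inv!>0 k = fromℚ-mono-< (ℚ.positive⁻¹ _ {{ℚ.normalize-pos 1 (k !) {{k ℕ.!≢0}}}})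

fromℕ-pos : ∀ n → .{{ℕ.NonZero n}} → 0ℝ < fromℕ n
fromℕ-pos (suc n) = fromℕ>0 n

inv!-suc : ∀ k → inv! (suc k) * fromℕ (suc k) ≃ inv! k
inv!-suc k = *-cancelʳ-≃ (fromℕ-pos (k !) {{k ℕ.!≢0}}) (begin-equality
  inv! (suc k) * fromℕ (suc k) * fromℕ (k !)
    ≈⟨ solve 3 (λ a b c → a :* b :* c := a :* (b :* c)) ≃-refl (inv! (suc k)) (fromℕ (suc k)) (fromℕ (k !)) ⟩
  inv! (suc k) * (fromℕ (suc k) * fromℕ (k !))
    ≈⟨ *-cong ≃-refl (fromℕ-* (suc k) (k !)) ⟨
  inv! (suc k) * fromℕ (suc k !)
    ≈⟨ inv!*! (suc k) ⟩
  1ℝ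
    ≈⟨ inv!*! k ⟨
  inv! k * fromℕ (k !) ∎)
  where open ≤-Reasoning

^-nonneg : ∀ {x} → 0ℝ ≤ x → ∀ k → 0ℝ ≤ x ^ k
^-nonneg 0≤x zero    = <⇒≤ 0<1ℝ
^-nonneg 0≤x (suc k) = *-nonneg 0≤x (^-nonneg 0≤x k)

^-cong : ∀ {x y} → x ≃ y → ∀ k → x ^ k ≃ y ^ k
^-cong x≃y zero    = ≃-refl
^-cong x≃y (suc k) = *-cong x≃y (^-cong x≃y k)

term : ℝ → ℕ → ℝ
term x k = x ^ k * inv! k

term-nonneg : ∀ {x} → 0ℝ ≤ x → ∀ k → 0ℝ ≤ term x k
term-nonneg 0≤x k = *-nonneg (^-nonneg 0≤x k) (<⇒≤ (inv!>0 k))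

-- Once k exceeds 2 x, the ratio x / (k + 1) of consecutive terms is at most one half.
exp-exists : ∀ x → 0ℝ ≤ x → ∃[ a ] IsExp x a
exp-exists x 0≤x = Ratio.summable (term x) (term-nonneg 0≤x) (fromℚ ½) 0<½ℝ N ratio
  where
  N = proj₁ (archimedean (x + x))
  ratio : ∀ k → N ℕ.≤ k → term x (suc k) ≤ (1ℝ - fromℚ ½) * term x k
  ratio k N≤k = ≤-by (x ^ k * inv! (suc k) * fromℚ ½ * (fromℕ (suc k) - (x + x)))
    (*-nonneg (*-nonneg (*-nonneg (^-nonneg 0≤x k) (<⇒≤ (inv!>0 (suc k)))) (<⇒≤ 0<½ℝ))
      (x≤y⇒0≤y-x (≤-trans (<⇒≤ (proj₂ (archimedean (x + x)))) (fromℕ-mono-≤ (ℕ.m≤n⇒m≤1+n N≤k)))))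
    (≃-trans (*-cong ≃-refl (*-cong ≃-refl (≃-sym (inv!-suc k))))
      (solve 4 (λ x p i n → (con 1ℚ :- con ½) :* (p :* (i :* n)) :=
        (x :* p) :* i :+ p :* i :* con ½ :* (n :- (x :+ x))) ≃-refl x (x ^ k) (inv! (suc k)) (fromℕ (suc k))))

exp-cong : ∀ {x x′ a a′} → x ≃ x′ → a ≃ a′ → IsExp x a → IsExp x′ a′
exp-cong {x} {x′} x≃x′ = conv-resp {λ n → Σ< n (term x)} {λ n → Σ< n (term x′)}
  (ev-always λ n → Σ-cong n λ k _ → *-cong (^-cong x≃x′ k) ≃-refl)

exp-≥1 : ∀ {x a} → 0ℝ ≤ x → IsExp x a → 1ℝ ≤ a
exp-≥1 {x} {a} 0≤x e = ≤-trans {1ℝ} {Σ< 1 (term x)} {a}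
  (≃⇒≤ (solve 0 (con 1ℚ := con 0ℚ :+ con 1ℚ :* con 1ℚ) ≃-refl)) (series-≤-limit (term-nonneg 0≤x) e 1)

exp-pos : ∀ {x a} → 0ℝ ≤ x → IsExp x a → 0ℝ < a
exp-pos 0≤x e = <-≤-trans 0<1ℝ (exp-≥1 0≤x e)

exp-zero : IsExp 0ℝ 1ℝ
exp-zero = conv-pred {λ n → Σ< n (term 0ℝ)} (conv-resp {λ _ → 1ℝ} {λ n → Σ< (suc n) (term 0ℝ)}
  (ev-always λ n → ≃-sym (partial n)) ≃-refl (conv-const 1ℝ))
  where
  partial : ∀ n → Σ< (suc n) (term 0ℝ) ≃ 1ℝ
  partial n = ≃-trans (Σ-head (term 0ℝ) n) (≃-trans
    (+-cong ≃-refl (Σ-zero n λ k _ → solve 2 (λ p i → (con 0ℚ :* p) :* i := con 0ℚ)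
        ≃-refl (0ℝ ^ k) (inv! (suc k))))
    (solve 0 (con 1ℚ :* con 1ℚ :+ con 0ℚ := con 1ℚ) ≃-refl))

module Increment (x s : ℝ) (0≤x : 0ℝ ≤ x) (0≤s : 0ℝ ≤ s) where

  0≤x+s : 0ℝ ≤ x + s
  0≤x+s = +-nonneg 0≤x 0≤s

  -- Convexity: the tangent of the power function at x lies below its graph.
  ^-lower : ∀ k → x ^ suc k + fromℕ (suc k) * s * x ^ k ≤ (x + s) ^ suc k
  ^-lower zero = ≃⇒≤ (solve 2 (λ x s → x :* con 1ℚ :+ con 1ℚ :* s :* con 1ℚ := (x :+ s) :* con 1ℚ) ≃-refl x s)
  ^-lower (suc k) = begin
    x * (x * p) + fromℕ (suc (suc k)) * s * (x * p)
      ≈⟨ +-cong ≃-refl (*-cong (*-cong (fromℕ-suc (suc k)) ≃-refl) ≃-refl) ⟩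
    x * (x * p) + (1ℝ + m) * s * (x * p)
      ≤⟨ ≤-by (m * s * s * p) (*-nonneg (*-nonneg (*-nonneg (fromℕ≥0 (suc k)) 0≤s) 0≤s) (^-nonneg 0≤x k))
         (solve 4 (λ x s p m → (x :+ s) :* (x :* p :+ m :* s :* p) :=
             (x :* (x :* p) :+ (con 1ℚ :+ m) :* s :* (x :* p)) :+ m :* s :* s :* p)
           ≃-refl x s p m) ⟩
    (x + s) * (x * p + m * s * p)
      ≤⟨ *-monoˡ-≤ 0≤x+s (^-lower k) ⟩
    (x + s) * (x + s) ^ suc k ∎
    where
    open ≤-Reasoning
    p = x ^ k
    m = fromℕ (suc k)

  -- Convexity again: the chord is no steeper than the tangent at its right end.
  ^-upper : ∀ k → (x + s) ^ suc k ≤ x ^ suc k + fromℕ (suc k) * s * (x + s) ^ k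
  ^-upper zero = ≃⇒≤ (solve 2 (λ x s → (x :+ s) :* con 1ℚ := x :* con 1ℚ :+ con 1ℚ :* s :* con 1ℚ) ≃-refl x s)
  ^-upper (suc k) = begin
    (x + s) * ((x + s) * P)
      ≈⟨ solve 3 (λ x s P → (x :+ s) :* ((x :+ s) :* P) := x :* ((x :+ s) :* P) :+ s :* ((x :+ s) :* P))
          ≃-refl x s P ⟩
    x * ((x + s) * P) + s * ((x + s) * P)
      ≤⟨ +-mono-≤ (*-monoˡ-≤ 0≤x (^-upper k)) ≤-refl ⟩
    x * (x * p + m * s * P) + s * ((x + s) * P)
      ≤⟨ ≤-by (m * s * s * P) (*-nonneg (*-nonneg (*-nonneg (fromℕ≥0 (suc k)) 0≤s) 0≤s) (^-nonneg 0≤x+s k))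
         (solve 5 (λ x s p P m → x :* (x :* p) :+ (con 1ℚ :+ m) :* s :* ((x :+ s) :* P) :=
            (x :* (x :* p :+ m :* s :* P) :+ s :* ((x :+ s) :* P)) :+ m :* s :* s :* P) ≃-refl x s p P m) ⟩
    x * (x * p) + (1ℝ + m) * s * ((x + s) * P)
      ≈⟨ +-cong ≃-refl (*-cong (*-cong (fromℕ-suc (suc k)) ≃-refl) ≃-refl) ⟨
    x * (x * p) + fromℕ (suc (suc k)) * s * ((x + s) * P) ∎
    where
    open ≤-Reasoning
    p = x ^ k
    P = (x + s) ^ k
    m = fromℕ (suc k)

  regroup : ∀ k p P → p * inv! (suc k) + s * (P * inv! k) ≃ (p + fromℕ (suc k) * s * P) * inv! (suc k)
  regroup k p P = ≃-trans (+-cong ≃-refl (*-cong ≃-refl (*-cong ≃-refl (≃-sym (inv!-suc k)))))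
    (solve 5 (λ s p P i n → p :* i :+ s :* (P :* (i :* n)) := (p :+ n :* s :* P) :* i)
        ≃-refl s p P (inv! (suc k)) (fromℕ (suc k)))

  -- With the term of index 0 split off, term k + 1 of one series meets s times term k of the other,
  -- which is how the derivative of a power matches the factorials.
  head-split : ∀ w n → term w 0 + Σ< n (λ k → term x (suc k) + s * term w k) ≃ Σ< (suc n) (term x) + s * Σ< n (term w)
  head-split w n = ≃-trans (+-cong ≃-refl (≃-trans (Σ-+ (λ k → term x (suc k)) (λ k → s * term w k) n)
      (+-cong ≃-refl (Σ-*ˡ s (term w) n))))
    (≃-trans (solve 3 (λ a b c → a :+ (b :+ c) := (a :+ b) :+ c)
        ≃-refl (term x 0) (Σ< n λ k → term x (suc k)) (s * Σ< n (term w)))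
      (+-cong (≃-sym (Σ-head (term x) n)) ≃-refl))

  limit-of : ∀ {w a b} → IsExp x a → IsExp w b → Converges (λ n → Σ< (suc n) (term x) + s * Σ< n (term w)) (a + s * b)
  limit-of {w} ea eb = conv-+ {λ n → Σ< (suc n) (term x)} {λ n → s * Σ< n (term w)}
    (conv-suc {λ n → Σ< n (term x)} ea) (conv-*ˡ {λ n → Σ< n (term w)} s eb)

  -- The tangent estimate divided by (k + 1)! and summed over k. This inequality and its companion
  -- stand in for the functional equation of exp.
  exp-lower : ∀ {a b} → IsExp x a → IsExp (x + s) b → a + s * a ≤ b
  exp-lower ea eb = conv-≤ {λ n → Σ< (suc n) (term x) + s * Σ< n (term x)} {λ n → Σ< (suc n) (term (x + s))}
    (ev-always λ n → ≤-resp (head-split x n) (≃-sym (Σ-head (term (x + s)) n))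
      (+-mono-≤ (≤-refl {1ℝ * inv! 0}) (Σ-mono n λ k _ → ≤-resp (≃-sym (regroup k (x ^ suc k) (x ^ k))) ≃-refl
        (*-monoʳ-≤ (<⇒≤ (inv!>0 (suc k))) (^-lower k)))))
    (limit-of ea ea) (conv-suc {λ n → Σ< n (term (x + s))} eb)

  exp-upper : ∀ {a b} → IsExp x a → IsExp (x + s) b → b ≤ a + s * b
  exp-upper ea eb = conv-≤ {λ n → Σ< (suc n) (term (x + s))} {λ n → Σ< (suc n) (term x) + s * Σ< n (term (x + s))}
    (ev-always λ n → ≤-resp (≃-sym (Σ-head (term (x + s)) n)) (head-split (x + s) n)
      (+-mono-≤ (≤-refl {1ℝ * inv! 0}) (Σ-mono n λ k _ → ≤-resp
          ≃-refl (≃-sym (regroup k (x ^ suc k) ((x + s) ^ k)))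
        (*-monoʳ-≤ (<⇒≤ (inv!>0 (suc k))) (^-upper k)))))
    (conv-suc {λ n → Σ< n (term (x + s))} eb) (limit-of ea eb)

open Increment public using (exp-lower; exp-upper)

shift-eq : ∀ x y → y ≃ x + (y - x)
shift-eq = solve 2 (λ x y → y := x :+ (y :- x)) ≃-refl

exp-mono : ∀ {x y a b} → 0ℝ ≤ x → IsExp x a → IsExp y b → x ≤ y → a ≤ b
exp-mono {x} {y} {a} {b} 0≤x ea eb x≤y = ≤-trans
  (≤-by ((y - x) * a) (*-nonneg 0≤y-x (<⇒≤ (exp-pos 0≤x ea))) ≃-refl)
  (exp-lower x (y - x) 0≤x 0≤y-x ea (exp-cong (shift-eq x y) (≃-refl {b}) eb))
  where 0≤y-x = x≤y⇒0≤y-x x≤y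

-- The goal is a negation: from y < x the lower estimate makes exp strictly larger at x than at y.
exp-cancel-≤ : ∀ {x y a b} → 0ℝ ≤ y → IsExp x a → IsExp y b → a ≤ b → x ≤ y
exp-cancel-≤ {x} {y} {a} {b} 0≤y ea eb a≤b y<x = a≤b (<-≤-trans
  (<-by ((x - y) * b) (*-pos-ℝ 0<x-y (exp-pos 0≤y eb)) ≃-refl)
  (exp-lower y (x - y) 0≤y (<⇒≤ 0<x-y) eb (exp-cong (shift-eq y x) (≃-refl {a}) ea)))
  where 0<x-y = x<y⇒0<y-x y<x

-- With g = 1 - a / b the upper estimate gives exp (x + g) ≤ b.
exp-cancel-< : ∀ {x y a b} → 0ℝ ≤ x → 0ℝ ≤ y → IsExp x a → IsExp y b → a < b → x < y
exp-cancel-< {x} {y} {a} {b} 0≤x 0≤y ea eb a<b =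
  <-≤-trans (<-by g 0<g ≃-refl) (exp-cancel-≤ {x + g} {y} {c} {b} 0≤y ec eb c≤b)
  where
  open ≤-Reasoning
  0<b = exp-pos 0≤y eb
  0<a = exp-pos 0≤x ea
  i = inverse b 0<b
  bi≃1 = *-inverseʳ b 0<b
  g = (b - a) * i
  0<g : 0ℝ < g
  0<g = *-pos-ℝ (x<y⇒0<y-x a<b) (inverse>0 b 0<b)
  c = proj₁ (exp-exists (x + g) (+-nonneg 0≤x (<⇒≤ 0<g)))
  ec : IsExp (x + g) c
  ec = proj₂ (exp-exists (x + g) (+-nonneg 0≤x (<⇒≤ 0<g)))
  c≤b : c ≤ b
  c≤b = *-cancelʳ-≤ 0<a (begin
    c * a           ≈⟨ ≃-by (c * (b - a)) bi≃1 (solve 4 (λ a b c i → c :* a :=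
        (c :- (b :- a) :* i :* c) :* b :+ c :* (b :- a) :* (b :* i :- con 1ℚ)) ≃-refl a b c i) ⟩
    (c - g * c) * b ≤⟨ *-monoʳ-≤ (<⇒≤ 0<b) (≤-by (a + g * c - c) (x≤y⇒0≤y-x (exp-upper x g 0≤x (<⇒≤ 0<g) ea ec))
                        (solve 3 (λ a g c → a := (c :- g :* c) :+ (a :+ g :* c :- c)) ≃-refl a g c)) ⟩
    a * b           ≈⟨ solve 2 (λ a b → a :* b := b :* a) ≃-refl a b ⟩
    b * a ∎)

-- Telescoping: Π z (k + 1) / z k is compared with the exponential of a Riemann sum.
module RiemannSums (z s t : ℕ → ℝ) (0<z : ∀ k → 0ℝ < z k) (0≤s : ∀ k → 0ℝ ≤ s k) (0≤t : ∀ k → 0ℝ ≤ t k)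
  (s*z : ∀ k → s k * z k ≃ z (suc k) - z k) (t*z : ∀ k → t k * z (suc k) ≃ z (suc k) - z k) where

  open ≤-Reasoning

  exp-Σ : ∀ {f} → (∀ k → 0ℝ ≤ f k) → ∀ n → ∃[ a ] IsExp (Σ< n f) a
  exp-Σ 0≤f n = exp-exists _ (Σ-nonneg n 0≤f)

  -- Here s k is the step divided by the left end point, so one step multiplies z by exactly 1 + s
  -- k, and `exp-lower` bounds this factor.
  upper-sum : ∀ n {a} → IsExp (Σ< n s) a → z n ≤ a * z 0
  upper-sum zero {a} e = ≃⇒≤ (≃-trans (solve 1 (λ z → z := con 1ℚ :* z) ≃-refl (z 0))
    (*-cong (conv-unique {λ n → Σ< n (term 0ℝ)} exp-zero e) ≃-refl))
  upper-sum (suc n) {a} e = begin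
    z (suc n)           ≈⟨ solve 2 (λ z z′ → z′ := z :+ (z′ :- z)) ≃-refl (z n) (z (suc n)) ⟩
    z n + (z (suc n) - z n) ≈⟨ +-cong ≃-refl (s*z n) ⟨
    z n + s n * z n     ≈⟨ solve 2 (λ z s → z :+ s :* z := (con 1ℚ :+ s) :* z) ≃-refl (z n) (s n) ⟩
    (1ℝ + s n) * z n    ≤⟨ *-monoˡ-≤ (+-nonneg (<⇒≤ 0<1ℝ) (0≤s n)) (upper-sum n (proj₂ prev)) ⟩
    (1ℝ + s n) * (b * z 0) ≈⟨ solve 3 (λ z s b → (con 1ℚ :+ s) :* (b :* z) := (b :+ s :* b) :* z)
        ≃-refl (z 0) (s n) b ⟩
    (b + s n * b) * z 0 ≤⟨ *-monoʳ-≤ (<⇒≤ (0<z 0)) (exp-lower (Σ< n s) (s n) (Σ-nonneg n 0≤s) (0≤s n) (proj₂ prev) e) ⟩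
    a * z 0             ∎
    where
    prev = exp-Σ 0≤s n
    b = proj₁ prev

  -- Here t k is the step divided by the right end point, so z k is z (k + 1) times 1 - t k, to
  -- which `exp-upper` applies.
  lower-sum : ∀ n {a} → IsExp (Σ< n t) a → a * z 0 ≤ z n
  lower-sum zero {a} e = ≃⇒≤ (≃-sym (≃-trans (solve 1 (λ z → z := con 1ℚ :* z) ≃-refl (z 0))
    (*-cong (conv-unique {λ n → Σ< n (term 0ℝ)} exp-zero e) ≃-refl)))
  lower-sum (suc n) {a} e = *-cancelʳ-≤ (0<z n) (begin
    a * z 0 * z n
      ≈⟨ ≃-by (a * z 0) (t*z n) (solve 5 (λ a z₀ z z′ t → a :* z₀ :* z :=
          (a :- t :* a) :* z₀ :* z′ :+ a :* z₀ :* (t :* z′ :- (z′ :- z)))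
          ≃-refl a (z 0) (z n) (z (suc n)) (t n)) ⟩
    (a - t n * a) * z 0 * z (suc n)
      ≤⟨ *-monoʳ-≤ (<⇒≤ (0<z (suc n))) (*-monoʳ-≤ (<⇒≤ (0<z 0)) (≤-by (b + t n * a - a)
           (x≤y⇒0≤y-x (exp-upper (Σ< n t) (t n) (Σ-nonneg n 0≤t) (0≤t n) (proj₂ prev) e))
           (solve 3 (λ a b t → b := (a :- t :* a) :+ (b :+ t :* a :- a)) ≃-refl a b (t n)))) ⟩
    b * z 0 * z (suc n)
      ≤⟨ *-monoʳ-≤ (<⇒≤ (0<z (suc n))) (lower-sum n (proj₂ prev)) ⟩
    z n * z (suc n)
      ≈⟨ solve 2 (λ a b → a :* b := b :* a) ≃-refl (z n) (z (suc n)) ⟩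
    z (suc n) * z n ∎)
    where
    prev = exp-Σ 0≤t n
    b = proj₁ prev

-- L is the common limit of the lower and upper Riemann sums of 1 / z over [1 , 1 + x].
module Logarithm (x : ℝ) (0<x : 0ℝ < x) where

  open ≤-Reasoning

  u : ℕ → ℝ
  u m = fromℚ (unit m)

  0<u : ∀ m → 0ℝ < u m
  0<u m = fromℚ-mono-< (unit>0 m)

  Δ : ℕ → ℝ
  Δ m = x * u m

  0<Δ : ∀ m → 0ℝ < Δ m
  0<Δ m = *-pos-ℝ 0<x (0<u m)

  z : ℕ → ℕ → ℝ
  z m k = 1ℝ + fromℕ k * Δ m

  0<z : ∀ m k → 0ℝ < z m k
  0<z m k = <-≤-trans 0<1ℝ (≤-by _ (*-nonneg (fromℕ≥0 k) (<⇒≤ (0<Δ m))) ≃-refl)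

  z-zero : ∀ m → z m 0 ≃ 1ℝ
  z-zero m = solve 1 (λ d → con 1ℚ :+ con 0ℚ :* d := con 1ℚ) ≃-refl (Δ m)

  z-suc : ∀ m k → z m (suc k) - z m k ≃ Δ m
  z-suc m k = ≃-trans (+-cong (+-cong ≃-refl (*-cong (fromℕ-suc k) ≃-refl)) ≃-refl)
    (solve 2 (λ k d → (con 1ℚ :+ (con 1ℚ :+ k) :* d) :- (con 1ℚ :+ k :* d) := d) ≃-refl (fromℕ k) (Δ m))

  z-last : ∀ m → z m (suc m) ≃ 1ℝ + x
  z-last m = +-cong ≃-refl (≃-trans (solve 3 (λ n x u → n :* (x :* u) := x :* (u :* n))
      ≃-refl (fromℕ (suc m)) x (u m))
    (≃-trans (*-cong ≃-refl (≃-pointwise {u m * fromℕ (suc m)} {1ℝ} λ _ → unit*suc m))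
        (solve 1 (λ x → x :* con 1ℚ := x) ≃-refl x)))

  s : ℕ → ℕ → ℝ
  s m k = Δ m * inverse (z m k) (0<z m k)

  0≤s : ∀ m k → 0ℝ ≤ s m k
  0≤s m k = <⇒≤ (*-pos-ℝ (0<Δ m) (inverse>0 (z m k) (0<z m k)))

  s*z : ∀ m k → s m k * z m k ≃ Δ m
  s*z m k = ≃-trans (solve 3 (λ d i z → d :* i :* z := d :* (z :* i))
      ≃-refl (Δ m) (inverse (z m k) (0<z m k)) (z m k))
    (≃-trans (*-cong ≃-refl (*-inverseʳ (z m k) (0<z m k))) (solve 1 (λ d → d :* con 1ℚ := d) ≃-refl (Δ m)))

  U V : ℕ → ℝ
  U m = Σ< (suc m) (s m)
  V m = Σ< (suc m) (λ k → s m (suc k))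

  0≤U : ∀ m → 0ℝ ≤ U m
  0≤U m = Σ-nonneg (suc m) (0≤s m)

  0≤V : ∀ m → 0ℝ ≤ V m
  0≤V m = Σ-nonneg (suc m) (λ k → 0≤s m (suc k))

  module R m = RiemannSums (z m) (s m) (λ k → s m (suc k)) (0<z m) (0≤s m) (λ k → 0≤s m (suc k))
    (λ k → ≃-trans (s*z m k) (≃-sym (z-suc m k))) (λ k → ≃-trans (s*z m (suc k)) (≃-sym (z-suc m k)))

  *z-zero : ∀ m a → a * z m 0 ≃ a
  *z-zero m a = ≃-trans (*-cong ≃-refl (z-zero m)) (solve 1 (λ a → a :* con 1ℚ := a) ≃-refl a)

  exp-U : ∀ m {a} → IsExp (U m) a → 1ℝ + x ≤ a
  exp-U m {a} e = ≤-resp (z-last m) (*z-zero m a) (R.upper-sum m (suc m) e)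

  exp-V : ∀ m {a} → IsExp (V m) a → a ≤ 1ℝ + x
  exp-V m {a} e = ≤-resp (*z-zero m a) (z-last m) (R.lower-sum m (suc m) e)

  eU : ∀ m → ∃[ a ] IsExp (U m) a
  eU m = exp-exists (U m) (0≤U m)

  eV : ∀ m → ∃[ a ] IsExp (V m) a
  eV m = exp-exists (V m) (0≤V m)

  -- Sums over unrelated partitions are compared through exp, with 1 + x between the two
  -- exponentials, so no common refinement enters.
  V≤U : ∀ m k → V m ≤ U k
  V≤U m k = exp-cancel-≤ (0≤U k) (proj₂ (eV m)) (proj₂ (eU k))
    (≤-trans (exp-V m (proj₂ (eV m))) (exp-U k (proj₂ (eU k))))

  -- The difference telescopes to the first left-end term minus the last right-end term, and the
  -- first term is the mesh because z starts at 1.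
  U-V : ∀ m → U m - V m ≤ Δ m
  U-V m = ≤-by (s m (suc m)) (0≤s m (suc m)) (begin-equality
    Δ m                                ≈⟨ s*z m 0 ⟨
    s m 0 * z m 0                      ≈⟨ *z-zero m (s m 0) ⟩
    s m 0                              ≈⟨ solve 3 (λ s U V → s := (s :+ V) :- V) ≃-refl (s m 0) (U m) (V m) ⟩
    (s m 0 + V m) - V m                ≈⟨ +-cong (Σ-head (s m) (suc m)) ≃-refl ⟨
    (U m + s m (suc m)) - V m          ≈⟨ solve 3 (λ U s V → (U :+ s) :- V := (U :- V) :+ s)
        ≃-refl (U m) (s m (suc m)) (V m) ⟩
    (U m - V m) + s m (suc m) ∎)

  Δ-small : ∀ ε → 0ℝ < ε → Ev (λ m → Δ m ≤ ε)
  Δ-small ε 0<ε = ev-map {λ m → u m ≤ ε * i} {λ m → Δ m ≤ ε} (λ m p →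
      ≤-resp ≃-refl (≃-trans (solve 3 (λ x e i → x :* (e :* i) := e :* (x :* i)) ≃-refl x ε i)
        (≃-trans (*-cong ≃-refl (*-inverseʳ x 0<x)) (solve 1 (λ e → e :* con 1ℚ := e) ≃-refl ε)))
        (*-monoˡ-≤ {u m} {ε * i} {x} (<⇒≤ 0<x) p))
    (unit-small (*-pos-ℝ 0<ε (inverse>0 x 0<x)))
    where i = inverse x 0<x

  U-cauchy : IsCauchy U
  U-cauchy ε 0<ε = let N , small = Δ-small ε 0<ε in N , λ m k N≤m N≤k →
    ≤-trans {U m - U k} {U m - V m} {ε} (+-mono-≤ ≤-refl (neg-mono-≤ (V≤U m k))) (≤-trans (U-V m) (small m N≤m))

  L : ℝ
  L = Completeness.limit U U-cauchy

  U→L : Converges U L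
  U→L = Completeness.converges U U-cauchy

  V≤L : ∀ m → V m ≤ L
  V≤L m = conv-≤ {λ _ → V m} {U} (ev-always (V≤U m)) (conv-const (V m)) U→L

  0≤L : 0ℝ ≤ L
  0≤L = ≤-trans (0≤V 0) (V≤L 0)

  Δ→0 : Converges Δ 0ℝ
  Δ→0 = converges-intro {Δ} {0ℝ} λ ε 0<ε → ev-map {λ m → Δ m ≤ ε} {λ m → (Δ m - 0ℝ ≤ ε) × (0ℝ - Δ m ≤ ε)}
    (λ m p → ≤-resp (solve 1 (λ d → d := d :- con 0ℚ) ≃-refl (Δ m)) ≃-refl p
           , ≤-by (ε + Δ m) (+-nonneg (<⇒≤ 0<ε) (<⇒≤ (0<Δ m))) (solve 2 (λ e d → e :=
               (con 0ℚ :- d) :+ (e :+ d)) ≃-refl ε (Δ m)))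
    (Δ-small ε 0<ε)

  L≤U : ∀ m → L ≤ U m
  L≤U m = ≤-resp ≃-refl (solve 1 (λ U → U :+ con 0ℚ := U) ≃-refl (U m))
    (conv-≤ {U} {λ k → U m + Δ k} (ev-always λ k → bound≤ k) U→L (conv-+ {λ _ → U m} {Δ}
        (conv-const (U m)) Δ→0))
    where
    bound≤ : ∀ k → U k ≤ U m + Δ k
    bound≤ k = ≤-by ((U m - V k) + (Δ k - (U k - V k))) (+-nonneg (x≤y⇒0≤y-x (V≤U k m)) (x≤y⇒0≤y-x (U-V k)))
      (solve 4 (λ U V U′ d → U′ :+ d := U :+ ((U′ :- V) :+ (d :- (U :- V)))) ≃-refl (U k) (V k) (U m) (Δ k))

  eL : ∃[ a ] IsExp L a
  eL = exp-exists L 0≤L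

  a : ℝ
  a = proj₁ eL

  a≤1+x : a ≤ 1ℝ + x
  a≤1+x = ≤-limit {a} {1ℝ + x} a λ ε 0<ε →
    let m , small = Δ-small ε 0<ε
        v , ev = eV m
        δ = L - V m
        0≤δ : 0ℝ ≤ δ
        0≤δ = x≤y⇒0≤y-x (V≤L m)
        δ≤ε : δ ≤ ε
        δ≤ε = ≤-trans {δ} {U m - V m} {ε} (+-mono-≤ (L≤U m) ≤-refl) (≤-trans (U-V m) (small m ℕ.≤-refl))
    in begin
      a          ≤⟨ exp-upper (V m) δ (0≤V m) 0≤δ ev (exp-cong (shift-eq (V m) L) (≃-refl {a}) (proj₂ eL)) ⟩
      v + δ * a  ≤⟨ +-mono-≤ (exp-V m ev) (*-monoʳ-≤ (<⇒≤ (exp-pos 0≤L (proj₂ eL))) δ≤ε) ⟩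
      1ℝ + x + ε * a ∎

  1+x≤a : 1ℝ + x ≤ a
  1+x≤a = ≤-limit {1ℝ + x} {a} (1ℝ + x) λ ε 0<ε →
    let M , small = Δ-small ε 0<ε
        -- A mesh of at most 1 keeps 1 - δ nonnegative, so that `exp-U` can be multiplied by it.
        K , small₁ = Δ-small 1ℝ 0<1ℝ
        m = M ℕ.⊔ K
        w , ew = eU m
        δ = U m - L
        0≤δ : 0ℝ ≤ δ
        0≤δ = x≤y⇒0≤y-x (L≤U m)
        δ≤Δ : δ ≤ Δ m
        δ≤Δ = ≤-trans {δ} {U m - V m} {Δ m} (+-mono-≤ ≤-refl (neg-mono-≤ (V≤L m))) (U-V m)
        0≤1-δ : 0ℝ ≤ 1ℝ - δ
        0≤1-δ = x≤y⇒0≤y-x (≤-trans {δ} {Δ m} {1ℝ} δ≤Δ (small₁ m (ℕ.m≤n⊔m M K)))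
        0≤1+x : 0ℝ ≤ 1ℝ + x
        0≤1+x = <⇒≤ (+-pos 0<1ℝ 0<x)
    in begin
      1ℝ + x                           ≈⟨ solve 2 (λ y d → y := (con 1ℚ :- d) :* y :+ d :* y)
          ≃-refl (1ℝ + x) δ ⟩
      (1ℝ - δ) * (1ℝ + x) + δ * (1ℝ + x) ≤⟨ +-mono-≤ (*-monoˡ-≤ 0≤1-δ (exp-U m ew))
                                             (*-monoʳ-≤ 0≤1+x (≤-trans {δ} {Δ m} {ε} δ≤Δ (small m (ℕ.m≤m⊔n M K)))) ⟩
      (1ℝ - δ) * w + ε * (1ℝ + x)      ≤⟨ +-mono-≤ (≤-by (a + δ * w - w)
            (x≤y⇒0≤y-x (exp-upper L δ 0≤L 0≤δ (proj₂ eL) (exp-cong (shift-eq L (U m)) (≃-refl {w}) ew)))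
            (solve 3 (λ a d w → a := (con 1ℚ :- d) :* w :+ (a :+ d :* w :- w)) ≃-refl a δ w)) ≤-refl ⟩
      a + ε * (1ℝ + x) ∎

  isLn : IsLn (1ℝ + x) L
  isLn = exp-cong ≃-refl (≤-antisym a≤1+x 1+x≤a) (proj₂ eL)

-- The Kronecker delta

δ : ℕ → ℕ → ℝ
δ zero    zero    = 1ℝ
δ zero    (suc _) = 0ℝ
δ (suc _) zero    = 0ℝ
δ (suc m) (suc n) = δ m n

δ-refl : ∀ m → δ m m ≃ 1ℝ
δ-refl zero    = ≃-refl
δ-refl (suc m) = δ-refl m

δ-≢ : ∀ m n → ¬ (m ≡ n) → δ m n ≃ 0ℝ
δ-≢ zero    zero    m≢n = ⊥-elim (m≢n refl)
δ-≢ zero    (suc n) m≢n = ≃-refl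
δ-≢ (suc m) zero    m≢n = ≃-refl
δ-≢ (suc m) (suc n) m≢n = δ-≢ m n λ m≡n → m≢n (cong suc m≡n)

δ-sym : ∀ m n → δ m n ≃ δ n m
δ-sym zero    zero    = ≃-refl
δ-sym zero    (suc n) = ≃-refl
δ-sym (suc m) zero    = ≃-refl
δ-sym (suc m) (suc n) = δ-sym m n

0*-cong : ∀ x y → 0ℝ * x ≃ 0ℝ * y
0*-cong = solve 2 (λ x y → con 0ℚ :* x := con 0ℚ :* y) ≃-refl

δ-transport : ∀ (f : ℕ → ℝ) m n → δ m n * f n ≃ δ m n * f m
δ-transport f zero    zero    = ≃-refl
δ-transport f zero    (suc n) = 0*-cong (f (suc n)) (f 0)
δ-transport f (suc m) zero    = 0*-cong (f 0) (f (suc m))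
δ-transport f (suc m) (suc n) = δ-transport (λ k → f (suc k)) m n

Σ-δ : ∀ (f : ℕ → ℝ) m n → m ℕ.< n → Σ< n (λ k → δ m k * f k) ≃ f m
Σ-δ f m (suc n) (ℕ.s≤s m≤n) with ℕ.m≤n⇒m<n∨m≡n m≤n
... | inj₁ m<n = ≃-trans (+-cong (Σ-δ f m n m<n) (*-cong (δ-≢ m n (ℕ.<⇒≢ m<n)) (≃-refl {f n})))
                   (solve 2 (λ a b → a :+ con 0ℚ :* b := a) ≃-refl (f m) (f n))
... | inj₂ refl = ≃-trans
    (+-cong (Σ-zero m λ k k<m → ≃-trans (*-cong (δ-≢ m k λ m≡k → ℕ.<⇒≢ k<m (sym m≡k)) (≃-refl {f k}))
                                      (solve 1 (λ b → con 0ℚ :* b := con 0ℚ) ≃-refl (f k)))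
                                  (*-cong (δ-refl m) (≃-refl {f m})))
                   (solve 1 (λ a → con 0ℚ :+ con 1ℚ :* a := a) ≃-refl (f m))

-- Indicators and sums over the quadrant

𝟙-refl : ∀ s → 𝟙 s s ≡ 1ℝ
𝟙-refl s = cong (λ b → if b then 1ℝ else 0ℝ) (dec-true (≡-dec ℕ._≟_ ℕ._≟_ s s) refl)

𝟙-≢ : ∀ s t → ¬ (s ≡ t) → 𝟙 s t ≡ 0ℝ
𝟙-≢ s t s≢t = cong (λ b → if b then 1ℝ else 0ℝ) (dec-false (≡-dec ℕ._≟_ ℕ._≟_ s t) s≢t)

≡⇒≃ : ∀ {x y} → x ≡ y → x ≃ y
≡⇒≃ refl = ≃-refl

𝟙-δ : ∀ h e j k → 𝟙 (h , e) (j , k) ≃ δ h j * δ e k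
𝟙-δ h e j k = case (h ℕ.≟ j) (e ℕ.≟ k)
  where
  case : Dec (h ≡ j) → Dec (e ≡ k) → 𝟙 (h , e) (j , k) ≃ δ h j * δ e k
  case (yes refl) (yes refl) = ≃-trans (≡⇒≃ (𝟙-refl (h , e)))
    (≃-trans (solve 0 (con 1ℚ := con 1ℚ :* con 1ℚ) ≃-refl) (*-cong (≃-sym (δ-refl h)) (≃-sym (δ-refl e))))
  case (no h≢j) _ = ≃-trans (≡⇒≃ (𝟙-≢ (h , e) (j , k) λ eq → h≢j (cong proj₁ eq)))
    (≃-trans (solve 1 (λ x → con 0ℚ := con 0ℚ :* x) ≃-refl (δ e k)) (*-cong (≃-sym (δ-≢ h j h≢j)) ≃-refl))
  case _ (no e≢k) = ≃-trans (≡⇒≃ (𝟙-≢ (h , e) (j , k) λ eq → e≢k (cong proj₂ eq)))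
    (≃-trans (solve 1 (λ x → con 0ℚ := x :* con 0ℚ) ≃-refl (δ h j)) (*-cong ≃-refl (≃-sym (δ-≢ e k e≢k))))

square : ℕ → (State → ℝ) → ℝ
square n f = Σ< n λ h → Σ< n λ e → f (h , e)

-- Once the square reaches row e its sum is an ordinary partial sum, so series over the quadrant
-- that live on one row become simple series, and conversely.
square-row : ∀ {f} e (g : ℕ → ℝ) → (∀ j k → f (j , k) ≃ δ e k * g j) → ∀ n → e ℕ.< n → square n f ≃ Σ< n g
square-row {f} e g f≃ n e<n = Σ-cong n λ j _ → ≃-trans (Σ-cong n λ k _ → f≃ j k) (Σ-δ (λ _ → g j) e n e<n)

hasSum⇒row : ∀ {f l} e (g : ℕ → ℝ) → (∀ j k → f (j , k) ≃ δ e k * g j) → HasSum f l → Converges (λ n → Σ< n g) l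
hasSum⇒row {f} e g f≃ = conv-resp {λ n → square n f} {λ n → Σ< n g} (suc e , square-row e g f≃) ≃-refl

row⇒hasSum : ∀ {f l} e (g : ℕ → ℝ) → (∀ j k → f (j , k) ≃ δ e k * g j) → Converges (λ n → Σ< n g) l → HasSum f l
row⇒hasSum {f} e g f≃ = conv-resp {λ n → Σ< n g} {λ n → square n f}
  (suc e , λ n e<n → ≃-sym (square-row e g f≃ n e<n)) ≃-refl

-- Probability of finding an edge

anyEdge-eval : ∀ p n f → anyEdge p n f ≃ (1ℝ - (1ℝ - p) ^ n) * f true + (1ℝ - p) ^ n * f false
anyEdge-eval p zero f = solve 2 (λ t f → f := (con 1ℚ :- con 1ℚ) :* t :+ con 1ℚ :* f) ≃-refl (f true) (f false)
anyEdge-eval p (suc n) f = ≃-trans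
  (+-cong (*-cong ≃-refl (anyEdge-eval p n (λ _ → f true))) (*-cong ≃-refl (anyEdge-eval p n f)))
  (solve 4 (λ p q t f → p :* ((con 1ℚ :- q) :* t :+ q :* t) :+ (con 1ℚ :- p) :* ((con 1ℚ :- q) :* t :+ q :* f) :=
      (con 1ℚ :- (con 1ℚ :- p) :* q) :* t :+ (con 1ℚ :- p) :* q :* f)
          ≃-refl p ((1ℝ - p) ^ n) (f true) (f false))

-- At least one candidate is essential: among none, the search fails even with edge probability 1.
anyEdge-sure : ∀ n f → anyEdge 1ℝ (suc n) f ≃ f true
anyEdge-sure n f = ≃-trans (anyEdge-eval 1ℝ (suc n) f)
  (solve 3 (λ q t f → (con 1ℚ :- (con 1ℚ :- con 1ℚ) :* q) :* t :+ (con 1ℚ :- con 1ℚ) :* q :* f := t)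
      ≃-refl ((1ℝ - 1ℝ) ^ n) (f true) (f false))

-- Transition law and stationary distribution

module Transitions (λH λE p : ℝ) (d : ℕ) where

  -- From here on d is one less than the number of bridge agents.
  open ChainMatch λH λE p 1ℝ (suc d)

  r u : ℝ
  r = 1ℝ - p
  u = r ^ suc d

  -- Total rates of unmatched and of matched arrivals.
  α β : ℝ
  α = λH * u
  β = λH * (1ℝ - u) + λE

  segment-H : ∀ h f → segment (suc h) 0 f ≃ (1ℝ - r ^ suc h) * segment h 0 f + r ^ suc h * f (suc h , 0)
  segment-H h f = anyEdge-eval p (suc h) λ b → (if b then segment h 0 else return (suc h , 0)) f

  -- Edges to E agents are certain, so a segment cannot stop while an E agent is waiting. Only the
  -- values of f at states without E agents matter.
  segment-support : ∀ {f} → (∀ k → f (k , 0) ≃ 0ℝ) → ∀ h e → segment h e f ≃ 0ℝ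
  segment-support f≃0 zero zero = f≃0 0
  segment-support {f} f≃0 zero (suc e) = ≃-trans
    (anyEdge-sure e λ b → (if b then segment zero e else return (zero , suc e)) f) (segment-support f≃0 zero e)
  segment-support {f} f≃0 (suc h) zero = ≃-trans (segment-H h f)
    (≃-trans (+-cong (*-cong ≃-refl (segment-support f≃0 h zero)) (*-cong ≃-refl (f≃0 (suc h))))
      (solve 1 (λ q → (con 1ℚ :- q) :* con 0ℚ :+ q :* con 0ℚ := con 0ℚ) ≃-refl (r ^ suc h)))
  segment-support {f} f≃0 (suc h) (suc e) = ≃-trans
    (anyEdge-eval p (suc h) λ b → (if b then segment h (suc e) else (anyEdge 1ℝ (suc e) >>= λ toE → if toE then segment (suc h) e else return (suc h , suc e))) f)
    (≃-trans (+-cong (*-cong ≃-refl (segment-support f≃0 h (suc e)))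
        (*-cong ≃-refl (≃-trans (anyEdge-sure e λ b → (if b then segment (suc h) e else return (suc h , suc e)) f) (segment-support f≃0 (suc h) e))))
      (solve 1 (λ q → (con 1ℚ :- q) :* con 0ℚ :+ q :* con 0ℚ := con 0ℚ) ≃-refl (r ^ suc h)))

  arrival-H : ∀ h e f → arrival H (h , e) f ≃ (1ℝ - u) * segment h e f + u * f (suc h , e)
  arrival-H h e f = anyEdge-eval p (suc d) λ b → (if b then segment h e else return (suc h , e)) f

  arrival-E : ∀ h e f → arrival E (h , e) f ≃ segment h e f
  arrival-E h e f = anyEdge-sure d λ b → (if b then segment h e else return (h , suc e)) f

  generator-eval : ∀ h e t →
    generator (h , e) t ≃ β * segment h e (𝟙 t) + α * 𝟙 t (suc h , e) - (α + β) * 𝟙 (h , e) t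
  generator-eval h e t = ≃-trans
    (+-cong (+-cong (*-cong ≃-refl (arrival-H h e (𝟙 t))) (*-cong ≃-refl (arrival-E h e (𝟙 t)))) ≃-refl)
    (solve 6 (λ lH lE u S x y → (lH :* ((con 1ℚ :- u) :* S :+ u :* x) :+ lE :* S) :- (lH :+ lE) :* y :=
       (lH :* (con 1ℚ :- u) :+ lE) :* S :+ lH :* u :* x :- (lH :* u :+ (lH :* (con 1ℚ :- u) :+ lE)) :* y) ≃-refl
       λH λE u (segment h e (𝟙 t)) (𝟙 t (suc h , e)) (𝟙 (h , e) t))

  -- P j h: a segment started among j waiting H agents and no E agent leaves h of them.
  P : ℕ → ℕ → ℝ
  P j h = segment j 0 (𝟙 (h , 0))

  𝟙-row : ∀ h j → 𝟙 (h , 0) (j , 0) ≃ δ h j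
  𝟙-row h j = ≃-trans (𝟙-δ h 0 j 0) (solve 1 (λ x → x :* con 1ℚ := x) ≃-refl (δ h j))

  P-zero : ∀ h → P 0 h ≃ δ h 0
  P-zero h = 𝟙-row h 0

  P-suc : ∀ j h → P (suc j) h ≃ (1ℝ - r ^ suc j) * P j h + r ^ suc j * δ h (suc j)
  P-suc j h = ≃-trans (segment-H j (𝟙 (h , 0))) (+-cong ≃-refl (*-cong ≃-refl (𝟙-row h (suc j))))

  -- For h ≤ j, P j h is r ^ h times the product of 1 - r ^ i over h < i ≤ j. Passing to h + 1
  -- trades the factor 1 - r ^ (h + 1) for one more r, and the delta accounts for j = h. This
  -- relation removes the infinite sums from the balance equations.
  P-step : ∀ j h → r * P j h ≃ r ^ suc h * δ h j + (1ℝ - r ^ suc h) * P j (suc h)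
  P-step zero zero = ≃-trans (*-cong ≃-refl (P-zero 0)) (≃-sym (≃-trans (+-cong ≃-refl (*-cong
      ≃-refl (P-zero 1)))
    (solve 1 (λ r → r :* con 1ℚ :* con 1ℚ :+ (con 1ℚ :- r :* con 1ℚ) :* con 0ℚ := r :* con 1ℚ) ≃-refl r)))
  P-step zero (suc h) = ≃-trans (*-cong ≃-refl (P-zero (suc h))) (≃-sym (≃-trans (+-cong ≃-refl (*-cong
      ≃-refl (P-zero (suc (suc h)))))
    (solve 2 (λ r R → R :* con 0ℚ :+ (con 1ℚ :- R) :* con 0ℚ := r :* con 0ℚ) ≃-refl r (r ^ suc (suc h)))))
  P-step (suc j) h = begin-equality
    r * P (suc j) h
      ≈⟨ *-cong ≃-refl (P-suc j h) ⟩
    r * ((1ℝ - J) * P j h + J * y)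
      ≈⟨ ≃-by (1ℝ - J) (P-step j h) (solve 7 (λ r J R x y Pj Pj′ → r :* ((con 1ℚ :- J) :* Pj :+ J :* y) :=
            ((con 1ℚ :- J) :* (R :* x :+ (con 1ℚ :- R) :* Pj′) :+ r :* J :* y) :+ (con 1ℚ :- J) :* (r :* Pj :- (R :* x :+ (con 1ℚ :- R) :* Pj′)))
            ≃-refl r J R x y (P j h) (P j (suc h))) ⟩
    (1ℝ - J) * (R * x + (1ℝ - R) * P j (suc h)) + r * J * y
      -- The deltas force h = j or h = j + 1, so `J` and `R` may be exchanged next to x, and `r * J`
      -- and `R` next to y.
      ≈⟨ ≃-by (- 1ℝ) (δ-transport (λ k → r ^ suc k) h j) (≃-by 1ℝ (δ-transport (λ k → r ^ suc k) h (suc j))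
           (solve 6 (λ r J R x y Pj′ → (con 1ℚ :- J) :* (R :* x :+ (con 1ℚ :- R) :* Pj′) :+ r :* J :* y :=
             ((R :* y :+ (con 1ℚ :- R) :* ((con 1ℚ :- J) :* Pj′ :+ J :* x)) :+ :- con 1ℚ :* (x :* J :- x :* R))
              :+ con 1ℚ :* (y :* (r :* J) :- y :* R)) ≃-refl r J R x y (P j (suc h)))) ⟩
    R * y + (1ℝ - R) * ((1ℝ - J) * P j (suc h) + J * x)
      ≈⟨ +-cong ≃-refl (*-cong ≃-refl (P-suc j (suc h))) ⟨
    R * y + (1ℝ - R) * P (suc j) (suc h) ∎
    where
    open ≤-Reasoning
    J = r ^ suc j
    R = r ^ suc h
    x = δ h j
    y = δ h (suc j)

^-≤1 : ∀ {r} → 0ℝ ≤ r → r ≤ 1ℝ → ∀ n → r ^ n ≤ 1ℝ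
^-≤1 0≤r r≤1 zero = ≤-refl
^-≤1 {r} 0≤r r≤1 (suc n) = ≤-trans (*-monoˡ-≤ 0≤r (^-≤1 0≤r r≤1 n)) (≤-resp (solve 1 (λ r → r :=
    r :* con 1ℚ) ≃-refl r) ≃-refl r≤1)

^-pos : ∀ {r} → 0ℝ < r → ∀ n → 0ℝ < r ^ n
^-pos 0<r zero    = 0<1ℝ
^-pos 0<r (suc n) = *-pos-ℝ 0<r (^-pos 0<r n)

null⇒converges : ∀ {s : ℕ → ℝ} → (∀ n → 0ℝ ≤ s n) → (∀ ε → 0ℝ < ε → Ev (λ n → s n ≤ ε)) → Converges s 0ℝ
null⇒converges {s} 0≤s small = converges-intro {s} {0ℝ} λ ε 0<ε →
  ev-map {λ n → s n ≤ ε} {λ n → (s n - 0ℝ ≤ ε) × (0ℝ - s n ≤ ε)}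
    (λ n p → ≤-resp (solve 1 (λ d → d := d :- con 0ℚ) ≃-refl (s n)) ≃-refl p
           , ≤-by (ε + s n) (+-nonneg (<⇒≤ 0<ε) (0≤s n)) (solve 2 (λ e d → e := (con 0ℚ :- d) :+ (e :+ d))
               ≃-refl ε (s n)))
    (small ε 0<ε)

Σ-δ-suc : ∀ (f : ℕ → ℝ) h n → suc h ℕ.< n → Σ< n (λ j → δ (suc h) (suc j) * f j) ≃ f h
Σ-δ-suc f h n h<n = Σ-δ f h n (ℕ.<-trans (ℕ.n<1+n h) h<n)

-- Stationarity implies the cut equation

module Stationarity (λH λE p : ℝ) (0<λH : 0ℝ < λH) (0<λE : 0ℝ < λE) (0<p : 0ℝ < p) (p<1 : p < 1ℝ) (d : ℕ) where

  open Transitions λH λE p d public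
  open ChainMatch λH λE p 1ℝ (suc d)
  open ≤-Reasoning

  0<r : 0ℝ < r
  0<r = x<y⇒0<y-x p<1

  r<1 : r < 1ℝ
  r<1 = <-by p 0<p (solve 1 (λ p → con 1ℚ := (con 1ℚ :- p) :+ p) ≃-refl p)

  0≤r^ : ∀ n → 0ℝ ≤ r ^ n
  0≤r^ = ^-nonneg (<⇒≤ 0<r)

  r^≤1 : ∀ n → r ^ n ≤ 1ℝ
  r^≤1 = ^-≤1 (<⇒≤ 0<r) (<⇒≤ r<1)

  0<1-r^ : ∀ n → 0ℝ < 1ℝ - r ^ suc n
  0<1-r^ n = x<y⇒0<y-x (≤-<-trans (≤-resp ≃-refl (solve 1 (λ r → r :* con 1ℚ := r)
      ≃-refl r) (*-monoˡ-≤ (<⇒≤ 0<r) (r^≤1 n))) r<1)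

  r^→0 : Converges (λ n → r ^ n) 0ℝ
  r^→0 = null⇒converges 0≤r^ (Ratio.null (λ n → r ^ n) 0≤r^ p 0<p 0 λ k _ → ≤-refl)

  0<α : 0ℝ < α
  0<α = *-pos-ℝ 0<λH (^-pos 0<r (suc d))

  0<β : 0ℝ < β
  0<β = +-nonneg-pos (*-nonneg (<⇒≤ 0<λH) (x≤y⇒0≤y-x (r^≤1 (suc d)))) 0<λE

  0<α+β : 0ℝ < α + β
  0<α+β = +-pos 0<α 0<β

  ρ : ℝ
  ρ = α * inverse (α + β) 0<α+β

  ρ*[α+β] : ρ * (α + β) ≃ α
  ρ*[α+β] = ≃-trans (solve 3 (λ a c i → a :* i :* c := a :* (c :* i)) ≃-refl α (α + β) (inverse (α + β) 0<α+β))
    (≃-trans (*-cong ≃-refl (*-inverseʳ (α + β) 0<α+β)) (solve 1 (λ a → a :* con 1ℚ := a) ≃-refl α))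

  [1-ρ]*[α+β] : (1ℝ - ρ) * (α + β) ≃ β
  [1-ρ]*[α+β] = ≃-by (- 1ℝ) ρ*[α+β] (solve 3 (λ ρ a b → (con 1ℚ :- ρ) :* (a :+ b) :=
      b :+ :- con 1ℚ :* (ρ :* (a :+ b) :- a)) ≃-refl ρ α β)

  0<ρ : 0ℝ < ρ
  0<ρ = *-pos-ℝ 0<α (inverse>0 (α + β) 0<α+β)

  0<1-ρ : 0ℝ < 1ℝ - ρ
  0<1-ρ = <-respʳ-≃ (≃-trans (*-cong (≃-sym [1-ρ]*[α+β]) ≃-refl)
     (≃-trans (solve 3 (λ x c i → x :* c :* i := x :* (c :* i)) ≃-refl (1ℝ - ρ) (α + β) (inverse (α + β) 0<α+β))
       (≃-trans (*-cong ≃-refl (*-inverseʳ (α + β) 0<α+β)) (solve 1 (λ a → a :* con 1ℚ := a) ≃-refl (1ℝ - ρ)))))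
     (*-pos-ℝ 0<β (inverse>0 (α + β) 0<α+β))

  -- The cut equation: flow from h to h + 1 against flow back across the cut.
  IsBalanced : (ℕ → ℝ) → Set
  IsBalanced w = ∀ h → (1ℝ - r ^ suc h) * w (suc h) ≃ ρ * w h

  generator-𝟙 : ∀ h e j k → generator (j , k) (h , e)
    ≃ β * segment j k (𝟙 (h , e)) + δ e k * (α * δ h (suc j) - (α + β) * δ h j)
  generator-𝟙 h e j k = ≃-trans (generator-eval j k (h , e)) (≃-trans
    (+-cong (+-cong ≃-refl (*-cong ≃-refl (𝟙-δ h e (suc j) k)))
       (-‿cong (*-cong ≃-refl (≃-trans (𝟙-δ j k h e) (*-cong (δ-sym j h) (δ-sym k e))))))
    (solve 6 (λ S a c x y z → S :+ a :* (x :* z) :- c :* (y :* z) := S :+ z :* (a :* x :- c :* y)) ≃-refl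
      (β * segment j k (𝟙 (h , e))) α (α + β) (δ h (suc j)) (δ h j) (δ e k)))

  generator-upper : ∀ h e j k → generator (j , k) (h , suc e) ≃ δ (suc e) k * (α * δ h (suc j) - (α + β) * δ h j)
  generator-upper h e j k = ≃-trans (generator-𝟙 h (suc e) j k)
    (≃-trans (+-cong (*-cong ≃-refl (segment-support (λ i → ≃-trans (𝟙-δ h (suc e) i 0)
        (solve 1 (λ x → x :* con 0ℚ := con 0ℚ) ≃-refl (δ h i))) j k)) ≃-refl)
      (solve 2 (λ b x → b :* con 0ℚ :+ x := x) ≃-refl β (δ (suc e) k * (α * δ h (suc j) - (α + β) * δ h j))))

  generator-0 : ∀ h j → generator (j , 0) (h , 0) ≃ β * P j h + (α * δ h (suc j) - (α + β) * δ h j)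
  generator-0 h j = ≃-trans (generator-𝟙 h 0 j 0) (+-cong ≃-refl (solve 1 (λ x → con 1ℚ :* x := x) ≃-refl _))

  -- The part of the balance at h that is not due to segments: unmatched H arrivals from h - 1, if
  -- there is such a state, against all arrivals at h. In equilibrium segments supply its negative.
  inflow : (ℕ → ℝ) → ℕ → ℝ
  inflow w zero    = - ((α + β) * w 0)
  inflow w (suc h) = α * w h - (α + β) * w (suc h)

  Σ-inflow : ∀ w h n → h ℕ.< n → Σ< n (λ j → w j * (α * δ h (suc j) - (α + β) * δ h j)) ≃ inflow w h
  Σ-inflow w h n h<n = ≃-trans
    (Σ-cong n λ j _ → solve 5 (λ w a c x y → w :* (a :* x :- c :* y) := a :* (x :* w) :+ :- c :* (y :* w))
        ≃-refl (w j) α (α + β) (δ h (suc j)) (δ h j))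
    (≃-trans (Σ-+ (λ j → α * (δ h (suc j) * w j)) (λ j → - (α + β) * (δ h j * w j)) n)
    (≃-trans (+-cong (Σ-*ˡ α (λ j → δ h (suc j) * w j) n)
        (≃-trans (Σ-*ˡ (- (α + β)) (λ j → δ h j * w j) n) (*-cong ≃-refl (Σ-δ w h n h<n))))
      (last h h<n)))
    where
    last : ∀ h → h ℕ.< n → α * Σ< n (λ j → δ h (suc j) * w j) + - (α + β) * w h ≃ inflow w h
    last zero _ = ≃-trans (+-cong (*-cong ≃-refl (Σ-zero n λ j _ → solve 1 (λ w → con 0ℚ :* w := con 0ℚ)
        ≃-refl (w j))) ≃-refl)
      (solve 3 (λ a c w → a :* con 0ℚ :+ :- c :* w := :- (c :* w)) ≃-refl α (α + β) (w 0))
    last (suc h) h<n = ≃-trans (+-cong (*-cong ≃-refl (Σ-δ-suc w h n h<n)) ≃-refl)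
      (solve 4 (λ a c w w′ → a :* w :+ :- c :* w′ := a :* w :- c :* w′) ≃-refl α (α + β) (w h) (w (suc h)))

  Σ-generator-0 : ∀ w h n → h ℕ.< n →
    Σ< n (λ j → w j * generator (j , 0) (h , 0)) ≃ β * Σ< n (λ j → w j * P j h) + inflow w h
  Σ-generator-0 w h n h<n = ≃-trans
    (Σ-cong n λ j _ → ≃-trans (*-cong ≃-refl (generator-0 h j))
      (solve 4 (λ w b P x → w :* (b :* P :+ x) := b :* (w :* P) :+ w :* x)
          ≃-refl (w j) β (P j h) (α * δ h (suc j) - (α + β) * δ h j)))
    (≃-trans (Σ-+ (λ j → β * (w j * P j h)) (λ j → w j * (α * δ h (suc j) - (α + β) * δ h j)) n)
      (+-cong (Σ-*ˡ β (λ j → w j * P j h) n) (Σ-inflow w h n h<n)))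

  row-0 : ∀ {f : State → ℝ} → (∀ h e → f (h , suc e) ≃ 0ℝ) → ∀ j k → f (j , k) ≃ δ 0 k * f (j , 0)
  row-0 {f} f≃0 j zero    = solve 1 (λ x → x := con 1ℚ :* x) ≃-refl (f (j , 0))
  row-0 {f} f≃0 j (suc k) = ≃-trans (f≃0 j k) (solve 1 (λ x → con 0ℚ := con 0ℚ :* x) ≃-refl (f (j , 0)))

  module Necessary (π : State → ℝ) (stationary : IsStationary π) where
    open IsStationary stationary

    w : ℕ → ℝ
    w h = π (h , 0)

    -- No segment stops in such a state, so the series has finitely many nonzero terms: the only
    -- supply comes from one H agent fewer in the same row.
    upper-balance : ∀ h e → inflow (λ j → π (j , suc e)) h ≃ 0ℝ
    upper-balance h e = conv-unique {λ n → Σ< n g} {inflow W h} {0ℝ}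
        (conv-resp {λ _ → inflow W h} {λ n → Σ< n g} (suc h , λ n h<n → ≃-sym (Σ-inflow W h n h<n)) ≃-refl
            (conv-const (inflow W h)))
        (hasSum⇒row (suc e) g row (balance (h , suc e)))
      where
      W : ℕ → ℝ
      W j = π (j , suc e)
      g : ℕ → ℝ
      g j = W j * (α * δ h (suc j) - (α + β) * δ h j)
      row : ∀ j k → π (j , k) * generator (j , k) (h , suc e) ≃ δ (suc e) k * g j
      row j k = ≃-trans (*-cong ≃-refl (generator-upper h e j k)) (≃-trans
        (solve 3 (λ p d x → p :* (d :* x) := d :* p :* x)
            ≃-refl (π (j , k)) (δ (suc e) k) (α * δ h (suc j) - (α + β) * δ h j))
        (≃-trans (*-cong (δ-transport (λ k → π (j , k)) (suc e) k) ≃-refl)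
          (solve 3 (λ p d x → d :* p :* x := d :* (p :* x))
              ≃-refl (W j) (δ (suc e) k) (α * δ h (suc j) - (α + β) * δ h j))))

    vanishes : ∀ h e → π (h , suc e) ≃ 0ℝ
    vanishes zero e = *-cancelʳ-≃ 0<α+β (≃-by (- 1ℝ) (upper-balance 0 e)
      (solve 2 (λ w c → w :* c := con 0ℚ :* c :+ :- con 1ℚ :* (:- (c :* w) :- con 0ℚ))
          ≃-refl (π (0 , suc e)) (α + β)))
    vanishes (suc h) e = *-cancelʳ-≃ 0<α+β (≃-by (- 1ℝ) (upper-balance (suc h) e) (≃-by α (vanishes h e)
      (solve 4 (λ w′ w c a → w′ :* c :=
          (con 0ℚ :* c :+ :- con 1ℚ :* ((a :* w :- c :* w′) :- con 0ℚ)) :+ a :* (w :- con 0ℚ)) ≃-refl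
        (π (suc h , suc e)) (π (h , suc e)) (α + β) α)))

    -- Balance at (h , 0), solved for the sum over segments. The equation supplies both the
    -- convergence of this sum and its value.
    outflow : ∀ h → Converges (λ n → β * Σ< n (λ j → w j * P j h)) (- inflow w h)
    outflow h = conv-resp {λ n → Σ< n g - inflow w h} {λ n → β * Σ< n (λ j → w j * P j h)}
      (suc h , λ n h<n → ≃-trans (+-cong (Σ-generator-0 w h n h<n) ≃-refl)
        (solve 2 (λ x y → (x :+ y) :- y := x) ≃-refl (β * Σ< n (λ j → w j * P j h)) (inflow w h)))
      (solve 1 (λ x → con 0ℚ :- x := :- x) ≃-refl (inflow w h))
      (conv-- {λ n → Σ< n g} {λ _ → inflow w h}
        (hasSum⇒row 0 g (row-0 λ j k → ≃-trans (*-cong (vanishes j k) ≃-refl)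
          (solve 1 (λ x → con 0ℚ :* x := con 0ℚ) ≃-refl (generator (j , suc k) (h , 0)))) (balance (h , 0)))
        (conv-const (inflow w h)))
      where
      g : ℕ → ℝ
      g j = w j * generator (j , 0) (h , 0)

    Σ-P-step : ∀ h n → h ℕ.< n → r * (β * Σ< n (λ j → w j * P j h))
      ≃ β * r ^ suc h * w h + (1ℝ - r ^ suc h) * (β * Σ< n (λ j → w j * P j (suc h)))
    Σ-P-step h n h<n = begin-equality
      r * (β * Σ< n (λ j → w j * P j h))
        ≈⟨ solve 3 (λ r b S → r :* (b :* S) := b :* (r :* S)) ≃-refl r β (Σ< n (λ j → w j * P j h)) ⟩
      β * (r * Σ< n (λ j → w j * P j h))
        ≈⟨ *-cong ≃-refl (Σ-*ˡ r (λ j → w j * P j h) n) ⟨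
      β * Σ< n (λ j → r * (w j * P j h))
        ≈⟨ *-cong ≃-refl (Σ-cong n λ j _ → pointwise j) ⟩
      β * Σ< n (λ j → R * (δ h j * w j) + (1ℝ - R) * (w j * P j (suc h)))
        ≈⟨ *-cong ≃-refl (≃-trans (Σ-+ (λ j → R * (δ h j * w j)) (λ j → (1ℝ - R) * (w j * P j (suc h))) n)
             (+-cong (≃-trans (Σ-*ˡ R (λ j → δ h j * w j) n) (*-cong
                 ≃-refl (Σ-δ w h n h<n))) (Σ-*ˡ (1ℝ - R) (λ j → w j * P j (suc h)) n))) ⟩
      β * (R * w h + (1ℝ - R) * Σ< n (λ j → w j * P j (suc h)))
        ≈⟨ solve 4 (λ b R w S → b :* (R :* w :+ (con 1ℚ :- R) :* S) :=
            b :* R :* w :+ (con 1ℚ :- R) :* (b :* S)) ≃-refl β R (w h) (Σ< n (λ j → w j * P j (suc h))) ⟩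
      β * R * w h + (1ℝ - R) * (β * Σ< n (λ j → w j * P j (suc h))) ∎
      where
      R = r ^ suc h
      pointwise : ∀ j → r * (w j * P j h) ≃ R * (δ h j * w j) + (1ℝ - R) * (w j * P j (suc h))
      pointwise j = ≃-by (w j) (P-step j h) (solve 6 (λ r w P R x P′ → r :* (w :* P) :=
          (R :* (x :* w) :+ (con 1ℚ :- R) :* (w :* P′)) :+ w :* (r :* P :- (R :* x :+ (con 1ℚ :- R) :* P′)))
        ≃-refl r (w j) (P j h) R (δ h j) (P j (suc h)))

    -- By `P-step`, r times the segment sum for h contains the segment sum for h + 1. Replacing both
    -- by their values from `outflow` leaves a finite relation.
    flow-step : ∀ h → r * (- inflow w h) ≃ β * r ^ suc h * w h + (1ℝ - r ^ suc h) * (- inflow w (suc h))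
    flow-step h = conv-unique {λ n → r * (β * Σ< n (λ j → w j * P j h))}
      (conv-*ˡ {λ n → β * Σ< n (λ j → w j * P j h)} r (outflow h))
      (conv-resp {λ n → β * r ^ suc h * w h + (1ℝ - r ^ suc h) * (β * Σ< n (λ j → w j * P j (suc h)))}
                 {λ n → r * (β * Σ< n (λ j → w j * P j h))} (suc h , λ n h<n → ≃-sym (Σ-P-step h n h<n)) ≃-refl
        (conv-+ {λ _ → β * r ^ suc h * w h} {λ n → (1ℝ - r ^ suc h) * (β * Σ< n (λ j → w j * P j (suc h)))}
          (conv-const (β * r ^ suc h * w h))
              (conv-*ˡ {λ n → β * Σ< n (λ j → w j * P j (suc h))} (1ℝ - r ^ suc h) (outflow (suc h)))))

    cut-step : ∀ h → - inflow w h ≃ (α + β) * r ^ h * w h → (1ℝ - r ^ suc h) * ((α + β) * w (suc h)) ≃ α * w h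
    cut-step h eq = ≃-by (- 1ℝ) (flow-step h) (≃-by r eq
      (solve 7 (λ r q w w′ a b i → (con 1ℚ :- r :* q) :* ((a :+ b) :* w′) :=
         (a :* w :+ :- con 1ℚ :* (r :* (:- i) :- (b :* (r :* q) :* w :+ (con 1ℚ :- r :* q) :* (:- (a :* w :- (a :+ b) :* w′)))))
          :+ r :* (:- i :- (a :+ b) :* q :* w)) ≃-refl r (r ^ h) (w h) (w (suc h)) α β (inflow w h)))

    -- The rate at which segments end in h, in closed form. The induction hypothesis removes w (h -
    -- 1) from `flow-step`, and what remains is the cut equation.
    cut : ∀ h → - inflow w h ≃ (α + β) * r ^ h * w h
    cut zero = solve 2 (λ c w → :- :- (c :* w) := c :* con 1ℚ :* w) ≃-refl (α + β) (w 0)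
    cut (suc h) = ≃-by 1ℝ (cut-step h (cut h))
      (solve 5 (λ c R w w′ a → :- (a :* w :- c :* w′) :=
          c :* R :* w′ :+ con 1ℚ :* ((con 1ℚ :- R) :* (c :* w′) :- a :* w)) ≃-refl
        (α + β) (r ^ suc h) (w h) (w (suc h)) α)

    balanced : IsBalanced w
    balanced h = *-cancelʳ-≃ 0<α+β (≃-by 1ℝ (cut-step h (cut h)) (≃-by (- w h) ρ*[α+β]
      (solve 6 (λ R w w′ c a ρ → (con 1ℚ :- R) :* w′ :* c :=
          (ρ :* w :* c :+ con 1ℚ :* ((con 1ℚ :- R) :* (c :* w′) :- a :* w)) :+ :- w :* (ρ :* c :- a)) ≃-refl
        (r ^ suc h) (w h) (w (suc h)) (α + β) α ρ)))

-- Existence and uniqueness of the stationary law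

δ-nonneg : ∀ m n → 0ℝ ≤ δ m n
δ-nonneg zero    zero    = <⇒≤ 0<1ℝ
δ-nonneg zero    (suc n) = ≤-refl
δ-nonneg (suc m) zero    = ≤-refl
δ-nonneg (suc m) (suc n) = δ-nonneg m n

module Solution (λH λE p : ℝ) (0<λH : 0ℝ < λH) (0<λE : 0ℝ < λE) (0<p : 0ℝ < p) (p<1 : p < 1ℝ) (d : ℕ) where

  open Stationarity λH λE p 0<λH 0<λE 0<p p<1 d public
  open ChainMatch λH λE p 1ℝ (suc d)
  open ≤-Reasoning

  q : ℕ → ℝ
  q zero    = 1ℝ
  q (suc h) = ρ * q h * inverse (1ℝ - r ^ suc h) (0<1-r^ h)

  q-balanced : IsBalanced q
  q-balanced h = ≃-trans (solve 4 (λ c ρ q i → c :* (ρ :* q :* i) := ρ :* q :* (c :* i)) ≃-refl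
      (1ℝ - r ^ suc h) ρ (q h) (inverse (1ℝ - r ^ suc h) (0<1-r^ h)))
    (≃-trans (*-cong ≃-refl (*-inverseʳ (1ℝ - r ^ suc h) (0<1-r^ h))) (solve 1 (λ x → x :* con 1ℚ := x)
        ≃-refl (ρ * q h)))

  0<q : ∀ h → 0ℝ < q h
  0<q zero    = 0<1ℝ
  0<q (suc h) = *-pos-ℝ (*-pos-ℝ 0<ρ (0<q h)) (inverse>0 (1ℝ - r ^ suc h) (0<1-r^ h))

  balanced-unique : ∀ {w} → IsBalanced w → ∀ h → w h ≃ w 0 * q h
  balanced-unique {w} w-balanced zero = solve 1 (λ x → x := x :* con 1ℚ) ≃-refl (w 0)
  balanced-unique {w} w-balanced (suc h) = *-cancelʳ-≃ (0<1-r^ h) (begin-equality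
    w (suc h) * C    ≈⟨ solve 2 (λ a b → a :* b := b :* a) ≃-refl (w (suc h)) C ⟩
    C * w (suc h)    ≈⟨ w-balanced h ⟩
    ρ * w h          ≈⟨ *-cong ≃-refl (balanced-unique w-balanced h) ⟩
    ρ * (w 0 * q h)  ≈⟨ solve 3 (λ ρ w q → ρ :* (w :* q) := w :* (ρ :* q)) ≃-refl ρ (w 0) (q h) ⟩
    w 0 * (ρ * q h)  ≈⟨ *-cong ≃-refl (q-balanced h) ⟨
    w 0 * (C * q (suc h)) ≈⟨ solve 3 (λ C w q → w :* (C :* q) := w :* q :* C) ≃-refl C (w 0) (q (suc h)) ⟩
    w 0 * q (suc h) * C ∎)
    where C = 1ℝ - r ^ suc h

  -- Once r ^ (h + 1) ≤ τ and (h + 1) τ ≥ 1, the ratio of consecutive terms of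
  -- (h + 1) q h is at most 1 - τ; D below is the slack.
  τ : ℝ
  τ = (1ℝ - ρ) * fromℚ (½ ℚ.* ½)

  0<τ : 0ℝ < τ
  0<τ = *-pos-ℝ 0<1-ρ (fromℚ-mono-< (ℚ.positive⁻¹ (½ ℚ.* ½)))

  -- The weight h + 1 dominates both 1 and h, so a single ratio test makes both the total mass and
  -- the mean summable.
  g : ℕ → ℝ
  g h = fromℕ (suc h) * q h

  g-ratio : ∀ h → r ^ suc h ≤ τ → 1ℝ ≤ fromℕ (suc h) * τ → g (suc h) ≤ (1ℝ - τ) * g h
  g-ratio h R≤τ 1≤mτ = *-cancelʳ-≤ 0<ρ (begin
    fromℕ (suc (suc h)) * q′ * ρ    ≈⟨ *-cong (*-cong (fromℕ-suc (suc h)) ≃-refl) ≃-refl ⟩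
    (1ℝ + m) * q′ * ρ               ≤⟨ ≤-by (D * q′) (*-nonneg 0≤D (<⇒≤ (0<q (suc h)))) identity ⟩
    (1ℝ - τ) * (m * ((1ℝ - R) * q′)) ≈⟨ *-cong ≃-refl (*-cong ≃-refl (q-balanced h)) ⟩
    (1ℝ - τ) * (m * (ρ * q h))      ≈⟨ solve 4 (λ t m ρ q → t :* (m :* (ρ :* q)) := t :* (m :* q) :* ρ)
        ≃-refl (1ℝ - τ) m ρ (q h) ⟩
    (1ℝ - τ) * g h * ρ ∎)
    where
    m = fromℕ (suc h)
    R = r ^ suc h
    q′ = q (suc h)
    D = m * (1ℝ - τ) * (τ - R) + (m * τ - 1ℝ) + (m * τ + m * τ * τ + (τ + τ + τ + τ))
    0≤mτ : 0ℝ ≤ m * τ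
    0≤mτ = *-nonneg (fromℕ≥0 (suc h)) (<⇒≤ 0<τ)
    0≤1-τ : 0ℝ ≤ 1ℝ - τ
    0≤1-τ = ≤-resp ≃-refl (solve 1 (λ ρ → ρ :+ (con 1ℚ :- ρ) :* con ½ :+ (con 1ℚ :- ρ) :* con (½ ℚ.* ½) :=
        con 1ℚ :- (con 1ℚ :- ρ) :* con (½ ℚ.* ½)) ≃-refl ρ)
      (+-nonneg (+-nonneg (<⇒≤ 0<ρ) (<⇒≤ (half>0ℝ 0<1-ρ))) (<⇒≤ 0<τ))
    0≤D : 0ℝ ≤ D
    0≤D = +-nonneg (+-nonneg (*-nonneg (*-nonneg (fromℕ≥0 (suc h)) 0≤1-τ) (x≤y⇒0≤y-x R≤τ)) (x≤y⇒0≤y-x 1≤mτ))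
      (+-nonneg (+-nonneg 0≤mτ (*-nonneg 0≤mτ (<⇒≤ 0<τ))) (<⇒≤ (+-pos (+-pos (+-pos 0<τ 0<τ) 0<τ) 0<τ)))
    identity : (1ℝ - τ) * (m * ((1ℝ - R) * q′)) ≃ (1ℝ + m) * q′ * ρ + D * q′
    identity = solve 4 (λ ρ m R q → let t = (con 1ℚ :- ρ) :* con (½ ℚ.* ½) in
      (con 1ℚ :- t) :* (m :* ((con 1ℚ :- R) :* q)) := (con 1ℚ :+ m) :* q :* ρ :+
        (m :* (con 1ℚ :- t) :* (t :- R) :+ (m :* t :- con 1ℚ) :+ (m :* t :+ m :* t :* t :+ (t :+ t :+ t :+ t))) :* q) ≃-refl ρ m R q′

  g-summable : Summable g
  g-summable = Ratio.summable g (λ h → *-nonneg (fromℕ≥0 (suc h)) (<⇒≤ (0<q h))) τ 0<τ (M ℕ.⊔ N) λ h ≤h →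
    g-ratio h (proj₂ r^≤τ (suc h) (ℕ.m≤n⇒m≤1+n (ℕ.m⊔n≤o⇒m≤o M N ≤h))) (large h (ℕ.m⊔n≤o⇒n≤o M N ≤h))
    where
    r^≤τ : Ev (λ n → r ^ n ≤ τ)
    r^≤τ = Ratio.null (λ n → r ^ n) 0≤r^ p 0<p 0 (λ k _ → ≤-refl) τ 0<τ
    M = proj₁ r^≤τ
    N = proj₁ (archimedean (inverse τ 0<τ))
    large : ∀ h → N ℕ.≤ h → 1ℝ ≤ fromℕ (suc h) * τ
    large h N≤h = ≤-resp (≃-trans (solve 2 (λ a b → a :* b := b :* a)
        ≃-refl (inverse τ 0<τ) τ) (*-inverseʳ τ 0<τ)) ≃-refl
      (*-monoʳ-≤ (<⇒≤ 0<τ) (≤-trans (<⇒≤ (proj₂ (archimedean (inverse τ 0<τ)))) (fromℕ-mono-≤ (ℕ.m≤n⇒m≤1+n N≤h))))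

  g-split : ∀ h → g h ≃ q h + fromℕ h * q h
  g-split h = ≃-trans (*-cong (fromℕ-suc h) ≃-refl) (solve 2 (λ h q → (con 1ℚ :+ h) :* q := q :+ h :* q)
      ≃-refl (fromℕ h) (q h))

  0≤hq : ∀ h → 0ℝ ≤ fromℕ h * q h
  0≤hq h = *-nonneg (fromℕ≥0 h) (<⇒≤ (0<q h))

  q-summable : Summable q
  q-summable = summable-dominated (λ h → <⇒≤ (0<q h)) (λ h → ≤-by (fromℕ h * q h) (0≤hq h) (g-split h)) g-summable

  hq-summable : Summable (λ h → fromℕ h * q h)
  hq-summable = summable-dominated 0≤hq (λ h → ≤-by (q h) (<⇒≤ (0<q h))
    (≃-trans (g-split h) (solve 2 (λ q x → q :+ x := x :+ q) ≃-refl (q h) (fromℕ h * q h)))) g-summable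

  S T : ℝ
  S = proj₁ q-summable
  T = proj₁ hq-summable

  0<S : 0ℝ < S
  0<S = <-≤-trans 0<1ℝ (≤-resp (solve 0 (con 0ℚ :+ con 1ℚ := con 1ℚ) ≃-refl) ≃-refl
    (series-≤-limit (λ h → <⇒≤ (0<q h)) (proj₂ q-summable) 1))

  P-nonneg : ∀ j h → 0ℝ ≤ P j h
  P-nonneg zero    h = ≤-resp ≃-refl (≃-sym (P-zero h)) (δ-nonneg h 0)
  P-nonneg (suc j) h = ≤-resp ≃-refl (≃-sym (P-suc j h))
    (+-nonneg (*-nonneg (<⇒≤ (0<1-r^ j)) (P-nonneg j h)) (*-nonneg (0≤r^ (suc j)) (δ-nonneg h (suc j))))

  -- Beyond h the terms w j P j h form a geometric progression of ratio ρ.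
  module Outflow (w : ℕ → ℝ) (0≤w : ∀ h → 0ℝ ≤ w h) (w-balanced : IsBalanced w) (h : ℕ) where
    K : ℝ
    K = r ^ h * w h

    v : ℕ → ℝ
    v j = w j * P j h

    V : ℕ → ℝ
    V n = Σ< n v

    v-zero : v 0 ≃ δ h 0 * K
    v-zero = ≃-trans (*-cong ≃-refl (P-zero h)) (≃-trans (solve 2 (λ w x → w :* x := x :* (con 1ℚ :* w))
        ≃-refl (w 0) (δ h 0))
      (δ-transport (λ k → r ^ k * w k) h 0))

    v-suc : ∀ j → v (suc j) ≃ ρ * v j + δ h (suc j) * K
    v-suc j = ≃-trans (*-cong ≃-refl (P-suc j h)) (≃-by (P j h) (w-balanced j)
        (≃-by 1ℝ (δ-transport (λ k → r ^ k * w k) h (suc j))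
      (solve 7 (λ w′ J P x ρ w K → w′ :* ((con 1ℚ :- J) :* P :+ J :* x) :=
         (ρ :* (w :* P) :+ x :* K :+ P :* ((con 1ℚ :- J) :* w′ :- ρ :* w)) :+ con 1ℚ :* (x :* (J :* w′) :- x :* K)) ≃-refl
         (w (suc j)) (r ^ suc j) (P j h) (δ h (suc j)) ρ (w j) K)))

    -- Summing the recursion of v expresses V through itself, so the geometric sum in `V-eval` needs
    -- no closed form of v; its boundary term v n tends to 0.
    V-suc : ∀ n → V (suc n) ≃ ρ * V n + Σ< (suc n) (λ j → δ h j * K)
    V-suc zero = ≃-trans (+-cong ≃-refl v-zero) (solve 2 (λ ρ x → con 0ℚ :+ x :=
        ρ :* con 0ℚ :+ (con 0ℚ :+ x)) ≃-refl ρ (δ h 0 * K))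
    V-suc (suc n) = ≃-trans (+-cong (V-suc n) (v-suc n))
      (solve 5 (λ ρ V I v x → (ρ :* V :+ I) :+ (ρ :* v :+ x) := ρ :* (V :+ v) :+ (I :+ x)) ≃-refl
        ρ (V n) (Σ< (suc n) (λ j → δ h j * K)) (v n) (δ h (suc n) * K))

    V-eval : ∀ n → h ℕ.< suc n → (1ℝ - ρ) * V n ≃ K - v n
    V-eval n h<1+n = ≃-by 1ℝ (≃-trans (V-suc n) (+-cong ≃-refl (Σ-δ (λ _ → K) h (suc n) h<1+n)))
      (solve 4 (λ ρ V v K → (con 1ℚ :- ρ) :* V := (K :- v) :+ con 1ℚ :* ((V :+ v) :- (ρ :* V :+ K)))
          ≃-refl ρ (V n) (v n) K)

    0≤v : ∀ j → 0ℝ ≤ v j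
    0≤v j = *-nonneg (0≤w j) (P-nonneg j h)

    v→0 : Converges v 0ℝ
    v→0 = null⇒converges 0≤v (Ratio.null v 0≤v (1ℝ - ρ) 0<1-ρ h ratio)
      where
      ratio : ∀ k → h ℕ.≤ k → v (suc k) ≤ (1ℝ - (1ℝ - ρ)) * v k
      ratio k h≤k = ≃⇒≤ (≃-trans (v-suc k) (≃-trans (+-cong
          ≃-refl (*-cong (δ-≢ h (suc k) (ℕ.<⇒≢ (s≤s h≤k))) ≃-refl))
        (solve 3 (λ ρ v K → ρ :* v :+ con 0ℚ :* K := (con 1ℚ :- (con 1ℚ :- ρ)) :* v) ≃-refl ρ (v k) K)))

    outflow : Converges (λ n → β * V n) ((α + β) * K)
    outflow = conv-resp {λ n → (α + β) * (K - v n)} {λ n → β * V n}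
      (h , λ n h≤n → ≃-trans (*-cong ≃-refl (≃-sym (V-eval n (s≤s h≤n))))
        (≃-trans (solve 3 (λ c x V → c :* (x :* V) := (x :* c) :* V)
            ≃-refl (α + β) (1ℝ - ρ) (V n)) (*-cong [1-ρ]*[α+β] ≃-refl)))
      (solve 2 (λ c K → c :* (K :- con 0ℚ) := c :* K) ≃-refl (α + β) K)
      (conv-*ˡ {λ n → K - v n} (α + β) (conv-- {λ _ → K} {v} (conv-const K) v→0))

  -- The converse of `cut`: with the segment sum evaluated by `Outflow`, the cut equation gives back
  -- balance at every (h , 0).
  balanced⇒inflow : ∀ {w} → IsBalanced w → ∀ h → (α + β) * (r ^ h * w h) + inflow w h ≃ 0ℝ
  balanced⇒inflow {w} w-balanced zero = solve 2 (λ c w → c :* (con 1ℚ :* w) :+ :- (c :* w) := con 0ℚ)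
      ≃-refl (α + β) (w 0)
  balanced⇒inflow {w} w-balanced (suc h) = ≃-by (- (α + β)) (w-balanced h) (≃-by (- w h) ρ*[α+β]
    (solve 6 (λ c R w w′ a ρ → c :* (R :* w′) :+ (a :* w :- c :* w′) :=
      (con 0ℚ :+ :- c :* ((con 1ℚ :- R) :* w′ :- ρ :* w)) :+ :- w :* (ρ :* c :- a))
          ≃-refl (α + β) (r ^ suc h) (w h) (w (suc h)) α ρ))

  π : State → ℝ
  π (h , zero)  = inverse S 0<S * q h
  π (h , suc _) = 0ℝ

  π-balanced : IsBalanced (λ h → π (h , 0))
  π-balanced h = ≃-trans (solve 3 (λ C i q → C :* (i :* q) := i :* (C :* q))
      ≃-refl (1ℝ - r ^ suc h) (inverse S 0<S) (q (suc h)))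
    (≃-trans (*-cong ≃-refl (q-balanced h)) (solve 3 (λ ρ i q → i :* (ρ :* q) := ρ :* (i :* q))
        ≃-refl ρ (inverse S 0<S) (q h)))

  0≤π : ∀ s → 0ℝ ≤ π s
  0≤π (h , zero)  = <⇒≤ (*-pos-ℝ (inverse>0 S 0<S) (0<q h))
  0≤π (h , suc e) = ≤-refl

  scaled-series : ∀ {f l} → Converges (λ n → Σ< n f) l → ∀ c → Converges (λ n → Σ< n (λ k → c * f k)) (c * l)
  scaled-series {f} {l} f→l c = conv-resp {λ n → c * Σ< n f} {λ n → Σ< n (λ k → c * f k)}
    (ev-always λ n → ≃-sym (Σ-*ˡ c f n)) ≃-refl (conv-*ˡ {λ n → Σ< n f} c f→l)

  inverse-S*S : inverse S 0<S * S ≃ 1ℝ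
  inverse-S*S = ≃-trans (solve 2 (λ a b → a :* b := b :* a) ≃-refl (inverse S 0<S) S) (*-inverseʳ S 0<S)

  π-stationary : IsStationary π
  π-stationary = record
    { nonNegative = 0≤π
    ; total = row⇒hasSum 0 (λ h → π (h , 0)) (row-0 {π} λ _ _ → ≃-refl)
        (conv-resp {λ n → Σ< n λ h → π (h , 0)} (ev-always λ _ → ≃-refl) inverse-S*S (scaled-series (proj₂ q-summable) (inverse S 0<S)))
    ; balance = balance
    }
    where
    balance : ∀ t → HasSum (λ s → π s * generator s t) 0ℝ
    balance (h , zero) = row⇒hasSum 0 (λ j → π (j , 0) * generator (j , 0) (h , 0))
      (row-0 {λ s → π s * generator s (h , 0)} λ j k → solve 1 (λ x → con 0ℚ :* x := con 0ℚ)
          ≃-refl (generator (j , suc k) (h , 0)))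
      (conv-resp {λ n → β * Outflow.V w (λ h → 0≤π (h , 0)) π-balanced h n + inflow w h} {λ n → Σ< n λ j → w j * generator (j , 0) (h , 0)}
        (suc h , λ n h<n → ≃-sym (Σ-generator-0 w h n h<n)) (balanced⇒inflow π-balanced h)
        (conv-+ {λ n → β * Outflow.V w (λ h → 0≤π (h , 0)) π-balanced h n} {λ _ → inflow w h}
          (Outflow.outflow w (λ h → 0≤π (h , 0)) π-balanced h) (conv-const (inflow w h))))
      where
      w : ℕ → ℝ
      w j = π (j , 0)
    balance (h , suc e) = row⇒hasSum 0 (λ _ → 0ℝ) vanish
      (conv-resp {λ _ → 0ℝ} {λ n → Σ< n λ _ → 0ℝ} (ev-always λ n → ≃-sym (Σ-zero n λ _ _ → ≃-refl)) ≃-refl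
          (conv-const 0ℝ))
      where
      vanish : ∀ j k → π (j , k) * generator (j , k) (h , suc e) ≃ δ 0 k * 0ℝ
      vanish j zero = ≃-trans (*-cong ≃-refl (generator-upper h e j 0))
        (solve 2 (λ x y → x :* (con 0ℚ :* y) := con 1ℚ :* con 0ℚ)
            ≃-refl (π (j , 0)) (α * δ h (suc j) - (α + β) * δ h j))
      vanish j (suc k) = 0*-cong (generator (j , suc k) (h , suc e)) 0ℝ

  mean-row : ∀ {π : State → ℝ} → (∀ h e → π (h , suc e) ≃ 0ℝ) → ∀ j k →
    fromℕ j * π (j , k) ≃ δ 0 k * (fromℕ j * π (j , 0))
  mean-row {π} vanish = row-0 {λ (h , e) → fromℕ h * π (h , e)} λ h e → ≃-trans (*-cong ≃-refl (vanish h e))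
    (solve 1 (λ x → x :* con 0ℚ := con 0ℚ) ≃-refl (fromℕ h))

  hasMean : IsMeanH (inverse S 0<S * T)
  hasMean = π , π-stationary , row⇒hasSum 0 (λ h → fromℕ h * π (h , 0)) (mean-row {π} λ _ _ → ≃-refl)
    (conv-resp {λ n → Σ< n λ h → inverse S 0<S * (fromℕ h * q h)} {λ n → Σ< n λ h → fromℕ h * π (h , 0)}
      (ev-always λ n → Σ-cong n λ h _ → solve 3 (λ i h q → i :* (h :* q) := h :* (i :* q))
          ≃-refl (inverse S 0<S) (fromℕ h) (q h))
      ≃-refl (scaled-series (proj₂ hq-summable) (inverse S 0<S)))

  module Mean {m : ℝ} (isMean : IsMeanH m) where
    open IsStationary (proj₁ (proj₂ isMean)) using (nonNegative; total)
    open Necessary (proj₁ isMean) (proj₁ (proj₂ isMean)) using (w; vanishes; balanced) public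

    0≤w : ∀ h → 0ℝ ≤ w h
    0≤w h = nonNegative (h , 0)

    w-total : Converges (λ n → Σ< n w) 1ℝ
    w-total = hasSum⇒row 0 w (row-0 {proj₁ isMean} vanishes) total

    w-mean : Converges (λ n → Σ< n λ h → fromℕ h * w h) m
    w-mean = hasSum⇒row 0 (λ h → fromℕ h * w h) (mean-row {proj₁ isMean} vanishes) (proj₂ (proj₂ isMean))

    -- The cut equation fixes any stationary law up to its value at 0, and the total mass fixes that
    -- value. So every admissible mean is the constructed one.
    w0*S : w 0 * S ≃ 1ℝ
    w0*S = conv-unique {λ n → Σ< n λ h → w 0 * q h} (scaled-series (proj₂ q-summable) (w 0))
      (conv-resp {λ n → Σ< n w} {λ n → Σ< n λ h → w 0 * q h} (ev-always λ n → Σ-cong n λ h _ → balanced-unique balanced h) ≃-refl w-total)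

    w0≃ : w 0 ≃ inverse S 0<S
    w0≃ = *-cancelʳ-≃ 0<S (≃-trans w0*S (≃-sym inverse-S*S))

    0<w0 : 0ℝ < w 0
    0<w0 = <-respʳ-≃ (≃-sym w0≃) (inverse>0 S 0<S)

    mean≃ : m ≃ inverse S 0<S * T
    mean≃ = ≃-trans (conv-unique {λ n → Σ< n λ h → fromℕ h * w h} w-mean
      (conv-resp {λ n → Σ< n λ h → w 0 * (fromℕ h * q h)} {λ n → Σ< n λ h → fromℕ h * w h}
        (ev-always λ n → Σ-cong n λ h _ → ≃-trans (solve 3 (λ i h q → i :* (h :* q) := h :* (i :* q))
            ≃-refl (w 0) (fromℕ h) (q h))
          (*-cong ≃-refl (≃-sym (balanced-unique balanced h))))
              ≃-refl (scaled-series (proj₂ hq-summable) (w 0))))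
      (*-cong w0≃ ≃-refl)

-- Asymptotics of the mean as p → 0

^-*-distrib : ∀ x y n → (x * y) ^ n ≃ x ^ n * y ^ n
^-*-distrib x y zero = solve 0 (con 1ℚ := con 1ℚ :* con 1ℚ) ≃-refl
^-*-distrib x y (suc n) = ≃-trans (*-cong ≃-refl (^-*-distrib x y n))
  (solve 4 (λ x y a b → x :* y :* (a :* b) := x :* a :* (y :* b)) ≃-refl x y (x ^ n) (y ^ n))

1^ : ∀ n → 1ℝ ^ n ≃ 1ℝ
1^ zero    = ≃-refl
1^ (suc n) = ≃-trans (*-cong ≃-refl (1^ n)) (solve 0 (con 1ℚ :* con 1ℚ := con 1ℚ) ≃-refl)

bernoulli-inequality : ∀ p → 0ℝ ≤ p → p ≤ 1ℝ → ∀ n → 1ℝ - (1ℝ - p) ^ n ≤ fromℕ n * p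
bernoulli-inequality p 0≤p p≤1 zero = ≃⇒≤ (solve 1 (λ p → con 1ℚ :- con 1ℚ := con 0ℚ :* p) ≃-refl p)
bernoulli-inequality p 0≤p p≤1 (suc n) = ≤-by ((fromℕ n * p - (1ℝ - R)) + p * (1ℝ - R))
  (+-nonneg (x≤y⇒0≤y-x (bernoulli-inequality p 0≤p p≤1 n))
    (*-nonneg 0≤p (x≤y⇒0≤y-x (^-≤1 (x≤y⇒0≤y-x p≤1) (≤-by p 0≤p (solve 1 (λ p → con 1ℚ := (con 1ℚ :- p) :+ p)
        ≃-refl p)) n))))
  (≃-trans (*-cong (fromℕ-suc n) ≃-refl)
    (solve 3 (λ p n R → (con 1ℚ :+ n) :* p :=
        (con 1ℚ :- (con 1ℚ :- p) :* R) :+ ((n :* p :- (con 1ℚ :- R)) :+ p :* (con 1ℚ :- R)))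
      ≃-refl p (fromℕ n) R))
  where R = (1ℝ - p) ^ n

module Asymptotics (λH λE p : ℝ) (0<λH : 0ℝ < λH) (0<λE : 0ℝ < λE) (0<p : 0ℝ < p) (p<1 : p < 1ℝ) (d : ℕ)
  (m : ℝ) (isMean : ChainMatch.IsMeanH λH λE p 1ℝ (suc d) m)
  (x L : ℝ) (0<x : 0ℝ < x) (x*λE : x * λE ≃ λH) (0≤L : 0ℝ ≤ L) (exp-L : IsExp L (1ℝ + x)) where

  open Solution λH λE p 0<λH 0<λE 0<p p<1 d
  open Mean isMean
  open ≤-Reasoning

  -- F k and D k are the expectations of (r ^ h) ^ k and h (r ^ h) ^ k.
  W : ℕ → ℕ → ℝ
  W k h = (r ^ h) ^ k

  W-suc : ∀ k h → W k (suc h) ≃ r ^ k * W k h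
  W-suc k h = ^-*-distrib r (r ^ h) k

  W-zero : ∀ k → W k 0 ≃ 1ℝ
  W-zero = 1^

  0≤W : ∀ k h → 0ℝ ≤ W k h
  0≤W k h = ^-nonneg (0≤r^ h) k

  W≤1 : ∀ k h → W k h ≤ 1ℝ
  W≤1 k h = ^-≤1 (0≤r^ h) (r^≤1 h) k

  wW hwW : ℕ → ℕ → ℝ
  wW k h = w h * W k h
  hwW k h = fromℕ h * wW k h

  0≤wW : ∀ k h → 0ℝ ≤ wW k h
  0≤wW k h = *-nonneg (0≤w h) (0≤W k h)

  0≤hwW : ∀ k h → 0ℝ ≤ hwW k h
  0≤hwW k h = *-nonneg (fromℕ≥0 h) (0≤wW k h)

  wW≤w : ∀ k h → wW k h ≤ w h
  wW≤w k h = ≤-resp ≃-refl (solve 1 (λ w → w :* con 1ℚ := w) ≃-refl (w h)) (*-monoˡ-≤ (0≤w h) (W≤1 k h))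

  wW-summable : ∀ k → Summable (wW k)
  wW-summable k = summable-dominated (0≤wW k) (wW≤w k) (1ℝ , w-total)

  hwW-summable : ∀ k → Summable (hwW k)
  hwW-summable k = summable-dominated (0≤hwW k) (λ h → *-monoˡ-≤ (fromℕ≥0 h) (wW≤w k h)) (m , w-mean)

  F D : ℕ → ℝ
  F k = proj₁ (wW-summable k)
  D k = proj₁ (hwW-summable k)

  F-limit : ∀ k → Converges (λ n → Σ< n (wW k)) (F k)
  F-limit k = proj₂ (wW-summable k)

  D-limit : ∀ k → Converges (λ n → Σ< n (hwW k)) (D k)
  D-limit k = proj₂ (hwW-summable k)

  F-zero : F 0 ≃ 1ℝ
  F-zero = conv-unique {λ n → Σ< n (wW 0)} (F-limit 0)
    (conv-resp {λ n → Σ< n w} {λ n → Σ< n (wW 0)} (ev-always λ n → Σ-cong n λ h _ → solve 1 (λ w → w :=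
        w :* con 1ℚ) ≃-refl (w h)) ≃-refl w-total)

  D-zero : D 0 ≃ m
  D-zero = conv-unique {λ n → Σ< n (hwW 0)} (D-limit 0)
    (conv-resp {λ n → Σ< n λ h → fromℕ h * w h} {λ n → Σ< n (hwW 0)}
      (ev-always λ n → Σ-cong n λ h _ → *-cong ≃-refl (solve 1 (λ w → w := w :* con 1ℚ) ≃-refl (w h)))
          ≃-refl w-mean)

  -- (1 - r ^ (h + 1)) w (h + 1) = ρ w h, tested against (r ^ (h + 1)) ^ k.
  balanced-W : ∀ k h → wW k (suc h) - wW (suc k) (suc h) ≃ ρ * r ^ k * wW k h
  balanced-W k h = ≃-by (W k (suc h)) (balanced h) (≃-trans
    (solve 3 (λ w′ R W → w′ :* W :- w′ :* (R :* W) := (con 1ℚ :- R) :* w′ :* W)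
        ≃-refl (w (suc h)) (r ^ suc h) (W k (suc h)))
    (≃-by (ρ * w h) (W-suc k h)
      (solve 7 (λ ρ w w′ R W′ W q → (con 1ℚ :- R) :* w′ :* W′ :=
         (ρ :* q :* (w :* W) :+ W′ :* ((con 1ℚ :- R) :* w′ :- ρ :* w)) :+ ρ :* w :* (W′ :- q :* W)) ≃-refl
       ρ (w h) (w (suc h)) (r ^ suc h) (W k (suc h)) (W k h) (r ^ k))))

  -- At h = 0 both test functions equal 1, so the shift from h to h + 1 leaves no boundary term.
  F-partial : ∀ k n → Σ< (suc n) (wW k) - Σ< (suc n) (wW (suc k)) ≃ ρ * r ^ k * Σ< n (wW k)
  F-partial k zero = solve 3 (λ w W c → (con 0ℚ :+ w :* W) :- (con 0ℚ :+ w :* (con 1ℚ :* W)) := c :* con 0ℚ)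
      ≃-refl (w 0) (W k 0) (ρ * r ^ k)
  F-partial k (suc n) = ≃-by 1ℝ (F-partial k n) (≃-by 1ℝ (balanced-W k n)
    (solve 7 (λ a b a′ b′ c S s → (a :+ a′) :- (b :+ b′) :=
        (c :* (S :+ s) :+ con 1ℚ :* ((a :- b) :- c :* S)) :+ con 1ℚ :* ((a′ :- b′) :- c :* s)) ≃-refl
      (Σ< (suc n) (wW k)) (Σ< (suc n) (wW (suc k))) (wW k (suc n)) (wW (suc k) (suc n)) (ρ * r ^ k) (Σ< n (wW k)) (wW k n)))

  -- The shifted weight h + 1 splits into h and 1; the second part is how F enters the recursion of
  -- D.
  D-partial : ∀ k n → Σ< (suc n) (hwW k) - Σ< (suc n) (hwW (suc k)) ≃ ρ * r ^ k * (Σ< n (hwW k) + Σ< n (wW k))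
  D-partial k zero = solve 3 (λ x y c → (con 0ℚ :+ con 0ℚ :* x) :- (con 0ℚ :+ con 0ℚ :* y) :=
      c :* (con 0ℚ :+ con 0ℚ)) ≃-refl (wW k 0) (wW (suc k) 0) (ρ * r ^ k)
  D-partial k (suc n) = ≃-by 1ℝ (D-partial k n) (≃-by (fromℕ (suc n)) (balanced-W k n)
      (≃-by (ρ * r ^ k * wW k n) (fromℕ-suc n)
    (solve 10 (λ a b a′ b′ c S S₁ s N n → (a :+ N :* a′) :- (b :+ N :* b′) :=
        ((c :* ((S :+ n :* s) :+ (S₁ :+ s)) :+ con 1ℚ :* ((a :- b) :- c :* (S :+ S₁))) :+ N :* ((a′ :- b′) :- c :* s)) :+ c :* s :* (N :- (con 1ℚ :+ n))) ≃-refl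
      (Σ< (suc n) (hwW k)) (Σ< (suc n) (hwW (suc k))) (wW k (suc n)) (wW (suc k) (suc n)) (ρ * r ^ k)
      (Σ< n (hwW k)) (Σ< n (wW k)) (wW k n) (fromℕ (suc n)) (fromℕ n))))

  F-step : ∀ k → F k - F (suc k) ≃ ρ * r ^ k * F k
  F-step k = conv-unique {λ n → ρ * r ^ k * Σ< n (wW k)}
    (conv-resp {λ n → Σ< (suc n) (wW k) - Σ< (suc n) (wW (suc k))} {λ n → ρ * r ^ k * Σ< n (wW k)} (ev-always (F-partial k)) ≃-refl
      (conv-- {λ n → Σ< (suc n) (wW k)} {λ n → Σ< (suc n) (wW (suc k))}
          (conv-suc {λ n → Σ< n (wW k)} (F-limit k)) (conv-suc {λ n → Σ< n (wW (suc k))} (F-limit (suc k)))))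
    (conv-*ˡ {λ n → Σ< n (wW k)} (ρ * r ^ k) (F-limit k))

  D-step : ∀ k → D k - D (suc k) ≃ ρ * r ^ k * (D k + F k)
  D-step k = conv-unique {λ n → ρ * r ^ k * (Σ< n (hwW k) + Σ< n (wW k))}
    (conv-resp {λ n → Σ< (suc n) (hwW k) - Σ< (suc n) (hwW (suc k))} {λ n → ρ * r ^ k * (Σ< n (hwW k) + Σ< n (wW k))} (ev-always (D-partial k)) ≃-refl
      (conv-- {λ n → Σ< (suc n) (hwW k)} {λ n → Σ< (suc n) (hwW (suc k))}
          (conv-suc {λ n → Σ< n (hwW k)} (D-limit k)) (conv-suc {λ n → Σ< n (hwW (suc k))} (D-limit (suc k)))))
    (conv-*ˡ {λ n → Σ< n (hwW k) + Σ< n (wW k)} (ρ * r ^ k)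
        (conv-+ {λ n → Σ< n (hwW k)} {λ n → Σ< n (wW k)} (D-limit k) (F-limit k)))

  w0≤F : ∀ k → w 0 ≤ F k
  w0≤F k = ≤-resp (≃-trans (+-cong ≃-refl (*-cong ≃-refl (W-zero k)))
      (solve 1 (λ w → con 0ℚ :+ w :* con 1ℚ := w) ≃-refl (w 0))) ≃-refl
    (series-≤-limit (0≤wW k) (F-limit k) 1)

  0<F : ∀ k → 0ℝ < F k
  0<F k = <-≤-trans 0<w0 (w0≤F k)

  0≤D : ∀ k → 0ℝ ≤ D k
  0≤D k = series-≤-limit (0≤hwW k) (D-limit k) 0

  0≤m : 0ℝ ≤ m
  0≤m = ≤-resp ≃-refl D-zero (0≤D 0)

  -- For h ≥ 1 the factor (r ^ h) ^ k is at most r ^ k, and for h = 0 the weight h vanishes. Hence D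
  -- k decays, whereas F k keeps the mass at 0.
  hwW≤ : ∀ k h → hwW k h ≤ r ^ k * (fromℕ h * w h)
  hwW≤ k zero    = ≃⇒≤ (solve 3 (λ x y c → con 0ℚ :* x := c :* (con 0ℚ :* y)) ≃-refl (wW k 0) (w 0) (r ^ k))
  hwW≤ k (suc h) = begin
    N * (w (suc h) * W k (suc h))   ≈⟨ *-cong ≃-refl (*-cong ≃-refl (W-suc k h)) ⟩
    N * (w (suc h) * (r ^ k * W k h)) ≈⟨ solve 4 (λ N w q W → N :* (w :* (q :* W)) := q :* (N :* w) :* W)
        ≃-refl N (w (suc h)) (r ^ k) (W k h) ⟩
    r ^ k * (N * w (suc h)) * W k h ≤⟨ *-monoˡ-≤ (*-nonneg (0≤r^ k)
        (*-nonneg (fromℕ≥0 (suc h)) (0≤w (suc h)))) (W≤1 k h) ⟩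
    r ^ k * (N * w (suc h)) * 1ℝ    ≈⟨ solve 1 (λ x → x :* con 1ℚ := x) ≃-refl (r ^ k * (N * w (suc h))) ⟩
    r ^ k * (N * w (suc h)) ∎
    where N = fromℕ (suc h)

  D≤ : ∀ k → D k ≤ r ^ k * m
  D≤ k = conv-≤ {λ n → Σ< n (hwW k)} {λ n → r ^ k * Σ< n (λ h → fromℕ h * w h)}
    (ev-always λ n → ≤-resp ≃-refl (Σ-*ˡ (r ^ k) (λ h → fromℕ h * w h) n) (Σ-mono n λ h _ → hwW≤ k h))
    (D-limit k) (conv-*ˡ {λ n → Σ< n (λ h → fromℕ h * w h)} (r ^ k) w-mean)

  z : ℕ → ℝ
  z k = 1ℝ - ρ * r ^ k

  z-zero : z 0 ≃ 1ℝ - ρ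
  z-zero = solve 1 (λ ρ → con 1ℚ :- ρ :* con 1ℚ := con 1ℚ :- ρ) ≃-refl ρ

  0<z : ∀ k → 0ℝ < z k
  0<z k = <-≤-trans 0<1-ρ (≤-by (ρ * (1ℝ - r ^ k)) (*-nonneg (<⇒≤ 0<ρ) (x≤y⇒0≤y-x (r^≤1 k)))
    (solve 2 (λ ρ q → con 1ℚ :- ρ :* q := (con 1ℚ :- ρ) :+ ρ :* (con 1ℚ :- q)) ≃-refl ρ (r ^ k)))

  z≤1 : ∀ k → z k ≤ 1ℝ
  z≤1 k = ≤-by (ρ * r ^ k) (*-nonneg (<⇒≤ 0<ρ) (0≤r^ k)) (solve 1 (λ y → con 1ℚ := (con 1ℚ :- y) :+ y)
      ≃-refl (ρ * r ^ k))

  Δ : ℕ → ℝ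
  Δ k = p * (ρ * r ^ k)

  0≤Δ : ∀ k → 0ℝ ≤ Δ k
  0≤Δ k = *-nonneg (<⇒≤ 0<p) (*-nonneg (<⇒≤ 0<ρ) (0≤r^ k))

  z-suc : ∀ k → z (suc k) - z k ≃ Δ k
  z-suc k = solve 3 (λ p ρ q → (con 1ℚ :- ρ :* ((con 1ℚ :- p) :* q)) :- (con 1ℚ :- ρ :* q) := p :* (ρ :* q))
      ≃-refl p ρ (r ^ k)

  z⁻¹ : ℕ → ℝ
  z⁻¹ k = inverse (z k) (0<z k)

  0≤z⁻¹ : ∀ k → 0ℝ ≤ z⁻¹ k
  0≤z⁻¹ k = <⇒≤ (inverse>0 (z k) (0<z k))

  s t : ℕ → ℝ
  s k = Δ k * z⁻¹ k
  t k = Δ k * z⁻¹ (suc k)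

  0≤s : ∀ k → 0ℝ ≤ s k
  0≤s k = *-nonneg (0≤Δ k) (0≤z⁻¹ k)

  0≤t : ∀ k → 0ℝ ≤ t k
  0≤t k = *-nonneg (0≤Δ k) (0≤z⁻¹ (suc k))

  cancel-z : ∀ y k → y * z⁻¹ k * z k ≃ y
  cancel-z y k = ≃-trans (solve 3 (λ y i z → y :* i :* z := y :* (z :* i)) ≃-refl y (z⁻¹ k) (z k))
    (≃-trans (*-cong ≃-refl (*-inverseʳ (z k) (0<z k))) (solve 1 (λ y → y :* con 1ℚ := y) ≃-refl y))

  s*z : ∀ k → s k * z k ≃ Δ k
  s*z k = cancel-z (Δ k) k

  open RiemannSums z s t 0<z 0≤s 0≤t (λ k → ≃-trans (s*z k) (≃-sym (z-suc k)))
    (λ k → ≃-trans (cancel-z (Δ k) (suc k)) (≃-sym (z-suc k)))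

  -- The recursions of F and D make p D k / F k drop by s k at each step, starting from p m. The
  -- relation is stated without division.
  remainder : ∀ k → (p * m - Σ< k s) * F k ≃ p * D k
  remainder zero = ≃-trans (*-cong ≃-refl F-zero) (≃-trans (solve 2 (λ p m → (p :* m :- con 0ℚ) :* con 1ℚ :=
      p :* m) ≃-refl p m) (*-cong ≃-refl (≃-sym D-zero)))
  remainder (suc k) = ≃-by (z k) (remainder k) (≃-by (- F k) (s*z k)
      (≃-by (- (p * m - (Σ< k s + s k))) (F-step k) (≃-by p (D-step k)
    (solve 10 (λ p m S s F F′ D D′ ρ q → (p :* m :- (S :+ s)) :* F′ :=
       (((p :* D′ :+ (con 1ℚ :- ρ :* q) :* ((p :* m :- S) :* F :- p :* D)) :+ :- F :* (s :* (con 1ℚ :- ρ :* q) :- p :* (ρ :* q)))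
         :+ :- (p :* m :- (S :+ s)) :* ((F :- F′) :- ρ :* q :* F)) :+ p :* ((D :- D′) :- ρ :* q :* (D :+ F))) ≃-refl
      p m (Σ< k s) (s k) (F k) (F (suc k)) (D k) (D (suc k)) ρ (r ^ k)))))

  partial≤ : ∀ k → Σ< k s ≤ p * m
  partial≤ k = ≤-by (p * m - Σ< k s) (*-cancelʳ-≤ (0<F k) (≤-resp (solve 1 (λ y → con 0ℚ := con 0ℚ :* y)
      ≃-refl (F k)) (≃-sym (remainder k))
      (*-nonneg (<⇒≤ 0<p) (0≤D k)))) (solve 2 (λ y S → y := S :+ (y :- S)) ≃-refl (p * m) (Σ< k s))

  remainder≤ : ∀ k → (p * m - Σ< k s) * w 0 ≤ p * m * r ^ k
  remainder≤ k = begin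
    (p * m - Σ< k s) * w 0 ≤⟨ *-monoˡ-≤ (x≤y⇒0≤y-x (partial≤ k)) (w0≤F k) ⟩
    (p * m - Σ< k s) * F k ≈⟨ remainder k ⟩
    p * D k                ≤⟨ *-monoˡ-≤ (<⇒≤ 0<p) (D≤ k) ⟩
    p * (r ^ k * m)        ≈⟨ solve 3 (λ p q m → p :* (q :* m) := p :* m :* q) ≃-refl p (r ^ k) m ⟩
    p * m * r ^ k          ∎

  0≤pm : 0ℝ ≤ p * m
  0≤pm = *-nonneg (<⇒≤ 0<p) 0≤m

  -- If u were 1, scaling [1 - ρ , 1] by 1 + x would give exactly [1 , 1 + x]. The term x (1 - u) is
  -- the error caused by H agents matched on arrival.
  [1-ρ]*[1+x] : (1ℝ - ρ) * (1ℝ + x) ≃ 1ℝ + x * (1ℝ - u)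
  [1-ρ]*[1+x] = *-cancelʳ-≃ 0<α+β (≃-by (1ℝ + x) [1-ρ]*[α+β] (≃-by u x*λE
    (solve 5 (λ ρ x lH lE u → let a = lH :* u ; b = lH :* (con 1ℚ :- u) :+ lE in
      (con 1ℚ :- ρ) :* (con 1ℚ :+ x) :* (a :+ b) :=
        ((con 1ℚ :+ x :* (con 1ℚ :- u)) :* (a :+ b) :+ (con 1ℚ :+ x) :* ((con 1ℚ :- ρ) :* (a :+ b) :- b)) :+ u :* (x :* lE :- lH)) ≃-refl ρ x λH λE u)))

  1≤[1-ρ]*[1+x] : 1ℝ ≤ (1ℝ - ρ) * (1ℝ + x)
  1≤[1-ρ]*[1+x] = ≤-by (x * (1ℝ - u)) (*-nonneg (<⇒≤ 0<x) (x≤y⇒0≤y-x (r^≤1 (suc d)))) [1-ρ]*[1+x]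

  0<1+x : 0ℝ < 1ℝ + x
  0<1+x = +-pos 0<1ℝ 0<x

  -- This is ρ / (1 - ρ) ≤ x. The term s 0 is the only one of the upper sum that `s-suc≤t` does not
  -- bound by a term of the lower sum.
  s-zero≤ : s 0 ≤ p * x
  s-zero≤ = *-cancelʳ-≤ (0<z 0) (≤-resp (≃-sym (s*z 0)) (*-cong ≃-refl (≃-sym z-zero))
    (≤-by (p * ((1ℝ - ρ) * (1ℝ + x) - 1ℝ)) (*-nonneg (<⇒≤ 0<p) (x≤y⇒0≤y-x 1≤[1-ρ]*[1+x]))
      (solve 3 (λ p ρ x → p :* x :* (con 1ℚ :- ρ) :=
          p :* (ρ :* con 1ℚ) :+ p :* ((con 1ℚ :- ρ) :* (con 1ℚ :+ x) :- con 1ℚ)) ≃-refl p ρ x)))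

  lower-sum≤L : ∀ k → Σ< k t ≤ L
  lower-sum≤L k = exp-cancel-≤ 0≤L ec exp-L (*-cancelʳ-≤ 0<1-ρ (begin
    c * (1ℝ - ρ)         ≈⟨ *-cong ≃-refl z-zero ⟨
    c * z 0              ≤⟨ lower-sum k ec ⟩
    z k                  ≤⟨ z≤1 k ⟩
    1ℝ                   ≤⟨ 1≤[1-ρ]*[1+x] ⟩
    (1ℝ - ρ) * (1ℝ + x)  ≈⟨ solve 2 (λ a b → a :* b := b :* a) ≃-refl (1ℝ - ρ) (1ℝ + x) ⟩
    (1ℝ + x) * (1ℝ - ρ) ∎))
    where
    c = proj₁ (exp-Σ {t} 0≤t k)
    ec : IsExp (Σ< k t) c
    ec = proj₂ (exp-Σ {t} 0≤t k)

  s-suc≤t : ∀ k → s (suc k) ≤ t k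
  s-suc≤t k = *-monoʳ-≤ (0≤z⁻¹ (suc k)) (≤-by (p * Δ k) (*-nonneg (<⇒≤ 0<p) (0≤Δ k))
    (solve 3 (λ p ρ q → p :* (ρ :* q) := p :* (ρ :* ((con 1ℚ :- p) :* q)) :+ p :* (p :* (ρ :* q)))
        ≃-refl p ρ (r ^ k)))

  partial-sum≤ : ∀ k → Σ< (suc k) s ≤ L + p * x
  partial-sum≤ k = begin
    Σ< (suc k) s                  ≈⟨ Σ-head s k ⟩
    s 0 + Σ< k (λ k → s (suc k))  ≤⟨ +-mono-≤ s-zero≤ (≤-trans (Σ-mono k λ k _ → s-suc≤t k) (lower-sum≤L k)) ⟩
    p * x + L                     ≈⟨ solve 2 (λ a b → a :+ b := b :+ a) ≃-refl (p * x) L ⟩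
    L + p * x                     ∎

  -- The factor w 0 is carried along because `remainder≤` contains it; it is cancelled after k has
  -- gone to infinity and the remainder has vanished.
  mean-upper : p * m ≤ L + p * x
  mean-upper = *-cancelʳ-≤ 0<w0 (conv-≤ {λ _ → p * m * w 0} {λ k → (L + p * x) * w 0 + p * m * r ^ suc k}
    (ev-always bound≤) (conv-const (p * m * w 0))
    (conv-resp {λ k → (L + p * x) * w 0 + p * m * r ^ suc k} {λ k → (L + p * x) * w 0 + p * m * r ^ suc k} (ev-always λ _ → ≃-refl)
      (solve 2 (λ a b → a :+ b :* con 0ℚ := a) ≃-refl ((L + p * x) * w 0) (p * m))
      (conv-+ {λ _ → (L + p * x) * w 0} {λ k → p * m * r ^ suc k} (conv-const ((L + p * x) * w 0))
        (conv-*ˡ {λ k → r ^ suc k} (p * m) (conv-suc {λ k → r ^ k} r^→0)))))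
    where
    bound≤ : ∀ k → p * m * w 0 ≤ (L + p * x) * w 0 + p * m * r ^ suc k
    bound≤ k = begin
      p * m * w 0 ≈⟨ solve 3 (λ y S w → y :* w := S :* w :+ (y :- S) :* w) ≃-refl (p * m) (Σ< (suc k) s) (w 0) ⟩
      Σ< (suc k) s * w 0 + (p * m - Σ< (suc k) s) * w 0
        ≤⟨ +-mono-≤ (*-monoʳ-≤ (<⇒≤ 0<w0) (partial-sum≤ k)) (remainder≤ (suc k)) ⟩
      (L + p * x) * w 0 + p * m * r ^ suc k ∎

  M : ℝ
  M = proj₁ (exp-exists (p * m) 0≤pm)

  exp-pm : IsExp (p * m) M
  exp-pm = proj₂ (exp-exists (p * m) 0≤pm)

  z≤ : ∀ k → z k ≤ M * (1ℝ - ρ)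
  z≤ k = begin
    z k           ≤⟨ upper-sum k ea ⟩
    a * z 0       ≈⟨ *-cong ≃-refl z-zero ⟩
    a * (1ℝ - ρ)  ≤⟨ *-monoʳ-≤ (<⇒≤ 0<1-ρ) (exp-mono (Σ-nonneg k 0≤s) ea exp-pm (partial≤ k)) ⟩
    M * (1ℝ - ρ)  ∎
    where
    a = proj₁ (exp-Σ {s} 0≤s k)
    ea : IsExp (Σ< k s) a
    ea = proj₂ (exp-Σ {s} 0≤s k)

  -- The points z k tend to 1, so the upper sums exhaust the whole interval [1 - ρ , 1].
  1≤M*[1-ρ] : 1ℝ ≤ M * (1ℝ - ρ)
  1≤M*[1-ρ] = conv-≤ {z} {λ _ → M * (1ℝ - ρ)} (ev-always z≤)
    (conv-resp {λ k → 1ℝ - ρ * r ^ k} {z} (ev-always λ _ → ≃-refl) (solve 1 (λ ρ → con 1ℚ :- ρ :* con 0ℚ :=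
        con 1ℚ) ≃-refl ρ)
      (conv-- {λ _ → 1ℝ} {λ k → ρ * r ^ k} (conv-const 1ℝ) (conv-*ˡ {λ k → r ^ k} ρ r^→0)))
    (conv-const (M * (1ℝ - ρ)))

  κ : ℝ
  κ = fromℕ (suc d) * p * x

  0≤κ : 0ℝ ≤ κ
  0≤κ = *-nonneg (*-nonneg (fromℕ≥0 (suc d)) (<⇒≤ 0<p)) (<⇒≤ 0<x)

  -- Bernoulli's inequality bounds the correction factor 1 + x (1 - u) by 1 + κ, which `exp-lower`
  -- absorbs into the exponent.
  mean-lower : L ≤ p * m + κ
  mean-lower = exp-cancel-≤ (+-nonneg 0≤pm 0≤κ) exp-L eb (begin
    1ℝ + x                       ≈⟨ solve 1 (λ y → y := con 1ℚ :* y) ≃-refl (1ℝ + x) ⟩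
    1ℝ * (1ℝ + x)                ≤⟨ *-monoʳ-≤ (<⇒≤ 0<1+x) 1≤M*[1-ρ] ⟩
    M * (1ℝ - ρ) * (1ℝ + x)      ≈⟨ solve 3 (λ a b c → a :* b :* c := a :* (b :* c))
        ≃-refl M (1ℝ - ρ) (1ℝ + x) ⟩
    M * ((1ℝ - ρ) * (1ℝ + x))    ≈⟨ *-cong ≃-refl [1-ρ]*[1+x] ⟩
    M * (1ℝ + x * (1ℝ - u))      ≤⟨ *-monoˡ-≤ (<⇒≤ (exp-pos 0≤pm exp-pm)) (+-mono-≤ (≤-refl {1ℝ})
                                     (*-monoˡ-≤ (<⇒≤ 0<x) (bernoulli-inequality p (<⇒≤ 0<p) (<⇒≤ p<1) (suc d)))) ⟩
    M * (1ℝ + x * (fromℕ (suc d) * p)) ≈⟨ solve 4 (λ M x n p → M :* (con 1ℚ :+ x :* (n :* p)) :=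
        M :+ n :* p :* x :* M) ≃-refl M x (fromℕ (suc d)) p ⟩
    M + κ * M                    ≤⟨ exp-lower (p * m) κ 0≤pm 0≤κ exp-pm eb ⟩
    b                            ∎)
    where
    b = proj₁ (exp-exists (p * m + κ) (+-nonneg 0≤pm 0≤κ))
    eb : IsExp (p * m + κ) b
    eb = proj₂ (exp-exists (p * m + κ) (+-nonneg 0≤pm 0≤κ))

-- The scaled limit and its uniqueness

-- Which of a and b is smaller is undecidable, but rationals below them can be compared.
rational-between : ∀ {a b} → 0ℝ < a → 0ℝ < b → ∃[ c ] 0ℝ < c × c < a × c < b
rational-between {a} {b} 0<a 0<b =
  let q , 0<q , q<a = rational-below 0<a
      q′ , 0<q′ , q′<b = rational-below 0<b
  in [ (λ q≤q′ → fromℚ q , fromℚ-mono-< 0<q , q<a , ≤-<-trans (fromℚ-mono-≤ q≤q′) q′<b)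
     , (λ q′≤q → fromℚ q′ , fromℚ-mono-< 0<q′ , ≤-<-trans (fromℚ-mono-≤ q′≤q) q<a , q′<b) ]′ (ℚ.≤-total q q′)

module Rates (λH λE : ℝ) {{λH>0 : Positive λH}} {{λE>0 : Positive λE}} where

  0<λH : 0ℝ < λH
  0<λH = Positive.0<x λH>0

  0<λE : 0ℝ < λE
  0<λE = Positive.0<x λE>0

  λH⁻¹ λE⁻¹ x : ℝ
  λH⁻¹ = inverse λH 0<λH
  λE⁻¹ = inverse λE 0<λE
  x = λH / λE

  0<λH⁻¹ : 0ℝ < λH⁻¹
  0<λH⁻¹ = inverse>0 λH 0<λH

  0<λE⁻¹ : 0ℝ < λE⁻¹
  0<λE⁻¹ = inverse>0 λE 0<λE

  0<x : 0ℝ < x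
  0<x = *-pos-ℝ 0<λH 0<λE⁻¹

  x*λE : x * λE ≃ λH
  x*λE = ≃-by λH (*-inverseʳ λE 0<λE) (solve 3 (λ a b i → a :* i :* b := a :+ a :* (b :* i :- con 1ℚ))
      ≃-refl λH λE λE⁻¹)

  abstract
    L : ℝ
    L = Logarithm.L x 0<x

    0≤L : 0ℝ ≤ L
    0≤L = Logarithm.0≤L x 0<x

    isLn : IsLn (1ℝ + x) L
    isLn = Logarithm.isLn x 0<x

  x*λH⁻¹ : x * λH⁻¹ ≃ λE⁻¹
  x*λH⁻¹ = ≃-by λE⁻¹ (*-inverseʳ λH 0<λH) (solve 3 (λ a i j → a :* i :* j := i :+ i :* (a :* j :- con 1ℚ))
      ≃-refl λH λE⁻¹ λH⁻¹)

  waiting-time : ∀ d p → 0ℝ < p → p < 1ℝ → ∃! _≃_ (ChainMatch.IsWaitingTimeH λH λE p 1ℝ (suc d))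
  waiting-time d p 0<p p<1 = m / λH , (m , hasMean , ≃-refl) , unique
    where
    open Solution λH λE p 0<λH 0<λE 0<p p<1 d
    m : ℝ
    m = inverse S 0<S * T
    unique : ∀ {w} → ChainMatch.IsWaitingTimeH λH λE p 1ℝ (suc d) w → m / λH ≃ w
    unique (m′ , isMean , w≃) = ≃-sym (≃-trans w≃ (*-cong (Mean.mean≃ isMean) ≃-refl))

  scaled-limit : ∀ d → IsScaledLimit λH λE (suc d) (L / λH)
  -- Since x / λH is 1 / λE, both error bounds divided by λH are at most N p / λE, and p < η makes
  -- this less than ε.
  scaled-limit d ε 0<ε = η , *-pos-ℝ (*-pos-ℝ 0<ε 0<λE) (inverse>0 N (fromℕ>0 d)) , close
    where
    open ≤-Reasoning
    N = fromℕ (suc d)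
    N⁻¹ = inverse N (fromℕ>0 d)
    η = ε * λE * N⁻¹
    close : ∀ p → 0ℝ < p → p < 1ℝ → p < η → ∀ w → ChainMatch.IsWaitingTimeH λH λE p 1ℝ (suc d) w → ∣ p * w - L / λH ∣< ε
    close p 0<p p<1 p<η w (m , isMean , w≃) = upper , lower
      where
      open Asymptotics λH λE p 0<λH 0<λE 0<p p<1 d m isMean x L 0<x x*λE 0≤L isLn using (mean-upper; mean-lower)
      small-enough : N * (p * λE⁻¹) < ε
      small-enough = begin-strict
        N * (p * λE⁻¹)   ≈⟨ solve 3 (λ n p i → n :* (p :* i) := p :* (n :* i)) ≃-refl N p λE⁻¹ ⟩
        p * (N * λE⁻¹)   <⟨ *-monoʳ-< (*-pos-ℝ (fromℕ>0 d) 0<λE⁻¹) p<η ⟩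
        η * (N * λE⁻¹)   ≈⟨ ≃-by (ε * (λE * λE⁻¹)) (*-inverseʳ N (fromℕ>0 d)) (≃-by ε (*-inverseʳ λE 0<λE)
            (solve 5 (λ e l i n j → e :* l :* j :* (n :* i) :=
                (e :+ e :* (l :* i) :* (n :* j :- con 1ℚ)) :+ e :* (l :* i :- con 1ℚ))
                ≃-refl ε λE λE⁻¹ N N⁻¹)) ⟩
        ε ∎
      1≤N : 1ℝ ≤ N
      1≤N = fromℕ-mono-≤ {1} {suc d} (ℕ.s≤s ℕ.z≤n)
      pw : p * w ≃ p * m * λH⁻¹
      pw = ≃-trans (*-cong ≃-refl w≃) (solve 3 (λ p m i → p :* (m :* i) := p :* m :* i) ≃-refl p m λH⁻¹)
      upper : p * w - L / λH < ε
      upper = begin-strict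
        p * w - L * λH⁻¹             ≈⟨ +-cong pw ≃-refl ⟩
        p * m * λH⁻¹ - L * λH⁻¹      ≤⟨ +-mono-≤ (*-monoʳ-≤ (<⇒≤ 0<λH⁻¹) mean-upper) ≤-refl ⟩
        (L + p * x) * λH⁻¹ - L * λH⁻¹ ≈⟨ solve 4 (λ L p x i → (L :+ p :* x) :* i :- L :* i := p :* (x :* i))
            ≃-refl L p x λH⁻¹ ⟩
        p * (x * λH⁻¹)               ≈⟨ *-cong ≃-refl x*λH⁻¹ ⟩
        p * λE⁻¹                     ≈⟨ solve 1 (λ y → y := con 1ℚ :* y) ≃-refl (p * λE⁻¹) ⟩
        1ℝ * (p * λE⁻¹)              ≤⟨ *-monoʳ-≤ (<⇒≤ (*-pos-ℝ 0<p 0<λE⁻¹)) 1≤N ⟩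
        N * (p * λE⁻¹)               <⟨ small-enough ⟩
        ε ∎
      lower : L / λH - p * w < ε
      lower = begin-strict
        L * λH⁻¹ - p * w             ≈⟨ +-cong ≃-refl (-‿cong pw) ⟩
        L * λH⁻¹ - p * m * λH⁻¹      ≤⟨ +-mono-≤ (*-monoʳ-≤ (<⇒≤ 0<λH⁻¹) mean-lower) ≤-refl ⟩
        (p * m + N * p * x) * λH⁻¹ - p * m * λH⁻¹
          ≈⟨ solve 5 (λ m p x i n → (p :* m :+ n :* p :* x) :* i :- p :* m :* i := n :* (p :* (x :* i)))
              ≃-refl m p x λH⁻¹ N ⟩
        N * (p * (x * λH⁻¹))         ≈⟨ *-cong ≃-refl (*-cong ≃-refl x*λH⁻¹) ⟩
        N * (p * λE⁻¹)               <⟨ small-enough ⟩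
        ε ∎

  -- `IsScaledLimit` constrains nothing at a p without a waiting time. The existence proved in
  -- `waiting-time` provides one p and w at which both limits are tested.
  limit-unique-≤ : ∀ d {ℓ ℓ′} → IsScaledLimit λH λE (suc d) ℓ → IsScaledLimit λH λE (suc d) ℓ′ → ℓ ≤ ℓ′
  limit-unique-≤ d {ℓ} {ℓ′} lim lim′ = ≤-limit {ℓ} {ℓ′} (1ℝ + 1ℝ) λ ε 0<ε →
    let η , 0<η , close = lim ε 0<ε
        η′ , 0<η′ , close′ = lim′ ε 0<ε
        a , 0<a , a<η , a<η′ = rational-between 0<η 0<η′
        p , 0<p , p<a , p<1 = rational-between 0<a 0<1ℝ
        w , isWait , _ = waiting-time d p 0<p p<1
        near = proj₂ (close p 0<p p<1 (<-trans p<a a<η) w isWait)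
        near′ = proj₁ (close′ p 0<p p<1 (<-trans p<a a<η′) w isWait)
    in ≤-by ((ε - (ℓ - p * w)) + (ε - (p * w - ℓ′))) (+-nonneg (x≤y⇒0≤y-x (<⇒≤ near)) (x≤y⇒0≤y-x (<⇒≤ near′)))
         (solve 4 (λ ℓ ℓ′ y e → ℓ′ :+ e :* (con 1ℚ :+ con 1ℚ) := ℓ :+ ((e :- (ℓ :- y)) :+ (e :- (y :- ℓ′))))
             ≃-refl ℓ ℓ′ (p * w) ε)

  limit-unique : ∀ d {ℓ} → IsScaledLimit λH λE (suc d) ℓ → ℓ ≃ L / λH
  limit-unique d lim = ≤-antisym (limit-unique-≤ d lim (scaled-limit d)) (limit-unique-≤ d (scaled-limit d) lim)

-- Monotonicity in the arrival rates

inverse-antitone : ∀ {a b} (0<a : 0ℝ < a) (0<b : 0ℝ < b) → a < b → inverse b 0<b < inverse a 0<a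
inverse-antitone {a} {b} 0<a 0<b a<b = <-by ((b - a) * (i * j)) (*-pos-ℝ (x<y⇒0<y-x a<b) (*-pos-ℝ (inverse>0 a 0<a) (inverse>0 b 0<b)))
  (≃-by (- i) (*-inverseʳ b 0<b) (≃-by j (*-inverseʳ a 0<a)
    (solve 4 (λ a b i j → i :=
        ((j :+ (b :- a) :* (i :* j)) :+ :- i :* (b :* j :- con 1ℚ)) :+ j :* (a :* i :- con 1ℚ))
        ≃-refl a b i j)))
  where
  i = inverse a 0<a
  j = inverse b 0<b

-- Squaring exp (t / 2) (1 - t / 2) ≤ 1 gains t² / 4 over exp t (1 - t) ≤ 1.
log-lower : ∀ {x L t} → 0ℝ < x → 0ℝ < t → 0ℝ ≤ L → t * (1ℝ + x) ≃ x → IsExp L (1ℝ + x) → t < L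
log-lower {x} {L} {t} 0<x 0<t 0≤L t*[1+x] exp-L = exp-cancel-< (<⇒≤ 0<t) 0≤L ea exp-L a<1+x
  where
  open ≤-Reasoning
  h = t * fromℚ ½
  0<h : 0ℝ < h
  0<h = half>0ℝ 0<t
  h+h : h + h ≃ t
  h+h = solve 1 (λ t → t :* con ½ :+ t :* con ½ := t) ≃-refl t
  b = proj₁ (exp-exists h (<⇒≤ 0<h))
  eb : IsExp h b
  eb = proj₂ (exp-exists h (<⇒≤ 0<h))
  a = proj₁ (exp-exists t (<⇒≤ 0<t))
  ea : IsExp t a
  ea = proj₂ (exp-exists t (<⇒≤ 0<t))
  0<1+x : 0ℝ < 1ℝ + x
  0<1+x = +-pos 0<1ℝ 0<x
  t<1 : t < 1ℝ
  t<1 = 0<y-x⇒x<y (<-respʳ-≃ 1-t≃ (inverse>0 (1ℝ + x) 0<1+x))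
    where
    1-t≃ : inverse (1ℝ + x) 0<1+x ≃ 1ℝ - t
    1-t≃ = *-cancelʳ-≃ 0<1+x (≃-by 1ℝ (*-inverseʳ (1ℝ + x) 0<1+x) (≃-by 1ℝ t*[1+x]
      (solve 3 (λ x t i → i :* (con 1ℚ :+ x) :=
          ((con 1ℚ :- t) :* (con 1ℚ :+ x) :+ con 1ℚ :* ((con 1ℚ :+ x) :* i :- con 1ℚ)) :+ con 1ℚ :* (t :* (con 1ℚ :+ x) :- x)) ≃-refl x t (inverse (1ℝ + x) 0<1+x))))
  0≤1-h : 0ℝ ≤ 1ℝ - h
  0≤1-h = x≤y⇒0≤y-x (<⇒≤ (<-trans (half<ℝ 0<t) t<1))
  b≤ : b ≤ 1ℝ + h * b
  b≤ = exp-upper 0ℝ h ≤-refl (<⇒≤ 0<h) exp-zero (exp-cong (solve 1 (λ h → h := con 0ℚ :+ h)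
      ≃-refl h) (≃-refl {b}) eb)
  a≤ : a ≤ b + h * a
  a≤ = exp-upper h h (<⇒≤ 0<h) (<⇒≤ 0<h) eb (exp-cong (≃-sym h+h) (≃-refl {a}) ea)
  a<1+x : a < 1ℝ + x
  a<1+x = <-by (a * h * h * (1ℝ + x) + ((b + h * a - a) * (1ℝ - h) + (1ℝ + h * b - b)) * (1ℝ + x))
    (<-≤-trans (*-pos-ℝ (*-pos-ℝ (*-pos-ℝ (exp-pos (<⇒≤ 0<t) ea) 0<h) 0<h) 0<1+x)
      (≤-by _ (*-nonneg (+-nonneg (*-nonneg (x≤y⇒0≤y-x a≤) 0≤1-h) (x≤y⇒0≤y-x b≤)) (<⇒≤ 0<1+x)) ≃-refl))
    (≃-by (- a) t*[1+x] (solve 4 (λ a b t x → let h = t :* con ½ in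
      con 1ℚ :+ x := (a :+ (a :* h :* h :* (con 1ℚ :+ x) :+ ((b :+ h :* a :- a) :* (con 1ℚ :- h) :+ (con 1ℚ :+ h :* b :- b)) :* (con 1ℚ :+ x)))
         :+ :- a :* (t :* (con 1ℚ :+ x) :- x)) ≃-refl a b t x))

decreasing-λE : ∀ (λH λE λE′ : ℝ) {{_ : Positive λH}} {{_ : Positive λE}} {{_ : Positive λE′}} → λE < λE′ →
  Rates.L λH λE′ / λH < Rates.L λH λE / λH
decreasing-λE λH λE λE′ λE<λE′ = *-monoʳ-< {R′.L} {R.L} {R.λH⁻¹} R.0<λH⁻¹ L′<L
  where
  module R = Rates λH λE
  module R′ = Rates λH λE′
  x = R.x
  x′ = R′.x
  x′<x : x′ < x
  x′<x = <-by (λH * (R.λE⁻¹ - R′.λE⁻¹)) (*-pos-ℝ R.0<λH (x<y⇒0<y-x (inverse-antitone R.0<λE R′.0<λE λE<λE′)))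
    (solve 3 (λ a i j → a :* i := a :* j :+ a :* (i :- j)) ≃-refl λH R.λE⁻¹ R′.λE⁻¹)
  1+x′<1+x : 1ℝ + x′ < 1ℝ + x
  1+x′<1+x = <-by (x - x′) (x<y⇒0<y-x x′<x) (solve 2 (λ x x′ → con 1ℚ :+ x := con 1ℚ :+ x′ :+ (x :- x′))
      ≃-refl x x′)
  L′<L : R′.L < R.L
  L′<L = exp-cancel-< {R′.L} {R.L} {1ℝ + x′} {1ℝ + x} R′.0≤L R.0≤L R′.isLn R.isLn 1+x′<1+x

-- ln (1 + x) / x is decreasing: its numerator grows at rate 1 / (1 + x) < ln (1 + x) / x.
decreasing-λH : ∀ (λH λH′ λE : ℝ) {{_ : Positive λH}} {{_ : Positive λH′}} {{_ : Positive λE}} → λH < λH′ →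
  Rates.L λH′ λE / λH′ < Rates.L λH λE / λH
decreasing-λH λH λH′ λE λH<λH′ = <-respˡ-≃ scale′ (<-respʳ-≃ scale (*-monoʳ-< 0<c L′x<Lx′))
  where
  open ≤-Reasoning
  module R = Rates λH λE
  module R′ = Rates λH′ λE
  x = R.x
  x′ = R′.x
  L = R.L
  L′ = R′.L
  0<1+x : 0ℝ < 1ℝ + x
  0<1+x = +-pos 0<1ℝ R.0<x
  i = inverse (1ℝ + x) 0<1+x
  0<i = inverse>0 (1ℝ + x) 0<1+x
  0<x′-x : 0ℝ < x′ - x
  0<x′-x = <-respʳ-≃ (solve 3 (λ a b i → (b :- a) :* i := b :* i :- a :* i) ≃-refl λH λH′ R.λE⁻¹)
    (*-pos-ℝ (x<y⇒0<y-x λH<λH′) R.0<λE⁻¹)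
  -- The tangent of ln at 1 + x gives L′ ≤ L + s. Since s x = t (x′ - x), the bound t < L turns this
  -- into L′ x < L x′.
  s = (x′ - x) * i
  t = x * i
  0<s : 0ℝ < s
  0<s = *-pos-ℝ 0<x′-x 0<i
  t<L : t < L
  t<L = log-lower R.0<x (*-pos-ℝ R.0<x 0<i) R.0≤L
    (≃-by x (*-inverseʳ (1ℝ + x) 0<1+x) (solve 2 (λ x i → x :* i :* (con 1ℚ :+ x) :=
        x :+ x :* ((con 1ℚ :+ x) :* i :- con 1ℚ)) ≃-refl x i)) R.isLn
  0≤L+s : 0ℝ ≤ L + s
  0≤L+s = +-nonneg R.0≤L (<⇒≤ 0<s)
  b = proj₁ (exp-exists (L + s) 0≤L+s)
  eb : IsExp (L + s) b
  eb = proj₂ (exp-exists (L + s) 0≤L+s)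
  L′≤L+s : L′ ≤ L + s
  L′≤L+s = exp-cancel-≤ 0≤L+s R′.isLn eb (begin
    1ℝ + x′ ≈⟨ ≃-by (- (x′ - x)) (*-inverseʳ (1ℝ + x) 0<1+x)
       (solve 3 (λ x x′ i → con 1ℚ :+ x′ :=
           (con 1ℚ :+ x :+ (x′ :- x) :* i :* (con 1ℚ :+ x)) :+ :- (x′ :- x) :* ((con 1ℚ :+ x) :* i :- con 1ℚ)) ≃-refl x x′ i) ⟩
    1ℝ + x + s * (1ℝ + x) ≤⟨ exp-lower L s R.0≤L (<⇒≤ 0<s) R.isLn eb ⟩
    b ∎)
  L′x<Lx′ : L′ * x < L * x′
  L′x<Lx′ = <-by ((L + s - L′) * x + (L - t) * (x′ - x))
    (+-nonneg-pos (*-nonneg (x≤y⇒0≤y-x L′≤L+s) (<⇒≤ R.0<x)) (*-pos-ℝ (x<y⇒0<y-x t<L) 0<x′-x))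
    (solve 5 (λ L L′ x x′ i → L :* x′ :=
        L′ :* x :+ ((L :+ (x′ :- x) :* i :- L′) :* x :+ (L :- x :* i) :* (x′ :- x))) ≃-refl L L′ x x′ i)
  -- Multiplication by c turns x into 1 / λH′ and x′ into 1 / λH.
  c = λE * (R.λH⁻¹ * R′.λH⁻¹)
  0<c : 0ℝ < c
  0<c = *-pos-ℝ R.0<λE (*-pos-ℝ R.0<λH⁻¹ R′.0<λH⁻¹)
  scale′ : L′ * x * c ≃ L′ / λH′
  scale′ = ≃-by (L′ * R.λH⁻¹ * R′.λH⁻¹) R.x*λE (≃-by (L′ * R′.λH⁻¹) (*-inverseʳ λH R.0<λH)
    (solve 6 (λ L x lE lH i j → L :* x :* (lE :* (i :* j)) :=
        (L :* j :+ L :* i :* j :* (x :* lE :- lH)) :+ L :* j :* (lH :* i :- con 1ℚ))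
        ≃-refl L′ x λE λH R.λH⁻¹ R′.λH⁻¹))
  scale : L * x′ * c ≃ L / λH
  scale = ≃-by (L * R.λH⁻¹ * R′.λH⁻¹) R′.x*λE (≃-by (L * R.λH⁻¹) (*-inverseʳ λH′ R′.0<λH)
    (solve 6 (λ L x lE lH i j → L :* x :* (lE :* (i :* j)) :=
        (L :* i :+ L :* i :* j :* (x :* lE :- lH)) :+ L :* i :* (lH :* j :- con 1ℚ))
        ≃-refl L x′ λE λH′ R.λH⁻¹ R′.λH⁻¹))

-- Existence of the waiting time keeps the limit statement from being vacuous, and uniqueness makes
-- it a function of pH. The monotonicity claims range over arbitrary limits, which `limit-unique`
-- identifies with the explicit values.
proposition1 : ∀ (d : ℕ) → 1 ℕ.≤ d →
    (∀ (λH λE : ℝ) {{_ : Positive λH}} {{_ : Positive λE}} →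
    (∀ pH → 0ℝ < pH → pH < 1ℝ →
    ∃! _≃_ (ChainMatch.IsWaitingTimeH λH λE pH 1ℝ d))
    × (∃[ L ] IsLn (λH / λE + 1ℝ) L × IsScaledLimit λH λE d (L / λH)))
    × (∀ (λH λE λE′ : ℝ) {{_ : Positive λH}} {{_ : Positive λE}} {{_ : Positive λE′}} →
    λE < λE′ →
    ∀ ℓ ℓ′ → IsScaledLimit λH λE d ℓ → IsScaledLimit λH λE′ d ℓ′ → ℓ′ < ℓ)
    × (∀ (λH λH′ λE : ℝ) {{_ : Positive λH}} {{_ : Positive λH′}} {{_ : Positive λE}} →
    λH < λH′ →
    ∀ ℓ ℓ′ → IsScaledLimit λH λE d ℓ → IsScaledLimit λH′ λE d ℓ′ → ℓ′ < ℓ)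
proposition1 (suc d) _ =
    (λ λH λE → Rates.waiting-time λH λE d , Rates.L λH λE
      , exp-cong ≃-refl (solve 1 (λ y → con 1ℚ :+ y := y :+ con 1ℚ) ≃-refl (λH / λE)) (Rates.isLn λH λE)
      , Rates.scaled-limit λH λE d)
  , (λ λH λE λE′ λE<λE′ ℓ ℓ′ lim lim′ → <-respˡ-≃ (≃-sym (Rates.limit-unique λH λE′ d lim′))
      (<-respʳ-≃ (≃-sym (Rates.limit-unique λH λE d lim)) (decreasing-λE λH λE λE′ λE<λE′)))
  , (λ λH λH′ λE λH<λH′ ℓ ℓ′ lim lim′ → <-respˡ-≃ (≃-sym (Rates.limit-unique λH′ λE d lim′))
      (<-respʳ-≃ (≃-sym (Rates.limit-unique λH λE d lim)) (decreasing-λH λH λH′ λE λH<λH′)))
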